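{- There is an absolute constant $C>0$ such that the following holds. Let $\mathcal{A}=\mathrm{Greedy}_3$ (the greedy algorithm using contraction Rule 3) and let $\mathcal{I}$ be an instance of online Steiner Forest with $k\ge 3$ pairs. Then $$\mathrm{cost}_{\mathcal{A}}(\mathcal{I})\le C\cdot\log(k)\,\log\log(k)\cdot w(T^\star(\mathcal{I})),$$ where $T^\star(\mathcal{I})$ is the optimum tree solution to $\mathcal{I}$, i.e. a minimum-weight feasible solution among those consisting of a single connected component.
   Context: Logarithms are in base 2. Online Steiner Forest. An instance $\mathcal{I}$ consists of a finite undirected weighted graph $G=(V,E,w)$ with $w:E\to\mathbb{R}_{\ge 0}$ and an ordered sequence $\mathcal{P}=(p_1,\dots,p_k)$ of pairs $p_i=\{s_i,t_i\}$ of vertices, revealed one by one. The vertices appearing in some pair are called terminals. A feasible solution is a subgraph of $G$ in which $s_i$ and $t_i$ are connected for every $i$. A tree solution is a feasible solution that is a single tree (hence contains all terminals); $w(T^\star(\mathcal{I}))$ is the minimum total weight of a tree solution (such a solution is assumed to exist). $\mathrm{Greedy}_3$. The algorithm maintains graphs $G^{(\tau)}=(V,E\cup S^{(\tau)})$, where $S^{(0)}=\emptyset$ and $S^{(0)}\subseteq S^{(1)}\subseteq\cdots\subseteq S^{(k)}$ are sets of edges of weight $0$ on $V$ called shortcuts. When pair $p_{\tau+1}=\{s,t\}$ arrives, the algorithm takes a shortest $s$–$t$ path in $G^{(\tau)}$ (ties broken arbitrarily) and pays $d_{G^{(\tau)}}(s,t)$, its length. Then Rule 3 is applied: let $s=v'_0,v'_1,\dots,v'_{\ell'},v'_{\ell'+1}=t$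 be the subsequence of the path consisting of $s$, $t$ and those path vertices that appeared in a previously arrived pair; $S^{(\tau+1)}$ is $S^{(\tau)}$ together with a weight-0 edge $\{v'_j,v'_{j+1}\}$ for all $0\le j\le\ell'$. $\mathrm{cost}_{\mathcal{A}}(\mathcal{I})$ is the sum of the costs paid over all pairs. -}

module Defs where

open import Algebra.Apartness.Bundles using (HeytingField; HeytingCommutativeRing)
open import Algebra.Bundles using (CommutativeRing; Semiring)
import Algebra.Definitions.RawSemiring as RawSemiringDefinitions
open import Data.Fin.Base using (Fin)
open import Data.Fin.Properties using (_≟_)
open import Data.Fin.Subset using (Subset; _∈_)
open import Data.Fin.Subset.Properties using (_∈?_)
open import Data.List.Base using (List; []; _∷_; _++_; length; lookup; map; foldr; filter; zip; drop; allFin)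
import Data.List.Membership.DecPropositional as DecMembership
open import Data.List.Relation.Unary.All using (All)
open import Data.List.Relation.Unary.Unique.Propositional using (Unique)
open import Data.Nat.Base as ℕ using (ℕ)
open import Data.Product.Base using (∃-syntax; Σ-syntax; _×_; _,_; uncurry)
open import Data.Sum.Base using (_⊎_)
open import Function.Bundles using (_⇔_)
open import Level using (Level; _⊔_; suc)
open import Relation.Binary.Core using (Rel)
open import Relation.Binary.Definitions using (Cotransitive)
open import Relation.Binary.PropositionalEquality using (_≡_; _≢_)
open import Relation.Binary.Structures using (IsStrictPartialOrder)
open import Relation.Nullary.Decidable using (_⊎-dec_)
open import Relation.Nullary.Negation using (¬_)

-- The real numbers, axiomatised as a Cauchy-complete Archimedean ordered
-- field.  Classically these axioms determine ℝ up to isomorphism.  They are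
-- phrased constructively (apartness, cotransitivity, ≤ as the negation of the
-- converse <) so that they are also those satisfied by Bishop's reals.
record RealField (c ℓ₁ ℓ₂ : Level) : Set (suc (c ⊔ ℓ₁ ⊔ ℓ₂)) where
  field
    heytingField : HeytingField c ℓ₁ ℓ₂

  open HeytingField heytingField public

  infix 4 _<_ _≤_

  field
    _<_                  : Rel Carrier ℓ₂
    isStrictPartialOrder : IsStrictPartialOrder _≈_ _<_
    <-cotrans            : Cotransitive _<_
    #⇔<⊎>                : ∀ {x y} → (x # y) ⇔ (x < y ⊎ y < x)
    +-monoˡ-<            : ∀ {x y} z → x < y → x + z < y + z
    *-pos                : ∀ {x y} → 0# < x → 0# < y → 0# < x * y

  _≤_ : Rel Carrier ℓ₂
  x ≤ y = ¬ (y < x)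

  commutativeRing : CommutativeRing c ℓ₁
  commutativeRing = HeytingCommutativeRing.commutativeRing heytingCommutativeRing

  open RawSemiringDefinitions (Semiring.rawSemiring (CommutativeRing.semiring commutativeRing)) public
    using (_^_) renaming (_×_ to _·_)

  fromℕ : ℕ → Carrier
  fromℕ n = n · 1#

  IsCauchy : (ℕ → Carrier) → Set (c ⊔ ℓ₂)
  IsCauchy x = ∀ ε → 0# < ε → ∃[ N ] (∀ i j → N ℕ.≤ i → N ℕ.≤ j → x i < x j + ε)

  _ConvergesTo_ : (ℕ → Carrier) → Carrier → Set (c ⊔ ℓ₂)
  x ConvergesTo l =
    ∀ ε → 0# < ε → ∃[ N ] (∀ i → N ℕ.≤ i → x i < l + ε × l < x i + ε)

  field
    archimedean : ∀ x → ∃[ n ] x < fromℕ n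
    complete    : ∀ x → IsCauchy x → ∃[ l ] x ConvergesTo l

  -- y is the base-2 logarithm of x: each rational r = (p - q) / n (n > 0)
  -- compares with y exactly as 2 ^ r compares with x.  Denominators and
  -- negative exponents are cleared; for n = 0 the condition holds trivially.
  _IsLog₂Of_ : Carrier → Carrier → Set ℓ₂
  y IsLog₂Of x = ∀ n p q →
    ((fromℕ p < fromℕ n * y + fromℕ q) ⇔ (fromℕ 2 ^ p < x ^ n * fromℕ 2 ^ q)) ×
    ((fromℕ n * y + fromℕ q < fromℕ p) ⇔ (x ^ n * fromℕ 2 ^ q < fromℕ 2 ^ p))

module SteinerForest {c ℓ₁ ℓ₂} (ℝ : RealField c ℓ₁ ℓ₂) where

  open RealField ℝ using (Carrier; 0#; _+_; _≤_)

  ∑ : List Carrier → Carrier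
  ∑ = foldr _+_ 0#

  record Edge (n : ℕ) : Set c where
    constructor edge
    field
      end₁ end₂ : Fin n
      weight    : Carrier

  open Edge public

  -- An edge of G is a position in the list, so that E ∪ S is concatenation
  -- and a shortcut may be parallel to an edge of positive weight.
  Graph : ℕ → Set c
  Graph n = List (Edge n)

  EdgeOf : ∀ {n} → Graph n → Set
  EdgeOf G = Fin (length G)

  edgeWeight : ∀ {n} (G : Graph n) → EdgeOf G → Carrier
  edgeWeight G e = weight (lookup G e)

  Joins : ∀ {n} → Edge n → Fin n → Fin n → Set
  Joins e u v = (end₁ e ≡ u × end₂ e ≡ v) ⊎ (end₁ e ≡ v × end₂ e ≡ u)

  data Walk {n} (G : Graph n) : Fin n → Fin n → Set where
    nil  : ∀ {u} → Walk G u u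
    step : ∀ {u v w} (e : EdgeOf G) → Joins (lookup G e) u v → Walk G v w → Walk G u w

  module _ {n} {G : Graph n} where

    vertices : ∀ {u v} → Walk G u v → List (Fin n)
    vertices {u} nil          = u ∷ []
    vertices {u} (step _ _ p) = u ∷ vertices p

    edges : ∀ {u v} → Walk G u v → List (EdgeOf G)
    edges nil          = []
    edges (step e _ p) = e ∷ edges p

    len : ∀ {u v} → Walk G u v → Carrier
    len p = ∑ (map (edgeWeight G) (edges p))

    IsPath : ∀ {u v} → Walk G u v → Set
    IsPath p = Unique (vertices p)

    IsShortestPath : ∀ {u v} → Walk G u v → Set ℓ₂
    IsShortestPath {u} {v} p = IsPath p × (∀ (q : Walk G u v) → IsPath q → len p ≤ len q)

    -- The base point occurs at both ends of the vertex list, hence the drop.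
    -- Distinctness of the edges excludes going back and forth along one edge.
    IsCycle : ∀ {u} → Walk G u u → Set
    IsCycle p = edges p ≢ [] × Unique (edges p) × Unique (drop 1 (vertices p))

  record Subgraph {n} (G : Graph n) : Set where
    field
      V′     : Subset n
      E′     : Subset (length G)
      closed : ∀ {e} → e ∈ E′ → end₁ (lookup G e) ∈ V′ × end₂ (lookup G e) ∈ V′

  open Subgraph public

  module _ {n} {G : Graph n} where

    _Within_ : ∀ {u v} → Walk G u v → Subgraph G → Set
    p Within H = All (_∈ E′ H) (edges p)

    ConnectedIn : Subgraph G → Fin n → Fin n → Set
    ConnectedIn H u v = u ∈ V′ H × v ∈ V′ H × (Σ[ p ∈ Walk G u v ] p Within H)

    IsTree : Subgraph G → Set
    IsTree H = (∀ {u v} → u ∈ V′ H → v ∈ V′ H → ConnectedIn H u v)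
             × (∀ {u} (p : Walk G u u) → p Within H → ¬ IsCycle p)

    totalWeight : Subgraph G → Carrier
    totalWeight H = ∑ (map (edgeWeight G) (filter (_∈? E′ H) (allFin (length G))))

  record Instance : Set (c ⊔ ℓ₂) where
    field
      size   : ℕ
      graph  : Graph size
      nonneg : All (λ e → 0# ≤ weight e) graph
      pairs  : List (Fin size × Fin size)

    #pairs : ℕ
    #pairs = length pairs

  module _ (I : Instance) where
    open Instance I

    IsFeasible : Subgraph graph → Set
    IsFeasible H = All (uncurry (ConnectedIn H)) pairs

    IsTreeSolution : Subgraph graph → Set
    IsTreeSolution T = IsFeasible T × IsTree T

    IsOptimalTreeSolution : Subgraph graph → Set ℓ₂
    IsOptimalTreeSolution T =
      IsTreeSolution T × (∀ T′ → IsTreeSolution T′ → totalWeight T ≤ totalWeight T′)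

  Shortcuts : ℕ → Set
  Shortcuts n = List (Fin n × Fin n)

  _⊕_ : ∀ {n} → Graph n → Shortcuts n → Graph n
  G ⊕ S = G ++ map (λ (u , v) → edge u v 0#) S

  -- The shortcuts added by Rule 3; `seen` lists the vertices of the previously
  -- arrived pairs.
  rule₃ : ∀ {n} {G : Graph n} → List (Fin n) → ∀ {s t} → Walk G s t → Shortcuts n
  rule₃ {n} seen {s} {t} p = zip v′ (drop 1 v′)
    where
    open DecMembership (_≟_ {n}) using () renaming (_∈?_ to _∈ˡ?_)
    v′ : List (Fin n)
    v′ = filter (λ v → (v ≟ s) ⊎-dec ((v ≟ t) ⊎-dec (v ∈ˡ? seen))) (vertices p)

  -- The executions of Greedy₃ on the pairs still to arrive, from a state given
  -- by the terminals seen and the shortcuts added so far.  Ties are broken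
  -- arbitrarily, so there may be several.
  data Run {n} (G : Graph n) (seen : List (Fin n)) (S : Shortcuts n) :
           List (Fin n × Fin n) → Set (c ⊔ ℓ₂) where
    done  : Run G seen S []
    serve : ∀ {s t ps} (p : Walk (G ⊕ S) s t) → IsShortestPath p →
            Run G (s ∷ t ∷ seen) (S ++ rule₃ seen p) ps →
            Run G seen S ((s , t) ∷ ps)

  cost : ∀ {n} {G : Graph n} {seen S ps} → Run G seen S ps → Carrier
  cost done          = 0#
  cost (serve p _ r) = len p + cost r

  Greedy₃ : Instance → Set (c ⊔ ℓ₂)
  Greedy₃ I = Run (Instance.graph I) [] [] (Instance.pairs I)

{-# OPTIONS --safe #-}
module Submission where

open import Defs
open import Algebra.Bundles using (CommutativeRing)
import Algebra.Properties.Ring as RingProperties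
import Algebra.Properties.Semiring.Mult as Mult
import Algebra.Solver.Ring.NaturalCoefficients.Default as RingSolver
open import Data.Fin.Base using (Fin; zero; suc)
import Data.Fin.Base as Fin
import Data.Fin.Properties as Finₚ
import Data.Fin.Subset as Subset
import Data.Fin.Subset.Properties as Subsetₚ
open import Data.List.Base using (List; []; _∷_; _++_; length; lookup; map; filter; zip; drop; allFin)
open import Data.List.Membership.Propositional using (_∈_)
import Data.List.Membership.DecPropositional as DecMembership
open import Data.List.Membership.Propositional.Properties
open import Data.List.Properties using (length-++; map-++; map-tabulate; tabulate-lookup; filter-accept)
open import Data.List.Relation.Binary.Subset.Propositional using (_⊆_)
open import Data.List.Relation.Unary.All as All using (All; []; _∷_)
import Data.List.Relation.Unary.All.Properties as Allₚ
open import Data.List.Relation.Unary.AllPairs as AllPairs using (AllPairs; []; _∷_)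
open import Data.List.Relation.Unary.Any as Any using (here; there)
import Data.List.Relation.Unary.Any.Properties as Anyₚ
open import Data.List.Relation.Unary.Unique.Propositional using (Unique)
import Data.List.Relation.Unary.Unique.Propositional.Properties as Uniqueₚ
open import Data.Nat.Base as ℕ using (ℕ)
open import Data.Nat.ListAction using (sum)
import Data.Nat.Properties as ℕₚ
open import Data.Nat.Tactic.RingSolver using (solve-∀)
open import Data.Product.Base as Product using (_×_; _,_; proj₁; proj₂; ∃-syntax; Σ-syntax)
open import Data.Sum.Base using (_⊎_; inj₁; inj₂; [_,_]′; swap)
open import Function.Base using (_∘_; id)
open import Function.Bundles using (Equivalence)
open import Level as Universe using (_⊔_)
open import Relation.Binary.PropositionalEquality as ≡ using (_≡_)
open import Relation.Binary.Structures using (IsStrictPartialOrder)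
open import Relation.Nullary.Decidable using (Dec; yes; no; _⊎-dec_)
open import Relation.Nullary.Negation using (¬_; contradiction)
open import Relation.Unary using (Decidable)

-- Rule 3 splits every served path into segments between consecutive terminals that consist of
-- edges of G only; their lengths add up to the cost, and no walk that may use the earlier
-- segments for free is shorter than a segment.  Measured in small units, the distances of G
-- become an integral metric D, and a tour around the optimal tree maps the terminals to
-- {0, …, M} with D at most the difference of positions and M about twice the weight of the tree.
--
-- Sort the segments by length into levels [2 ^ l, 2 ^ (l + 1)), and the levels into O(log log k)
-- classes such that consecutive levels of a class differ by a factor polylogarithmic in k.  The
-- claim is that a class costs O(M log k).  If the segments of one level have length d, contract
-- balls of radius r = Θ(d / log k) around a net of their ends: a short cycle would make its
-- last segment too long, so the resulting graph has large girth and its edges are at most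
-- twice the net points.  It remains to pay r for each net point.  Going from short to long
-- segments, every net point kills r / 4 positions of its ball, under the invariant that each
-- window of distances from any terminal still contains almost its length in live positions.
-- If few net points meet a longer window of the next level, few of its positions die.  If many
-- do, the girth argument at the larger radius Θ(d / log log k) shows that the window contains
-- far more live positions than its length, and a killer spares at least half of its ball.

-- Charging each level separately is too expensive: about `log k` levels matter, and each loses a
-- factor `log k` because its segments may be contracted only at radius d / log k. The levels of a
-- class must share one supply of positions, although balls of long segments may contain many
-- killers of short ones. With J of order log k / log log k levels in a class, a level may cost a
-- window the fraction 1 / (2J), so that half of it stays alive to the end. This pays for K = Λ / J
-- killers, where Λ is the ratio of consecutive levels. In a window with more killers only K + 1 of
-- them are inspected. The girth argument then excludes only cycles of length O(log K) = O(log log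
-- k), which permits a radius larger by a factor of order J, and the disjoint balls of this radius
-- hold twice as many live positions as the window is long.
--
-- Real distances are rounded by choices that are classical. They are made under double negation,
-- which is harmless because `_≤_` on the reals is a negation.

module Combinatorics where

  open import Data.Bool.Base using (Bool; true; false; not; if_then_else_)
  open import Data.Bool.Properties using () renaming (_≟_ to _≟ᵇ_)
  open import Data.Empty using (⊥; ⊥-elim)
  open import Data.Fin.Base using (toℕ)
  open import Data.List.Base using (foldr; take; upTo)
  open import Data.List.Membership.Propositional using (_∉_; find)
  open import Data.List.Properties using (length-map; length-take; length-filter; filter-all; length-tabulate; length-upTo)
  import Data.List.Relation.Unary.AllPairs.Properties as AllPairsₚ
  open import Data.List.Relation.Unary.Any using (Any)
  open import Data.Nat.Base hiding (_⊔_)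
  open import Data.Nat.DivMod using (_/_; _%_; m≡m%n+[m/n]*n; m%n<n; m/n*n≤m; m/n≤m)
  open import Data.Nat.Properties
  open import Relation.Binary.Core using (Rel)
  open import Relation.Binary.Definitions using (DecidableEquality; Symmetric; tri<; tri≈; tri>)
  open import Relation.Binary.PropositionalEquality using (_≢_; refl; sym; trans; cong; cong₂; subst; module ≡-Reasoning)
  open import Relation.Nullary.Decidable using (¬?; _×-dec_; does)
  open import Relation.Unary using (Pred)

  -- Counting in lists: packing disjoint sets, deleting elements

  module _ {a} {A : Set a} where

    count : ∀ {p} {P : Pred A p} → Decidable P → List A → ℕ
    count P? xs = length (filter P? xs)

    count-mono : ∀ {p q} {P : Pred A p} {Q : Pred A q} (P? : Decidable P) (Q? : Decidable Q) →
                 (∀ x → P x → Q x) → ∀ xs → count P? xs ≤ count Q? xs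
    count-mono P? Q? P⇒Q [] = z≤n
    count-mono P? Q? P⇒Q (x ∷ xs) with ih ← count-mono P? Q? P⇒Q xs | P? x | Q? x
    ... | yes _  | yes _  = s≤s ih
    ... | yes px | no ¬qx = contradiction (P⇒Q x px) ¬qx
    ... | no _   | yes _  = m≤n⇒m≤1+n ih
    ... | no _   | no _   = ih

    count-disjoint : ∀ {p q r} {P : Pred A p} {Q : Pred A q} {R : Pred A r}
                     (P? : Decidable P) (Q? : Decidable Q) (R? : Decidable R) →
                     (∀ x → P x → ¬ Q x) → (∀ x → P x → R x) → (∀ x → Q x → R x) →
                     ∀ xs → count P? xs + count Q? xs ≤ count R? xs
    count-disjoint P? Q? R? P⇒¬Q P⇒R Q⇒R [] = z≤n
    count-disjoint P? Q? R? P⇒¬Q P⇒R Q⇒R (x ∷ xs)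
      with ih ← count-disjoint P? Q? R? P⇒¬Q P⇒R Q⇒R xs | P? x | Q? x | R? x
    ... | yes px | yes qx | _      = contradiction qx (P⇒¬Q x px)
    ... | yes px | no _   | no ¬rx = contradiction (P⇒R x px) ¬rx
    ... | yes _  | no _   | yes _  = s≤s ih
    ... | no _   | yes qx | no ¬rx = contradiction (Q⇒R x qx) ¬rx
    ... | no _   | yes _  | yes _  = ≤-trans (≤-reflexive (+-suc (count P? xs) _)) (s≤s ih)
    ... | no _   | no _   | yes _  = m≤n⇒m≤1+n ih
    ... | no _   | no _   | no _   = ih

    allPairs-lookup : ∀ {r} {R : Rel A r} → Symmetric R → ∀ {xs} → AllPairs R xs →
                      ∀ {x y} → x ∈ xs → y ∈ xs → x ≡ y ⊎ R x y
    allPairs-lookup R-sym (Rx ∷ Rxs) (here refl) (here refl) = inj₁ refl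
    allPairs-lookup R-sym (Rx ∷ Rxs) (here refl) (there y∈)  = inj₂ (All.lookup Rx y∈)
    allPairs-lookup R-sym (Rx ∷ Rxs) (there x∈)  (here refl) = inj₂ (R-sym (All.lookup Rx x∈))
    allPairs-lookup R-sym (Rx ∷ Rxs) (there x∈)  (there y∈)  = allPairs-lookup R-sym Rxs x∈ y∈

    take-⊆ : ∀ n (xs : List A) → take n xs ⊆ xs
    take-⊆ (suc n) (x ∷ xs) (here p)   = here p
    take-⊆ (suc n) (x ∷ xs) (there y∈) = there (take-⊆ n xs y∈)

    remove : ∀ {x : A} {ys} → x ∈ ys → List A
    remove {ys = y ∷ ys} (here _)   = ys
    remove {ys = y ∷ ys} (there x∈) = y ∷ remove x∈

    length-remove : ∀ {x : A} {ys} (x∈ : x ∈ ys) → suc (length (remove x∈)) ≡ length ys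
    length-remove (here _)   = refl
    length-remove (there x∈) = cong suc (length-remove x∈)

    ∈-remove : ∀ {x z : A} {ys} (x∈ : x ∈ ys) → z ∈ ys → z ≢ x → z ∈ remove x∈
    ∈-remove (here refl) (here refl) z≢x = contradiction refl z≢x
    ∈-remove (here refl) (there z∈)  z≢x = z∈
    ∈-remove (there x∈)  (here refl) z≢x = here refl
    ∈-remove (there x∈)  (there z∈)  z≢x = there (∈-remove x∈ z∈ z≢x)

    unique⊆⇒length≤ : ∀ {xs ys : List A} → Unique xs → xs ⊆ ys → length xs ≤ length ys
    unique⊆⇒length≤ {[]}     _            _     = z≤n
    unique⊆⇒length≤ {x ∷ xs} {ys} (x∉ ∷ xs!) xs⊆ys =
      ≤-trans (s≤s (unique⊆⇒length≤ xs! λ {z} z∈ →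
                      ∈-remove x∈ (xs⊆ys (there z∈)) (λ { refl → All.lookup x∉ z∈ refl })))
              (≤-reflexive (length-remove x∈))
      where x∈ = xs⊆ys (here refl)

    map-unique : ∀ {b} {B : Set b} {f : A → B} {xs} → Unique xs →
                 (∀ {x y} → x ∈ xs → y ∈ xs → f x ≡ f y → x ≡ y) → Unique (map f xs)
    map-unique [] inj = []
    map-unique {f = f} {x ∷ xs} (x∉ ∷ xs!) inj =
      go x∉ (λ y∈ → inj (here refl) (there y∈)) ∷
      map-unique xs! (λ x∈ y∈ → inj (there x∈) (there y∈))
      where
      go : ∀ {ys} → All (x ≢_) ys → (∀ {y} → y ∈ ys → f x ≡ f y → x ≡ y) → All (f x ≢_) (map f ys)
      go []         _   = []
      go (x≢y ∷ ps) inj′ = (x≢y ∘ inj′ (here refl)) ∷ go ps (inj′ ∘ there)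

    -- The induction takes the set of `u` out of `R`; by disjointness the remaining sets still lie
    -- in what is left.
    packing : ∀ {u q r} {U : Set u} {Q : U → Pred A q} (Q? : ∀ u → Decidable (Q u))
              {R : Pred A r} (R? : Decidable R) c xs us →
              AllPairs (λ u v → ∀ x → Q u x → ¬ Q v x) us →
              All (λ u → ∀ x → Q u x → R x) us →
              All (λ u → c ≤ count (Q? u) xs) us →
              length us * c ≤ count R? xs
    packing Q? R? c xs [] _ _ _ = z≤n
    packing {Q = Q} Q? {R} R? c xs (u ∷ us) (du ∷ ds) (ru ∷ rs) (cu ∷ cs) =
      ≤-trans (+-mono-≤ cu (packing Q? R∖u? c xs us ds (restrict du rs) cs))
              (count-disjoint (Q? u) R∖u? R? (λ x qx (_ , ¬qx) → ¬qx qx) ru (λ x → proj₁) xs)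
      where
      R∖u? : Decidable (λ x → R x × ¬ Q u x)
      R∖u? x = R? x ×-dec ¬? (Q? u x)
      restrict : ∀ {vs} → All (λ v → ∀ x → Q u x → ¬ Q v x) vs → All (λ v → ∀ x → Q v x → R x) vs →
                 All (λ v → ∀ x → Q v x → R x × ¬ Q u x) vs
      restrict []        []        = []
      restrict (d ∷ ds′) (r ∷ rs′) = (λ x qx → r x qx , λ qux → d x qux qx) ∷ restrict ds′ rs′

    kill : ∀ {q} {Q : Pred A q} → ℕ → Decidable Q → List A → List A
    kill zero    Q? xs       = xs
    kill (suc κ) Q? []       = []
    kill (suc κ) Q? (x ∷ xs) with Q? x
    ... | yes _ = kill κ Q? xs
    ... | no  _ = x ∷ kill (suc κ) Q? xs

    count-kill : ∀ {p q} {P : Pred A p} {Q : Pred A q} (P? : Decidable P) κ (Q? : Decidable Q) xs →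
                 count P? xs ≤ κ + count P? (kill κ Q? xs)
    count-kill P? zero    Q? xs       = ≤-refl
    count-kill P? (suc κ) Q? []       = z≤n
    count-kill P? (suc κ) Q? (x ∷ xs) with Q? x
    count-kill P? (suc κ) Q? (x ∷ xs) | yes _ with P? x
    ... | yes _ = s≤s (count-kill P? κ Q? xs)
    ... | no  _ = m≤n⇒m≤1+n (count-kill P? κ Q? xs)
    count-kill P? (suc κ) Q? (x ∷ xs) | no _ with P? x
    ... | yes _ = ≤-trans (s≤s (count-kill P? (suc κ) Q? xs)) (s≤s (≤-reflexive (sym (+-suc κ _))))
    ... | no  _ = count-kill P? (suc κ) Q? xs

    count-kill-disjoint : ∀ {p q} {P : Pred A p} {Q : Pred A q} (P? : Decidable P) κ (Q? : Decidable Q) →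
                          (∀ x → Q x → ¬ P x) → ∀ xs → count P? xs ≤ count P? (kill κ Q? xs)
    count-kill-disjoint P? zero    Q? d xs       = ≤-refl
    count-kill-disjoint P? (suc κ) Q? d []       = z≤n
    count-kill-disjoint P? (suc κ) Q? d (x ∷ xs) with Q? x
    count-kill-disjoint P? (suc κ) Q? d (x ∷ xs) | yes qx with P? x
    ... | yes px = contradiction px (d x qx)
    ... | no  _  = count-kill-disjoint P? κ Q? d xs
    count-kill-disjoint P? (suc κ) Q? d (x ∷ xs) | no _ with P? x
    ... | yes _ = s≤s (count-kill-disjoint P? (suc κ) Q? d xs)
    ... | no  _ = count-kill-disjoint P? (suc κ) Q? d xs

    length-kill : ∀ {q} {Q : Pred A q} κ (Q? : Decidable Q) xs → κ ≤ count Q? xs →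
                  κ + length (kill κ Q? xs) ≤ length xs
    length-kill zero    Q? xs       _ = ≤-refl
    length-kill (suc κ) Q? (x ∷ xs) h with Q? x
    ... | yes _ = s≤s (length-kill κ Q? xs (s≤s⁻¹ h))
    ... | no  _ = ≤-trans (≤-reflexive (+-suc (suc κ) _)) (s≤s (length-kill (suc κ) Q? xs h))

  module _ {a u q} {A : Set a} {U : Set u} {Q : U → Pred A q} (Q? : ∀ u → Decidable (Q u)) (κ : ℕ) where

    killAll : List U → List A → List A
    killAll []       xs = xs
    killAll (u ∷ us) xs = killAll us (kill κ (Q? u) xs)

    length-killAll : ∀ us xs → AllPairs (λ u v → ∀ x → Q u x → ¬ Q v x) us →
                     All (λ u → κ ≤ count (Q? u) xs) us →
                     length us * κ + length (killAll us xs) ≤ length xs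
    length-killAll []       xs _         _         = ≤-refl
    length-killAll (u ∷ us) xs (du ∷ ds) (cu ∷ cs) = begin
      κ + length us * κ + length (killAll us (kill κ (Q? u) xs))    ≡⟨ +-assoc κ _ _ ⟩
      κ + (length us * κ + length (killAll us (kill κ (Q? u) xs)))  ≤⟨ +-monoʳ-≤ κ (length-killAll us _ ds (keep du cs)) ⟩
      κ + length (kill κ (Q? u) xs)                                 ≤⟨ length-kill κ (Q? u) xs cu ⟩
      length xs                                                     ∎
      where
      open ≤-Reasoning
      keep : ∀ {vs} → All (λ v → ∀ x → Q u x → ¬ Q v x) vs → All (λ v → κ ≤ count (Q? v) xs) vs →
             All (λ v → κ ≤ count (Q? v) (kill κ (Q? u) xs)) vs
      keep []        []        = []
      keep (d ∷ ds′) (c ∷ cs′) =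
        ≤-trans c (count-kill-disjoint (Q? _) κ (Q? u) d xs) ∷ keep ds′ cs′

    -- A killer outside `M` does not touch `P`, and one inside `M` removes at most `κ` elements of
    -- it.
    count-killAll : ∀ {p m} {P : Pred A p} (P? : Decidable P) {M : Pred U m} (M? : Decidable M) us xs →
                    (∀ {u} → u ∈ us → ¬ M u → ∀ x → Q u x → ¬ P x) →
                    count P? xs ≤ count M? us * κ + count P? (killAll us xs)
    count-killAll P? M? []       xs _ = ≤-refl
    count-killAll P? M? (u ∷ us) xs d
      with ih ← count-killAll P? M? us (kill κ (Q? u) xs) (d ∘ there) | M? u
    ... | yes _ = ≤-trans (count-kill P? κ (Q? u) xs)
                          (≤-trans (+-monoʳ-≤ κ ih) (≤-reflexive (sym (+-assoc κ _ _))))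
    ... | no ¬m = ≤-trans (count-kill-disjoint P? κ (Q? u) (d (here refl) ¬m) xs) ih

  module _ {a} {A : Set a} (cost : A → ℕ) where

    -- Serves to peel one dyadic level `R` off a sum: `P` and `Q` will be the costs below `2x` and
    -- below `x`.
    sum-filter-split : ∀ {p q r} {P : Pred A p} {Q : Pred A q} {R : Pred A r}
                       (P? : Decidable P) (Q? : Decidable Q) (R? : Decidable R) y →
                       (∀ e → P e → Q e ⊎ (R e × cost e ≤ y)) → ∀ es →
                       sum (map cost (filter P? es)) ≤ sum (map cost (filter Q? es)) + length (filter R? es) * y
    sum-filter-split P? Q? R? y split [] = z≤n
    sum-filter-split P? Q? R? y split (e ∷ es)
      with ih ← sum-filter-split P? Q? R? y split es | P? e | Q? e | R? e
    ... | yes _  | yes _ | yes _  = ≤-trans (+-monoʳ-≤ (cost e) ih) (≤-trans (≤-reflexive (sym (+-assoc (cost e) _ _)))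
                                      (+-monoʳ-≤ (cost e + _) (m≤n+m _ y)))
    ... | yes _  | yes _ | no _   = ≤-trans (+-monoʳ-≤ (cost e) ih) (≤-reflexive (sym (+-assoc (cost e) _ _)))
    ... | no _ | yes _ | yes _ =
      ≤-trans ih (+-mono-≤ (m≤n+m _ (cost e)) (m≤n+m _ y))
    ... | no _ | yes _ | no _  =
      ≤-trans ih (+-monoˡ-≤ _ (m≤n+m _ (cost e)))
    ... | no _ | no _  | yes _ = ≤-trans ih (+-monoʳ-≤ (sum (map cost (filter Q? es))) (m≤n+m _ y))
    ... | no _ | no _  | no _  = ih
    ... | yes pe | no ¬q | re? with split e pe | re?
    ...   | inj₁ qe       | _      = contradiction qe ¬q
    ...   | inj₂ (re , _) | no ¬r  = contradiction re ¬r
    ...   | inj₂ (_ , ≤y) | yes _  = ≤-trans (+-mono-≤ ≤y ih) (≤-reflexive (rotate y (sum (map cost (filter Q? es))) _))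
      where
      rotate : ∀ x y z → x + (y + z) ≡ y + (x + z)
      rotate x y z = trans (sym (+-assoc x y z)) (trans (cong (_+ z) (+-comm x y)) (+-assoc y x z))

    sum-filter-≤ : ∀ {p} {P : Pred A p} (P? : Decidable P) x → (∀ e → P e → cost e ≤ x) →
                   ∀ es → sum (map cost (filter P? es)) ≤ length es * x
    sum-filter-≤ P? x small [] = z≤n
    sum-filter-≤ P? x small (e ∷ es) with P? e
    ... | yes p = +-mono-≤ (small e p) (sum-filter-≤ P? x small es)
    ... | no  _ = ≤-trans (sum-filter-≤ P? x small es) (m≤n+m _ x)

  length-filter-¬ : ∀ {a p} {A : Set a} {P : Pred A p} (P? : Decidable P) xs →
                    length (filter P? xs) + length (filter (¬? ∘ P?) xs) ≡ length xs
  length-filter-¬ P? [] = refl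
  length-filter-¬ P? (x ∷ xs) with ih ← length-filter-¬ P? xs | P? x
  ... | yes _ = cong suc ih
  ... | no  _ = trans (+-suc _ _) (cong suc ih)

  -- Graphs without short cycles have few edges

  module GraphWalks {E X : Set} (A B : E → X) where

    Ends : E → X → X → Set
    Ends e x y = (x ≡ A e × y ≡ B e) ⊎ (x ≡ B e × y ≡ A e)

    ends-sym : ∀ {e x y} → Ends e x y → Ends e y x
    ends-sym (inj₁ (p , q)) = inj₂ (q , p)
    ends-sym (inj₂ (p , q)) = inj₁ (q , p)

    data Trail (U : List E) : X → X → ℕ → Set where
      here : ∀ {x} → Trail U x x 0
      step : ∀ {e x y z n} → e ∈ U → Ends e x y → Trail U y z n → Trail U x z (suc n)

    trail-++ : ∀ {U x y z m n} → Trail U x y m → Trail U y z n → Trail U x z (m + n)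
    trail-++ here           q = q
    trail-++ (step e∈ xy p) q = step e∈ xy (trail-++ p q)

    trail-reverse : ∀ {U x y n} → Trail U x y n → Trail U y x n
    trail-reverse here = here
    trail-reverse {U} {n = suc n} (step e∈ xy p) =
      subst (Trail U _ _) (+-comm n 1) (trail-++ (trail-reverse p) (step e∈ (ends-sym xy) here))

    trail-mono : ∀ {U V x y n} → U ⊆ V → Trail U x y n → Trail V x y n
    trail-mono U⊆V here           = here
    trail-mono U⊆V (step e∈ xy p) = step (U⊆V e∈) xy (trail-mono U⊆V p)

    -- A cycle is an edge `e` with a trail between its ends that avoids `e`; the trail itself may
    -- repeat edges. Excluded are the lengths up to `2h + 2`, and with `n = 0` also loops.
    NoShortCycle : ℕ → List E → Set
    NoShortCycle h Es = ∀ {e U x y n} → e ∈ Es → U ⊆ Es → e ∉ U → n ≤ suc (h + h) →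
                        Ends e x y → Trail U x y n → ⊥

  -- A ball of a graph without short cycles spans a tree, and some ball of radius at most
  -- log₂ |Q| at most doubles in size when its radius grows by one.  The edges that meet that
  -- ball are fewer than twice its vertices; remove them with the ball and repeat.
  module Moore {E X : Set} (_≟_ : DecidableEquality X) (A B : E → X) where

    open GraphWalks A B
    open DecMembership _≟_ using (_∈?_)

    Meets : List X → E → Set
    Meets S e = A e ∈ S ⊎ B e ∈ S

    meets? : ∀ S → Decidable (Meets S)
    meets? S e = (A e ∈? S) ⊎-dec (B e ∈? S)

    far : List X → E → X
    far S e = if does (A e ∈? S) then B e else A e

    near-far : ∀ {S e} → Meets S e → ∃[ x ] x ∈ S × Ends e x (far S e)
    near-far {S} {e} m with A e ∈? S | m
    ... | yes a∈ | _       = A e , a∈ , inj₁ (refl , refl)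
    ... | no  a∉ | inj₁ a∈ = contradiction a∈ a∉
    ... | no  _  | inj₂ b∈ = B e , b∈ , inj₂ (refl , refl)

    record Cut (Q : List X) (Es : List E) : Set where
      field
        ball      : List X
        rest      : List E
        nonempty  : 0 < length ball
        ball!     : Unique ball
        ball⊆     : ball ⊆ Q
        rest!     : Unique rest
        rest⊆     : rest ⊆ Es
        separated : ∀ {e} → e ∈ rest → ¬ Meets ball e
        few       : length Es ≤ 2 * length ball + length rest

    module Growth (h : ℕ) (Q : List X) (Es : List E)
                  (onQ : ∀ {e} → e ∈ Es → A e ∈ Q × B e ∈ Q)
                  (∣Q∣≤ : length Q ≤ 2 ^ h) (noCycle : NoShortCycle h Es) where

      -- A breadth-first ball: the edges `U` form a tree spanning `S`, and `R` holds the edges not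
      -- yet absorbed.
      record Ball (i : ℕ) : Set where
        field
          S      : List X
          U R    : List E
          root   : X
          S!     : Unique S
          S⊆Q    : S ⊆ Q
          big    : 2 ^ i ≤ length S
          tree   : length S ≡ suc (length U)
          reach  : ∀ {x} → x ∈ S → ∃[ n ] n ≤ i × Trail U x root n
          U⊆Es   : U ⊆ Es
          R⊆Es   : R ⊆ Es
          R!     : Unique R
          R∉U    : ∀ {e} → e ∈ R → e ∉ U
          split  : length Es ≡ length U + length R

      module Extend {i : ℕ} (i≤h : i ≤ h) (b : Ball i) where
        open Ball b

        new old : List E
        new = filter (meets? S) R
        old = filter (¬? ∘ meets? S) R

        S′ : List X
        S′ = map (far S) new ++ S

        new⁻ : ∀ {e} → e ∈ new → e ∈ R × Meets S e
        new⁻ = ∈-filter⁻ (meets? S)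

        end∈Q : ∀ {e x y} → e ∈ Es → Ends e x y → y ∈ Q
        end∈Q e∈ (inj₁ (_ , refl)) = proj₂ (onQ e∈)
        end∈Q e∈ (inj₂ (_ , refl)) = proj₁ (onQ e∈)

        -- Otherwise `e` and the tree paths from its two ends to the root close a cycle of length at
        -- most `2h + 1`.
        far∉S : ∀ {e} → e ∈ new → far S e ∉ S
        far∉S e∈ f∈
          with e∈R , m ← new⁻ e∈
          with x , x∈ , ends ← near-far m
          with n , n≤i , p ← reach x∈ | k , k≤i , q ← reach f∈ =
          noCycle (R⊆Es e∈R) U⊆Es (R∉U e∈R)
                  (m≤n⇒m≤1+n (+-mono-≤ (≤-trans n≤i i≤h) (≤-trans k≤i i≤h)))
                  ends (trail-++ p (trail-reverse q))

        -- Two new edges with a common far end close a cycle with the tree paths from their near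
        -- ends. Its length may reach `2h + 2`, which is the bound in `NoShortCycle`.
        far-distinct : (_≟E_ : DecidableEquality E) → ∀ {e e′} → e ∈ new → e′ ∈ new → far S e ≡ far S e′ → e ≡ e′
        far-distinct _≟E_ {e} {e′} e∈ e∈′ eq with e ≟E e′
        ... | yes e≡e′ = e≡e′
        ... | no e≢e′
          with e∈R , m ← new⁻ e∈ | e∈R′ , m′ ← new⁻ e∈′
          with x , x∈ , ends ← near-far m | x′ , x∈′ , ends′ ← near-far m′
          with n , n≤i , p ← reach x∈ | k , k≤i , q ← reach x∈′ =
          ⊥-elim (noCycle {U = e′ ∷ U} (R⊆Es e∈R)
                    (λ { (here refl) → R⊆Es e∈R′ ; (there u∈) → U⊆Es u∈ })
                    (λ { (here e≡e′) → e≢e′ e≡e′ ; (there e∈U) → R∉U e∈R e∈U })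
                    (≤-trans (≤-reflexive (trans (cong (n +_) (+-comm k 1)) (+-suc n k)))
                             (s≤s (+-mono-≤ (≤-trans n≤i i≤h) (≤-trans k≤i i≤h))))
                    ends
                    (trail-++ (trail-mono there p)
                       (trail-++ (trail-reverse (trail-mono there q))
                          (step (here refl) (subst (Ends e′ x′) (sym eq) ends′) here))))

        module _ (_≟E_ : DecidableEquality E) where

          S′! : Unique S′
          S′! = Uniqueₚ.++⁺ (map-unique (Uniqueₚ.filter⁺ (meets? S) R!) (far-distinct _≟E_)) S!
                    (λ (f∈ , s∈) → disjoint f∈ s∈)
            where
            disjoint : ∀ {x} → x ∈ map (far S) new → x ∉ S
            disjoint f∈ with e , e∈ , refl ← ∈-map⁻ (far S) f∈ = far∉S e∈

          S′⊆Q : S′ ⊆ Q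
          S′⊆Q x∈ with ∈-++⁻ (map (far S) new) x∈
          ... | inj₂ s∈ = S⊆Q s∈
          ... | inj₁ f∈ with e , e∈ , refl ← ∈-map⁻ (far S) f∈
                        with e∈R , m ← new⁻ e∈
                        with x , _ , ends ← near-far m = end∈Q (R⊆Es e∈R) ends

          ∣S′∣ : length S′ ≡ suc (length (new ++ U))
          ∣S′∣ rewrite length-++ (map (far S) new) {S} | length-map (far S) new | tree
                     | length-++ new {U} = +-suc _ _

          split′ : length Es ≡ length (new ++ U) + length old
          split′ rewrite length-++ new {U} | split | sym (length-filter-¬ (meets? S) R) =
            shuffle (length U) (length new) (length old)
            where
            shuffle : ∀ u n o → u + (n + o) ≡ n + u + o
            shuffle = solve-∀

          extend : 2 * length S < length S′ → Ball (suc i)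
          extend doubles = record
            { S = S′ ; U = new ++ U ; R = old ; root = root ; S! = S′! ; S⊆Q = S′⊆Q
            ; big = <⇒≤ (≤-<-trans (*-monoʳ-≤ 2 big) doubles)
            ; tree = ∣S′∣ ; reach = reach′ ; U⊆Es = U′⊆Es
            ; R⊆Es = R⊆Es ∘ proj₁ ∘ ∈-filter⁻ (¬? ∘ meets? S)
            ; R! = Uniqueₚ.filter⁺ (¬? ∘ meets? S) R!
            ; R∉U = old∉ ; split = split′ }
            where
            reach′ : ∀ {x} → x ∈ S′ → ∃[ n ] n ≤ suc i × Trail (new ++ U) x root n
            reach′ x∈ with ∈-++⁻ (map (far S) new) x∈
            ... | inj₂ s∈ with n , n≤i , p ← reach s∈ =
              n , m≤n⇒m≤1+n n≤i , trail-mono (∈-++⁺ʳ new) p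
            ... | inj₁ f∈ with e , e∈ , refl ← ∈-map⁻ (far S) f∈
                          with x , x∈S , ends ← near-far (proj₂ (new⁻ e∈))
                          with n , n≤i , p ← reach x∈S =
              suc n , s≤s n≤i , step (∈-++⁺ˡ e∈) (ends-sym ends) (trail-mono (∈-++⁺ʳ new) p)
            U′⊆Es : new ++ U ⊆ Es
            U′⊆Es u∈ with ∈-++⁻ new u∈
            ... | inj₁ n∈ = R⊆Es (proj₁ (new⁻ n∈))
            ... | inj₂ u∈ = U⊆Es u∈
            old∉ : ∀ {e} → e ∈ old → e ∉ new ++ U
            old∉ e∈ u∈ with e∈R , ¬m ← ∈-filter⁻ (¬? ∘ meets? S) e∈ | ∈-++⁻ new u∈
            ... | inj₁ n∈  = ¬m (proj₂ (new⁻ n∈))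
            ... | inj₂ u∈′ = R∉U e∈R u∈′

          -- The edges outside `rest` are those of `new ++ U`. There are `length S′ - 1` of them,
          -- one per vertex of the larger tree except the root.
          cut : length S′ ≤ 2 * length S → Cut Q Es
          cut small = record
            { ball = S ; rest = old ; nonempty = ≤-trans (m^n>0 2 i) big ; ball! = S! ; ball⊆ = S⊆Q
            ; rest! = Uniqueₚ.filter⁺ (¬? ∘ meets? S) R!
            ; rest⊆ = R⊆Es ∘ proj₁ ∘ ∈-filter⁻ (¬? ∘ meets? S)
            ; separated = proj₂ ∘ ∈-filter⁻ (¬? ∘ meets? S) {xs = R}
            ; few = ≤-trans (≤-reflexive split′)
                      (+-monoˡ-≤ (length old)
                         (≤-trans (n≤1+n _) (≤-trans (≤-reflexive (sym ∣S′∣)) small))) }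

      grow : DecidableEquality E → ∀ j {i} → i + j ≡ h → Ball i → Cut Q Es
      grow _≟E_ j {i} i+j≡h b = continue j i+j≡h (length S′ ≤? 2 * length (Ball.S b))
        where
        open Extend (≤-trans (m≤m+n i j) (≤-reflexive i+j≡h)) b
        open ≤-Reasoning
        continue : ∀ j → i + j ≡ h → Dec (length S′ ≤ 2 * length (Ball.S b)) → Cut Q Es
        continue _       _      (yes small) = cut _≟E_ small
        continue (suc j) i+j≡h′ (no big)    = grow _≟E_ j (trans (sym (+-suc i j)) i+j≡h′) (extend _≟E_ (≰⇒> big))
        -- After `h` doublings `S` has at least `2 ^ h` vertices, so one more would exceed `Q`.
        continue zero    i+0≡h  (no big)    = ⊥-elim (<-irrefl refl (begin-strict
          2 ^ h                  ≡⟨ cong (2 ^_) (trans (sym i+0≡h) (+-identityʳ i)) ⟩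
          2 ^ i                  ≤⟨ Ball.big b ⟩
          length (Ball.S b)      ≤⟨ m≤m+n _ _ ⟩
          2 * length (Ball.S b)  <⟨ ≰⇒> big ⟩
          length S′              ≤⟨ unique⊆⇒length≤ (S′! _≟E_) (S′⊆Q _≟E_) ⟩
          length Q               ≤⟨ ∣Q∣≤ ⟩
          2 ^ h                  ∎))

    edges≤2vertices : DecidableEquality E → ∀ h Q Es → Unique Es →
                      (∀ {e} → e ∈ Es → A e ∈ Q × B e ∈ Q) → length Q ≤ 2 ^ h →
                      NoShortCycle h Es → length Es ≤ 2 * length Q
    edges≤2vertices _≟E_ h Q = go (length Q) Q ≤-refl
      where
      go : ∀ fuel Q → length Q ≤ fuel → ∀ Es → Unique Es →
           (∀ {e} → e ∈ Es → A e ∈ Q × B e ∈ Q) → length Q ≤ 2 ^ h →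
           NoShortCycle h Es → length Es ≤ 2 * length Q
      go fuel Q _ [] _ _ _ _ = z≤n
      go zero [] _ (e ∷ Es) _ onQ _ _ with () ← proj₁ (onQ (here refl))
      go (suc fuel) Q ∣Q∣≤fuel (e ∷ Es) Es! onQ ∣Q∣≤ noCycle = begin
        length (e ∷ Es)                        ≤⟨ few ⟩
        2 * length ball + length rest          ≤⟨ +-monoʳ-≤ (2 * length ball) ih ⟩
        2 * length ball + 2 * length Q′        ≡⟨ *-distribˡ-+ 2 (length ball) (length Q′) ⟨
        2 * (length ball + length Q′)          ≤⟨ *-monoʳ-≤ 2 ∣ball∣+∣Q′∣≤ ⟩
        2 * length Q                           ∎
        where
        open ≤-Reasoning
        ball₀ : Growth.Ball h Q (e ∷ Es) onQ ∣Q∣≤ noCycle 0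
        ball₀ = record
          { S = A e ∷ [] ; U = [] ; R = e ∷ Es ; root = A e ; S! = [] ∷ []
          ; S⊆Q = λ { (here refl) → proj₁ (onQ (here refl)) }
          ; big = ≤-refl ; tree = refl ; reach = λ { (here refl) → 0 , z≤n , here }
          ; U⊆Es = λ () ; R⊆Es = λ x → x ; R! = Es! ; R∉U = λ _ () ; split = refl }
        open Cut (Growth.grow h Q (e ∷ Es) onQ ∣Q∣≤ noCycle _≟E_ h refl ball₀)
        Q′ : List X
        Q′ = filter (¬? ∘ (_∈? ball)) Q
        ∣ball∣+∣Q′∣≤ : length ball + length Q′ ≤ length Q
        ∣ball∣+∣Q′∣≤ = ≤-trans (+-monoˡ-≤ (length Q′)
                          (unique⊆⇒length≤ ball! (λ x∈ → ∈-filter⁺ (_∈? ball) (ball⊆ x∈) x∈)))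
                          (≤-reflexive (length-filter-¬ (_∈? ball) Q))
        ∣Q′∣≤ : suc (length Q′) ≤ length Q
        ∣Q′∣≤ = ≤-trans (+-monoˡ-≤ (length Q′) nonempty) ∣ball∣+∣Q′∣≤
        onQ′ : ∀ {f} → f ∈ rest → A f ∈ Q′ × B f ∈ Q′
        onQ′ f∈ = ∈-filter⁺ (¬? ∘ (_∈? ball)) (proj₁ (onQ (rest⊆ f∈))) (separated f∈ ∘ inj₁) ,
                  ∈-filter⁺ (¬? ∘ (_∈? ball)) (proj₂ (onQ (rest⊆ f∈))) (separated f∈ ∘ inj₂)
        ih : length rest ≤ 2 * length Q′
        ih = go fuel Q′ (s≤s⁻¹ (≤-trans ∣Q′∣≤ ∣Q∣≤fuel)) rest rest! onQ′
                (≤-trans (<⇒≤ ∣Q′∣≤) ∣Q∣≤)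
                (λ f∈ U⊆ → noCycle (rest⊆ f∈) (rest⊆ ∘ U⊆))

  -- Nets, and contracting the clusters around a net

  module Nets {V : Set} (D : V → V → ℕ) where

    -- Points are labelled by `P` so that a net point can remember of which segment it is an end.
    net : ∀ {P : Set} → (P → V) → ℕ → List P → List P
    net pos ρ []       = []
    net pos ρ (x ∷ xs) with Any.any? (λ q → D (pos x) (pos q) ≤? ρ) (net pos ρ xs)
    ... | yes _ = net pos ρ xs
    ... | no  _ = x ∷ net pos ρ xs

    module _ {P : Set} (pos : P → V) (ρ : ℕ) where

      net-⊆ : ∀ xs → net pos ρ xs ⊆ xs
      net-⊆ (x ∷ xs) q∈ with Any.any? (λ q → D (pos x) (pos q) ≤? ρ) (net pos ρ xs)
      net-⊆ (x ∷ xs) q∈          | yes _ = there (net-⊆ xs q∈)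
      net-⊆ (x ∷ xs) (here refl) | no  _ = here refl
      net-⊆ (x ∷ xs) (there q∈)  | no  _ = there (net-⊆ xs q∈)

      length-net : ∀ xs → length (net pos ρ xs) ≤ length xs
      length-net []       = z≤n
      length-net (x ∷ xs) with Any.any? (λ q → D (pos x) (pos q) ≤? ρ) (net pos ρ xs)
      ... | yes _ = m≤n⇒m≤1+n (length-net xs)
      ... | no  _ = s≤s (length-net xs)

      net-separated : ∀ xs → AllPairs (λ p q → ρ < D (pos p) (pos q)) (net pos ρ xs)
      net-separated []       = []
      net-separated (x ∷ xs) with Any.any? (λ q → D (pos x) (pos q) ≤? ρ) (net pos ρ xs)
      ... | yes _    = net-separated xs
      ... | no ¬near = All.tabulate (λ q∈ → ≰⇒> λ near → ¬near (Any.map (λ { refl → near }) q∈)) ∷ net-separated xs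

      net-covers : (∀ x → D x x ≡ 0) → ∀ {x xs} → x ∈ xs → Any (λ q → D (pos x) (pos q) ≤ ρ) (net pos ρ xs)
      net-covers D-refl {x} {y ∷ xs} x∈ with Any.any? (λ q → D (pos y) (pos q) ≤? ρ) (net pos ρ xs)
      net-covers D-refl (here refl) | yes near = near
      net-covers D-refl (there x∈)  | yes _    = net-covers D-refl x∈
      net-covers D-refl (here refl) | no _     = here (≤-trans (≤-reflexive (D-refl _)) z≤n)
      net-covers D-refl (there x∈)  | no _     = there (net-covers D-refl x∈)

  -- `Conn H x y c` is a walk from x to y in which the edges satisfying H are free and the
  -- remaining moves cost at most c.
  module Contraction {V : Set} (D : V → V → ℕ) (D-refl : ∀ x → D x x ≡ 0)
                     (D-sym : ∀ x y → D x y ≡ D y x) (D-tri : ∀ x y z → D x z ≤ D x y + D y z)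
                     {m : ℕ} (a b : Fin m → V) where

    open GraphWalks a b using (Ends; ends-sym) public

    data Conn (H : Fin m → Set) (x y : V) (c : ℕ) : Set where
      gap : D x y ≤ c → Conn H x y c
      hop : ∀ {e u v g c′} → D x u ≤ g → H e → Ends e u v → Conn H v y c′ → g + c′ ≤ c → Conn H x y c

    conn-mono : ∀ {H H′ x y c} → (∀ e → H e → H′ e) → Conn H x y c → Conn H′ x y c
    conn-mono H⇒H′ (gap p)            = gap p
    conn-mono H⇒H′ (hop p h ends w l) = hop p (H⇒H′ _ h) ends (conn-mono H⇒H′ w) l

    conn-weaken : ∀ {H x y c c′} → c ≤ c′ → Conn H x y c → Conn H x y c′
    conn-weaken c≤c′ (gap p)            = gap (≤-trans p c≤c′)
    conn-weaken c≤c′ (hop p h ends w l) = hop p h ends w (≤-trans l c≤c′)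

    conn-++ : ∀ {H x y z c d} → Conn H x y c → Conn H y z d → Conn H x z (c + d)
    conn-++ (gap p) (gap q) = gap (≤-trans (D-tri _ _ _) (+-mono-≤ p q))
    conn-++ {c = c} (gap p) (hop q h ends w l) =
      hop (≤-trans (D-tri _ _ _) (+-mono-≤ p q)) h ends w
          (≤-trans (≤-reflexive (+-assoc c _ _)) (+-monoʳ-≤ c l))
    conn-++ (hop {g = g} p h ends w l) w′ =
      hop p h ends (conn-++ w w′) (≤-trans (≤-reflexive (sym (+-assoc g _ _))) (+-monoˡ-≤ _ l))

    refl≤ : ∀ x → D x x ≤ 0
    refl≤ x = ≤-reflexive (D-refl x)

    conn-reverse : ∀ {H x y c} → Conn H x y c → Conn H y x c
    conn-reverse {x = x} {y} (gap p) = gap (≤-trans (≤-reflexive (D-sym y x)) p)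
    conn-reverse {x = x} (hop {u = u} {v} {g} {c′} p h ends w l) =
      conn-weaken (≤-trans (≤-reflexive (+-comm c′ g)) l)
        (conn-++ (conn-reverse w)
                 (hop (refl≤ v) h (ends-sym ends) (gap (≤-trans (≤-reflexive (D-sym u x)) p)) ≤-refl))

    -- All that the combinatorial part knows about the algorithm: making the earlier segments free
    -- brings the ends of a later one no closer together.
    Star : Set
    Star = ∀ e {c} → Conn (Fin._< e) (a e) (b e) c → D (a e) (b e) ≤ c

    module Cycles (star : Star) where

      star-ends : ∀ {e x y c} → Ends e x y → Conn (Fin._< e) x y c → D (a e) (b e) ≤ c
      star-ends (inj₁ (refl , refl)) w = star _ w
      star-ends (inj₂ (refl , refl)) w = star _ (conn-reverse w)

      Before : (Fin m → Set) → ℕ → Fin m → Set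
      Before H t e = H e × toℕ e < t

      record Crossing (H : Fin m → Set) (t : ℕ) (x y : V) (c : ℕ) : Set where
        field
          {f}     : Fin m
          {s s′}  : V
          {c₁ c₂} : ℕ
          time    : toℕ f ≡ t
          Hf      : H f
          ends    : Ends f s s′
          prefix  : Conn (Before H t) x s c₁
          suffix  : Conn (Before H t) s′ y c₂
          total   : c₁ + c₂ ≤ c

      module _ {H : Fin m → Set} {Δ : ℕ} (long : ∀ e → H e → Δ ≤ D (a e) (b e)) where

        -- Between two consecutive passages of the latest edge the walk is too cheap to lead from
        -- one of its ends to the other, so it makes a detour that can be cut out.
        simplify : ∀ {t x y c} → Conn (Before H (suc t)) x y c → c < Δ →
                   Conn (Before H t) x y c ⊎ Crossing H t x y c
        simplify (gap p) _ = inj₁ (gap p)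
        simplify {t} (hop {e} {g = g} p (h , e<1+t) ends w l) c<Δ
          with simplify w (≤-<-trans (m≤n+m _ g) (≤-<-trans l c<Δ)) | m≤n⇒m<n∨m≡n (s≤s⁻¹ e<1+t)
        ... | inj₁ w′ | inj₁ e<t  = inj₁ (hop p (h , e<t) ends w′ l)
        ... | inj₁ w′ | inj₂ refl = inj₂ (record
          { time = refl ; Hf = h ; ends = ends ; prefix = gap p ; suffix = w′ ; total = l })
        ... | inj₂ X  | inj₁ e<t  = inj₂ (record
          { time = time ; Hf = Hf ; ends = ends′ ; prefix = hop p (h , e<t) ends prefix ≤-refl
          ; suffix = suffix ; total = ≤-trans (≤-reflexive (+-assoc g _ _)) (≤-trans (+-monoʳ-≤ g total) l) })
          where open Crossing X renaming (ends to ends′)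
        ... | inj₂ X  | inj₂ refl with refl ← Finₚ.toℕ-injective (Crossing.time X) = cases ends ends′
          where
          open Crossing X renaming (ends to ends′)
          c₁<Δ : c₁ < Δ
          c₁<Δ = ≤-<-trans (m≤m+n c₁ c₂) (≤-<-trans total (≤-<-trans (m≤n+m _ g) (≤-<-trans l c<Δ)))
          earlier : ∀ e′ → Before H (toℕ e) e′ → e′ Fin.< e
          earlier _ = proj₂
          skip : ∀ {u} → D _ u ≤ g → Conn (Before H (toℕ e)) u _ c₂ → Conn (Before H (toℕ e)) _ _ _
          skip p w′ = conn-weaken (≤-trans (+-monoʳ-≤ g (≤-trans (m≤n+m c₂ c₁) total)) l) (conn-++ (gap p) w′)
          cases : Ends e _ _ → Ends e s s′ → _
          cases (inj₁ (refl , refl)) (inj₁ (refl , refl)) =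
            ⊥-elim (<⇒≱ c₁<Δ (≤-trans (long e h) (star e (conn-mono earlier (conn-reverse prefix)))))
          cases (inj₂ (refl , refl)) (inj₂ (refl , refl)) =
            ⊥-elim (<⇒≱ c₁<Δ (≤-trans (long e h) (star e (conn-mono earlier prefix))))
          cases (inj₁ (refl , refl)) (inj₂ (refl , refl)) = inj₁ (skip p suffix)
          cases (inj₂ (refl , refl)) (inj₁ (refl , refl)) = inj₁ (skip p suffix)

        -- Descent on the latest edge of the walk. If all its edges precede `e`, then `star` for `e`
        -- is violated. A later edge `f` is either cut out or crossed exactly once; in the second
        -- case the rest of the cycle, on which `e` is free, joins the ends of `f` too cheaply.
        no-short-cycle : ∀ {e x y c} → Δ ≤ D (a e) (b e) → (∀ f → H f → f ≢ e) →
                         Ends e x y → Conn H x y c → c < Δ → ⊥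
        no-short-cycle {e} Δ≤e avoid ends w c<Δ =
          descend m (conn-mono (λ f Hf → Hf , Finₚ.toℕ<n f) w) c<Δ
          where
          descend : ∀ t {c} → Conn (Before H t) _ _ c → c < Δ → ⊥
          descend t w c<Δ with t ≤? toℕ e
          ... | yes t≤e =
            <⇒≱ c<Δ (≤-trans Δ≤e (star-ends ends (conn-mono (λ f (_ , f<t) → <-≤-trans f<t t≤e) w)))
          descend zero    w c<Δ | no t≰e = t≰e z≤n
          descend (suc t) w c<Δ | no t≰e with m≤n⇒m<n∨m≡n (s≤s⁻¹ (≰⇒> t≰e))
          ... | inj₂ e≡t = <⇒≱ c<Δ (≤-trans Δ≤e (star-ends ends (conn-mono earlier w)))
            where
            earlier : ∀ f → Before H (suc t) f → f Fin.< e
            earlier f (Hf , f<1+t) = ≤∧≢⇒< (subst (toℕ f ≤_) (sym e≡t) (s≤s⁻¹ f<1+t)) (avoid f Hf ∘ Finₚ.toℕ-injective)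
          ... | inj₁ e<t with simplify w c<Δ
          ...   | inj₁ w′ = descend t w′ c<Δ
          ...   | inj₂ X  =
            <⇒≱ (≤-<-trans (Crossing.total X) c<Δ) (≤-trans (long f Hf) (star-ends ends′ around))
            where
            open Crossing X renaming (ends to ends′)
            earlier : ∀ e′ → Before H t e′ → e′ Fin.< f
            earlier e′ (_ , lt) = subst (toℕ e′ <_) (sym time) lt
            around : Conn (Fin._< f) s s′ (c₁ + c₂)
            around = conn-++ (conn-mono earlier (conn-reverse prefix))
                             (hop (refl≤ _) (subst (toℕ e <_) (sym time) e<t) ends
                                  (conn-mono earlier (conn-reverse suffix)) ≤-refl)

      open Nets D

      module _ (ρ : ℕ) where

        -- Assigning covered vertices to the first net point nearby partitions them into clusters of
        -- diameter at most `2ρ`.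
        cluster : List V → V → ℕ
        cluster []      x = 0
        cluster (q ∷ Q) x with D x q ≤? ρ
        ... | yes _ = 0
        ... | no  _ = suc (cluster Q x)

        cluster< : ∀ {Q x} → Any (λ q → D x q ≤ ρ) Q → cluster Q x < length Q
        cluster< {q ∷ Q} {x} near with D x q ≤? ρ | near
        ... | yes _ | _          = z<s
        ... | no ¬p | here p     = contradiction p ¬p
        ... | no _  | there near′ = s<s (cluster< near′)

        cluster-close : ∀ {Q x y} → Any (λ q → D x q ≤ ρ) Q → Any (λ q → D y q ≤ ρ) Q →
                        cluster Q x ≡ cluster Q y → D x y ≤ 2 * ρ
        cluster-close {q ∷ Q} {x} {y} nx ny eq with D x q ≤? ρ | D y q ≤? ρ | nx | ny
        ... | yes p | yes p′ | _ | _ =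
          ≤-trans (D-tri x q y) (+-mono-≤ p (≤-trans (≤-reflexive (D-sym q y)) (≤-trans p′ (m≤m+n ρ 0))))
        ... | no ¬p | _      | here p   | _        = contradiction p ¬p
        ... | _     | no ¬p  | _        | here p   = contradiction p ¬p
        ... | no _  | no _   | there nx′ | there ny′ = cluster-close nx′ ny′ (suc-injective eq)

        -- A trail of `n` edges between clusters lifts to a walk with `n + 1` gaps inside clusters,
        -- each at most `2ρ`. A cycle of length up to `2h + 2` would thus give a walk cheaper than
        -- `Δ`.
        edges≤2net : ∀ {Δ} h Q Es → Unique Es → length Q ≤ 2 ^ h → suc (suc (h + h)) * (2 * ρ) < Δ →
                     (∀ {e} → e ∈ Es → Δ ≤ D (a e) (b e)) →
                     (∀ {e} → e ∈ Es → Any (λ q → D (a e) q ≤ ρ) Q × Any (λ q → D (b e) q ≤ ρ) Q) →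
                     length Es ≤ 2 * length Q
        edges≤2net {Δ} h Q Es Es! ∣Q∣≤ short long covered = ≤-trans
          (edges≤2vertices Finₚ._≟_ h (upTo (length Q)) Es Es!
             (λ e∈ → ∈-upTo⁺ (cluster< (proj₁ (covered e∈))) , ∈-upTo⁺ (cluster< (proj₂ (covered e∈))))
             (≤-trans (≤-reflexive (length-upTo (length Q))) ∣Q∣≤) acyclic)
          (≤-reflexive (cong (2 *_) (length-upTo (length Q))))
          where
          open Moore ℕₚ._≟_ (cluster Q ∘ a) (cluster Q ∘ b) using (edges≤2vertices)
          module W = GraphWalks (cluster Q ∘ a) (cluster Q ∘ b)
          Near : V → Set
          Near x = Any (λ q → D x q ≤ ρ) Q
          lift : ∀ {U i j n x y} → U ⊆ Es → W.Trail U i j n → Near x → Near y → cluster Q x ≡ i → cluster Q y ≡ j →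
                 Conn (_∈ U) x y (suc n * (2 * ρ))
          lift U⊆ W.here nx ny refl eq =
            gap (≤-trans (cluster-close nx ny (sym eq)) (≤-reflexive (sym (+-identityʳ (2 * ρ)))))
          lift U⊆ (W.step e∈ (inj₁ (p , q)) t) nx ny eqx eqy =
            hop (cluster-close nx (proj₁ (covered (U⊆ e∈))) (trans eqx p)) e∈ (inj₁ (refl , refl))
                (lift U⊆ t (proj₂ (covered (U⊆ e∈))) ny (sym q) eqy) ≤-refl
          lift U⊆ (W.step e∈ (inj₂ (p , q)) t) nx ny eqx eqy =
            hop (cluster-close nx (proj₂ (covered (U⊆ e∈))) (trans eqx p)) e∈ (inj₂ (refl , refl))
                (lift U⊆ t (proj₁ (covered (U⊆ e∈))) ny (sym q) eqy) ≤-refl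
          acyclic : W.NoShortCycle h Es
          acyclic {e} {U} e∈ U⊆ e∉ n≤ ends t =
            close ends (≤-<-trans (*-monoˡ-≤ (2 * ρ) (s≤s n≤)) short)
            where
            avoid : ∀ f → f ∈ U → f ≢ e
            avoid f f∈ refl = e∉ f∈
            close : W.Ends e _ _ → _ → ⊥
            close (inj₁ (p , q)) c<Δ = no-short-cycle (λ f f∈ → long (U⊆ f∈)) (long e∈) avoid (inj₁ (refl , refl))
              (lift U⊆ t (proj₁ (covered e∈)) (proj₂ (covered e∈)) (sym p) (sym q)) c<Δ
            close (inj₂ (p , q)) c<Δ = no-short-cycle (λ f f∈ → long (U⊆ f∈)) (long e∈) avoid (inj₂ (refl , refl))
              (lift U⊆ t (proj₂ (covered e∈)) (proj₁ (covered e∈)) (sym p) (sym q)) c<Δ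

  -- B − A = (Y − X) + d, with both sides moved so that no subtraction occurs.
  lin : ∀ {X Y A B} d → X ≤ Y → A + Y + d ≡ B + X → A ≤ B
  lin {X} {Y} {A} {B} d X≤Y eq = +-cancelʳ-≤ Y A B (begin
    A + Y      ≤⟨ m≤m+n (A + Y) d ⟩
    A + Y + d  ≡⟨ eq ⟩
    B + X      ≤⟨ +-monoʳ-≤ B X≤Y ⟩
    B + Y      ∎)
    where open ≤-Reasoning

  -- The budget of one level. With `Λ = q + 6Γ` and `r = 4κ`, lowering `β` by one allows a loss of
  -- `Λ r / (2J)`. The margins of length `6Γ r` take at most half of it since `24ΓJ ≤ Λ`, and at
  -- most `K` killings of `r / 4` positions take the other half since `JK ≤ Λ`.
  sparse-arith : ∀ {β q Γ J K κ M c c′} → 24 * Γ * J ≤ q + 6 * Γ → suc β ≤ 2 * J →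
                 J * K ≤ q + 6 * Γ → M ≤ K → suc β * (q * (4 * κ)) ≤ 2 * J * c → c ≤ M * κ + c′ →
                 β * ((q + 6 * Γ) * (4 * κ)) ≤ 2 * J * c′
  sparse-arith {β} {q} {Γ} {J} {K} {κ} {M} {c} {c′} ΓJ≤ β<2J JK≤ M≤K inv c≤ =
    lin 0 (+-mono-≤ (+-mono-≤ margins inv) (+-mono-≤ (*-monoʳ-≤ (2 * J) c≤) kills))
        (arith β q Γ J κ M c c′)
    where
    margins : κ * (24 * Γ * suc β) ≤ κ * (2 * (q + 6 * Γ))
    margins = *-monoʳ-≤ κ (begin
      24 * Γ * suc β      ≤⟨ *-monoʳ-≤ (24 * Γ) β<2J ⟩
      24 * Γ * (2 * J)    ≡⟨ e₁ Γ J ⟩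
      2 * (24 * Γ * J)    ≤⟨ *-monoʳ-≤ 2 ΓJ≤ ⟩
      2 * (q + 6 * Γ)     ∎)
      where
      open ≤-Reasoning
      e₁ : ∀ Γ J → 24 * Γ * (2 * J) ≡ 2 * (24 * Γ * J)
      e₁ = solve-∀
    kills : 2 * κ * (J * M) ≤ 2 * κ * (q + 6 * Γ)
    kills = *-monoʳ-≤ (2 * κ) (≤-trans (*-monoʳ-≤ J M≤K) JK≤)
    arith : ∀ β q Γ J κ M c c′ →
      β * ((q + 6 * Γ) * (4 * κ)) +
        (κ * (2 * (q + 6 * Γ)) + 2 * J * c + (2 * J * (M * κ + c′) + 2 * κ * (q + 6 * Γ))) + 0 ≡
      2 * J * c′ +
        (κ * (24 * Γ * suc β) + suc β * (q * (4 * κ)) + (2 * J * c + 2 * κ * (J * M)))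
    arith = solve-∀

  -- One level of the killing process

  module Killing {V : Set} (D : V → V → ℕ) (D-refl : ∀ x → D x x ≡ 0)
                 (D-sym : ∀ x y → D x y ≡ D y x) (D-tri : ∀ x y z → D x z ≤ D x y + D y z)
                 {m : ℕ} (a b : Fin m → V)
                 (star : Contraction.Star D D-refl D-sym D-tri a b)
                 (δ : V → ℕ → ℕ) (δ≤ : ∀ x y i → δ x i ≤ D x y + δ y i)
                 (≤δ : ∀ x y i → D x y ≤ δ x i + δ y i)
                 (src tgt : Fin m → V)
                 (src-tgt : ∀ e → Contraction.Ends D D-refl D-sym D-tri a b e (src e) (tgt e)) where

    open Contraction D D-refl D-sym D-tri a b
    open Cycles star using (edges≤2net)
    open Nets D

    -- Here `δ v i` stands for the distance of the vertex `v` from position `i` of the tour; `δ≤`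
    -- and `≤δ` are the triangle inequalities that involve one position.
    Range : V → ℕ → ℕ → ℕ → Set
    Range v lo hi i = lo ≤ δ v i × δ v i < hi

    range? : ∀ v lo hi → Decidable (Range v lo hi)
    range? v lo hi i = (lo ≤? δ v i) ×-dec (δ v i <? hi)

    Within : ℕ → V → ℕ → Set
    Within r x i = δ x i < r

    within? : ∀ r x → Decidable (Within r x)
    within? r x i = δ x i <? r

    -- The live positions fill at least the fraction `β / (2J)` of each window of length `r`. From
    -- `2J` on, `β` drops by one per level and stays at least `J`, that is, the fraction stays at
    -- least one half. The vertex `u` guarantees that distances as large as those of the window
    -- occur.
    Inv : ℕ → ℕ → List ℕ → ℕ → Set
    Inv J β live r = ∀ v s u → s + r ≤ D v u → β * r ≤ 2 * J * count (range? v s (s + r)) live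

    inv-multiple : ∀ J β live r → Inv J β live r → ∀ q v s u → s + q * r ≤ D v u →
                   β * (q * r) ≤ 2 * J * count (range? v s (s + q * r)) live
    inv-multiple J β live r inv zero v s u _ rewrite *-zeroʳ β = z≤n
    inv-multiple J β live r inv (suc q) v s u far = begin
      β * (r + q * r)              ≡⟨ *-distribˡ-+ β r (q * r) ⟩
      β * r + β * (q * r)          ≤⟨ +-mono-≤ (inv v s u (≤-trans (+-monoʳ-≤ s (m≤m+n r (q * r))) far))
                                               (inv-multiple J β live r inv q v (s + r) u (≤-trans (≤-reflexive assoc) far)) ⟩
      2 * J * c₁ + 2 * J * c₂      ≡⟨ *-distribˡ-+ (2 * J) c₁ c₂ ⟨
      2 * J * (c₁ + c₂)            ≤⟨ *-monoʳ-≤ (2 * J) (count-disjoint (range? v s (s + r)) (range? v (s + r) (s + r + q * r)) _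
                                         (λ i (_ , <s+r) (s+r≤ , _) → <⇒≱ <s+r s+r≤)
                                         (λ i (s≤ , <s+r) → s≤ , <-≤-trans <s+r (+-monoʳ-≤ s (m≤m+n r (q * r))))
                                         (λ i (s+r≤ , <hi) → ≤-trans (m≤m+n s r) s+r≤ , <-≤-trans <hi (≤-reflexive assoc)) live) ⟩
      2 * J * count (range? v s (s + (r + q * r))) live ∎
      where
      open ≤-Reasoning
      c₁ = count (range? v s (s + r)) live
      c₂ = count (range? v (s + r) (s + r + q * r)) live
      assoc = +-assoc s r (q * r)

    -- Each segment acts as a killer at its end `src` only. The separation makes the balls of radius
    -- `r` disjoint, and `Γ` is the ratio of segment length to ball radius.
    record Level (Γ r : ℕ) (E : List (Fin m)) : Set where
      field
        separated : AllPairs (λ e f → r + r < D (src e) (src f)) E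
        cost≥     : ∀ {e} → e ∈ E → Γ * r ≤ D (src e) (tgt e)
        cost<     : ∀ {e} → e ∈ E → D (src e) (tgt e) < 2 * (Γ * r)

    within-disjoint : ∀ {r x y} → r + r < D x y → ∀ i → Within r x i → ¬ Within r y i
    within-disjoint {x = x} {y} far i p q = <⇒≱ far (≤-trans (≤δ x y i) (+-mono-≤ (<⇒≤ p) (<⇒≤ q)))

    -- There are `J` levels in a class, whose scales grow by the factor `Λ`; `K` is the number of
    -- killers that a window can afford, and `2 ^ h` bounds the ends of `K + 1` segments.
    module Step (J K Λ Γ h : ℕ) (J>0 : 0 < J) (ΓJ≤Λ : 24 * Γ * J ≤ Λ)
                (JK≤Λ : J * K ≤ Λ) (Λ≤JK : Λ ≤ J * suc K) (K≤h : 2 * suc K ≤ 2 ^ h)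
                (h<Γ : suc (suc (h + h)) * (32 * J) < Γ)
                (κ : ℕ) (κ>0 : 0 < κ) (β : ℕ) (J≤β : J ≤ β) (β<2J : suc β ≤ 2 * J)
                (live : List ℕ) (E : List (Fin m)) where

      r : ℕ
      r = 4 * κ

      r>0 : 0 < r
      r>0 = *-mono-≤ (s≤s (z≤n {3})) κ>0

      ball? : ∀ e → Decidable (Within r (src e))
      ball? e = within? r (src e)

      live′ : List ℕ
      live′ = killAll ball? κ E live

      instance
        J≢0 : NonZero J
        J≢0 = >-nonZero J>0

      8J+3≤Γ : 8 * J + 3 ≤ Γ
      8J+3≤Γ = begin
        8 * J + 3 * 1                 ≤⟨ +-monoʳ-≤ (8 * J) (*-monoʳ-≤ 3 J>0) ⟩
        8 * J + 3 * J                 ≤⟨ lin (53 * J) (≤-refl {0}) (e₁ J) ⟩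
        2 * (32 * J)                  ≤⟨ *-monoˡ-≤ (32 * J) {2} {suc (suc (h + h))} (s≤s (s≤s z≤n)) ⟩
        suc (suc (h + h)) * (32 * J)  ≤⟨ <⇒≤ h<Γ ⟩
        Γ                             ∎
        where
        open ≤-Reasoning
        e₁ : ∀ J → 8 * J + 3 * J + 0 + 53 * J ≡ 2 * (32 * J) + 0
        e₁ = solve-∀

      module _ (level : Level Γ r E) (inv : Inv J (suc β) live r) where
        open Level level

        G : ℕ
        G = Γ * r

        8Jr+3r≤G : 8 * J * r + 3 * r ≤ G
        8Jr+3r≤G = ≤-trans (≤-reflexive (sym (*-distribʳ-+ r (8 * J) 3))) (*-monoˡ-≤ r 8J+3≤Γ)

        ball-count : ∀ q {x y} → q * r ≤ D x y → q * (2 * κ) ≤ count (within? (q * r) x) live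
        ball-count q {x} {y} far = *-cancelˡ-≤ (2 * J) (begin
          2 * J * (q * (2 * κ))  ≡⟨ e₁ J q κ ⟩
          J * (q * r)            ≤⟨ *-monoˡ-≤ (q * r) (m≤n⇒m≤1+n J≤β) ⟩
          suc β * (q * r)        ≤⟨ inv-multiple J (suc β) live r inv q x 0 y far ⟩
          2 * J * count (range? x 0 (q * r)) live
                                 ≤⟨ *-monoʳ-≤ (2 * J) (count-mono (range? x 0 (q * r)) (within? (q * r) x) (λ i → proj₂) live) ⟩
          2 * J * count (within? (q * r) x) live ∎)
          where
          open ≤-Reasoning
          instance
            2J≢0 : NonZero (2 * J)
            2J≢0 = m*n≢0 2 J
          e₁ : ∀ J q κ → 2 * J * (q * (2 * κ)) ≡ J * (q * (4 * κ))
          e₁ = solve-∀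

        r≤G : r ≤ G
        r≤G = ≤-trans (≤-trans (m≤m+n r _) (m≤n+m (3 * r) (8 * J * r))) 8Jr+3r≤G

        -- At least half of the radius `r = 4κ` is alive, which is twice what the killer removes.
        killer-count : ∀ {e} → e ∈ E → 2 * κ ≤ count (ball? e) live
        killer-count {e} e∈ = begin
          2 * κ        ≡⟨ *-identityˡ (2 * κ) ⟨
          1 * (2 * κ)  ≤⟨ ball-count 1 (≤-trans (≤-reflexive (*-identityˡ r)) (≤-trans r≤G (cost≥ e∈))) ⟩
          count (within? (1 * r) (src e)) live
                       ≤⟨ count-mono (within? (1 * r) (src e)) (ball? e) (λ i lt → <-≤-trans lt (≤-reflexive (*-identityˡ r))) live ⟩
          count (ball? e) live ∎
          where open ≤-Reasoning

        balls-disjoint : AllPairs (λ e f → ∀ i → Within r (src e) i → ¬ Within r (src f) i) E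
        balls-disjoint = AllPairs.map within-disjoint separated

        killed : length E * κ + length live′ ≤ length live
        killed = length-killAll ball? κ E live balls-disjoint
                   (All.tabulate (λ e∈ → ≤-trans (m≤m+n κ _) (killer-count e∈)))

        Meets : V → ℕ → ℕ → Fin m → Set
        Meets v lo hi e = lo ≤ D v (src e) + r × D v (src e) < hi + r

        meets? : ∀ v lo hi → Decidable (Meets v lo hi)
        meets? v lo hi e = (lo ≤? D v (src e) + r) ×-dec (D v (src e) <? hi + r)

        meets : ∀ {v lo hi e i} → Within r (src e) i → Range v lo hi i → Meets v lo hi e
        meets {v} {lo} {hi} {e} {i} <r (lo≤ , <hi) =
          ≤-trans lo≤ (≤-trans (δ≤ v (src e) i) (+-monoʳ-≤ (D v (src e)) (<⇒≤ <r))) ,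
          ≤-<-trans (≤δ v (src e) i) (+-mono-<-≤ <hi (<⇒≤ <r))

        -- The core omits a margin of `3G` on either side of the window. Measured from `v`, the ends
        -- of a segment whose ball meets the core leave it by at most `r + 2G`. Balls of radius
        -- `8Jr` around these ends still keep `2r` away from the border of the window, because
        -- `8Jr + 3r ≤ G`.
        module Window (v : V) (s : ℕ) (u : V) (far : s + Λ * r ≤ D v u) where

          6Γ≤Λ : 6 * Γ ≤ Λ
          6Γ≤Λ = begin
            6 * Γ            ≤⟨ *-monoˡ-≤ Γ (m≤m+n 6 18) ⟩
            24 * Γ           ≡⟨ *-identityʳ (24 * Γ) ⟨
            24 * Γ * 1       ≤⟨ *-monoʳ-≤ (24 * Γ) J>0 ⟩
            24 * Γ * J       ≤⟨ ΓJ≤Λ ⟩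
            Λ                ∎
            where open ≤-Reasoning

          q : ℕ
          q = Λ ∸ 6 * Γ

          Λ≡ : Λ ≡ q + 6 * Γ
          Λ≡ = sym (m∸n+n≡m 6Γ≤Λ)

          Λr≡ : Λ * r ≡ q * r + 6 * G
          Λr≡ = trans (cong (_* r) Λ≡) (trans (*-distribʳ-+ r q (6 * Γ)) (cong (q * r +_) (*-assoc 6 Γ r)))

          lo hi top : ℕ
          lo  = s + 3 * G
          hi  = lo + q * r
          top = s + q * r + 6 * G ∸ 2 * r

          top+2r≡ : top + 2 * r ≡ s + q * r + 6 * G
          top+2r≡ = m∸n+n≡m {s + q * r + 6 * G} {2 * r} (lin (s + q * r + 5 * G + 8 * J * r + r) 8Jr+3r≤G (e₁ r s (q * r) G (8 * J * r)))
            where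
            e₁ : ∀ r s Q G J → 2 * r + G + (s + Q + 5 * G + J + r) ≡ s + Q + 6 * G + (J + 3 * r)
            e₁ = solve-∀

          window core inner : Decidable _
          window = range? v s (s + Λ * r)
          core   = range? v lo hi
          inner  = range? v (s + 2 * r) top

          end≡ : s + Λ * r ≡ s + q * r + 6 * G
          end≡ = trans (cong (s +_) Λr≡) (sym (+-assoc s (q * r) (6 * G)))

          core⊆window : ∀ i → Range v lo hi i → Range v s (s + Λ * r) i
          core⊆window i (lo≤ , <hi) =
            ≤-trans (m≤m+n s (3 * G)) lo≤ ,
            <-≤-trans <hi (≤-trans (lin (3 * G) (≤-refl {0}) (e₁ s (q * r) G)) (≤-reflexive (sym end≡)))
            where
            e₁ : ∀ s Q G → s + 3 * G + Q + 0 + 3 * G ≡ s + Q + 6 * G + 0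
            e₁ = solve-∀

          meeting : List (Fin m)
          meeting = filter (meets? v lo hi) E

          sparse : length meeting ≤ K → β * (Λ * r) ≤ 2 * J * count window live′
          sparse few = begin
            β * (Λ * r)               ≡⟨ cong (λ x → β * (x * r)) Λ≡ ⟩
            β * ((q + 6 * Γ) * r)     ≤⟨ sparse-arith {β} {q} {Γ} {J} {K} {κ} {length meeting}
                                           (≤-trans ΓJ≤Λ (≤-reflexive Λ≡)) β<2J
                                           (≤-trans JK≤Λ (≤-reflexive Λ≡)) few
                                           (inv-multiple J (suc β) live r inv q v lo u (≤-trans (lin (3 * G) (≤-refl {0}) (e₁ s (q * r) G))
                                                                                   (≤-trans (≤-reflexive (sym end≡)) far)))
                                           (count-killAll ball? κ core (meets? v lo hi) E live
                                              (λ _ ¬m i w c → ¬m (meets w c))) ⟩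
            2 * J * count core live′  ≤⟨ *-monoʳ-≤ (2 * J) (count-mono core window core⊆window live′) ⟩
            2 * J * count window live′ ∎
            where
            open ≤-Reasoning
            e₁ : ∀ s Q G → s + 3 * G + Q + 0 + 3 * G ≡ s + Q + 6 * G + 0
            e₁ = solve-∀

          module Dense (many : K < length meeting) where

            Es : List (Fin m)
            -- Keeping only `K + 1` segments lets `h` depend on `K` instead of the number of all
            -- segments, so that contraction at radius `16Jr` creates no short cycle.
            Es = take (suc K) meeting

            ∣Es∣ : length Es ≡ suc K
            ∣Es∣ = trans (length-take (suc K) meeting) (m≤n⇒m⊓n≡m many)

            Es⊆ : ∀ {e} → e ∈ Es → e ∈ E × Meets v lo hi e
            Es⊆ e∈ = ∈-filter⁻ (meets? v lo hi) {xs = E} (take-⊆ (suc K) meeting e∈)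

            Es! : AllPairs _≢_ Es
            Es! = AllPairs.map distinct (AllPairsₚ.take⁺ (suc K) (AllPairsₚ.filter⁺ (meets? v lo hi) separated))
              where
              distinct : ∀ {e f} → r + r < D (src e) (src f) → e ≢ f
              distinct lt refl with () ← <-≤-trans lt (refl≤ _)

            points Q : List V
            points = map src Es ++ map tgt Es
            Q      = net id (2 * (8 * J * r)) points

            record Endpoint (x : V) : Set where
              field
                {other} : V
                long    : G ≤ D x other
                above   : D v x < hi + r + 2 * G
                below   : lo < D v x + r + 2 * G

            endpoint : ∀ {x} → x ∈ points → Endpoint x
            endpoint x∈ with ∈-++⁻ (map src Es) x∈
            ... | inj₁ s∈ with e , e∈ , refl ← ∈-map⁻ src s∈ with e∈E , lo≤ , <hi ← Es⊆ e∈ = record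
              { long  = cost≥ e∈E
              ; above = <-≤-trans <hi (m≤m+n (hi + r) (2 * G))
              ; below = ≤-<-trans lo≤ (m<m+n _ (≤-trans r>0 (≤-trans r≤G (m≤m+n G _)))) }
            ... | inj₂ t∈ with e , e∈ , refl ← ∈-map⁻ tgt t∈ with e∈E , lo≤ , <hi ← Es⊆ e∈ = record
              { other = src e
              ; long  = ≤-trans (cost≥ e∈E) (≤-reflexive (D-sym _ _))
              ; above = ≤-<-trans (D-tri v (src e) (tgt e)) (+-mono-< <hi (cost< e∈E))
              ; below = ≤-<-trans lo≤ (≤-<-trans (+-monoˡ-≤ r (D-tri v (tgt e) (src e)))
                  (<-≤-trans (+-monoˡ-< r (+-monoʳ-< (D v (tgt e)) (≤-<-trans (≤-reflexive (D-sym _ _)) (cost< e∈E))))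
                             (≤-reflexive (e₁ (D v (tgt e)) (2 * G) r)))) }
              where
              e₁ : ∀ x y z → x + y + z ≡ x + z + y
              e₁ = solve-∀

            K<2Q : suc K ≤ 2 * length Q
            K<2Q = ≤-trans (≤-reflexive (sym ∣Es∣))
              (edges≤2net (2 * (8 * J * r)) h Q Es Es! ∣Q∣≤ short (λ e∈ → long (src-tgt _) (cost≥ (proj₁ (Es⊆ e∈))))
                 (λ {e} e∈ → cover (src-tgt e) (covered (∈-++⁺ˡ (∈-map⁺ src e∈)))
                                               (covered (∈-++⁺ʳ (map src Es) (∈-map⁺ tgt e∈)))))
              where
              ∣Q∣≤ : length Q ≤ 2 ^ h
              ∣Q∣≤ = begin
                length Q                             ≤⟨ length-net id _ points ⟩
                length points                        ≡⟨ length-++ (map src Es) ⟩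
                length (map src Es) + length (map tgt Es)
                                                     ≡⟨ cong₂ _+_ (length-map src Es) (trans (length-map tgt Es) (sym (+-identityʳ _))) ⟩
                2 * length Es                        ≡⟨ cong (2 *_) ∣Es∣ ⟩
                2 * suc K                            ≤⟨ K≤h ⟩
                2 ^ h                                ∎
                where open ≤-Reasoning
              short : suc (suc (h + h)) * (2 * (2 * (8 * J * r))) < G
              short = ≤-<-trans (≤-reflexive (e₁ (suc (suc (h + h))) J r))
                                (*-monoˡ-< r ⦃ >-nonZero r>0 ⦄ h<Γ)
                where
                e₁ : ∀ n J r → n * (2 * (2 * (8 * J * r))) ≡ n * (32 * J) * r
                e₁ = solve-∀
              long : ∀ {e} → Ends e (src e) (tgt e) → G ≤ D (src e) (tgt e) → G ≤ D (a e) (b e)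
              long (inj₁ (p , q)) l rewrite p | q = l
              long (inj₂ (p , q)) l rewrite p | q = ≤-trans l (≤-reflexive (D-sym _ _))
              Near : V → Set
              Near x = Any (λ q → D x q ≤ 2 * (8 * J * r)) Q
              covered : ∀ {x} → x ∈ points → Near x
              covered = net-covers id _ D-refl
              cover : ∀ {e} → Ends e (src e) (tgt e) → Near (src e) → Near (tgt e) → Near (a e) × Near (b e)
              cover (inj₁ (p , q)) ns nt = subst Near p ns , subst Near q nt
              cover (inj₂ (p , q)) ns nt = subst Near q nt , subst Near p ns

            -- At least `(K + 1) / 2` disjoint balls of radius `8Jr`, each with at least `4Jr` live
            -- positions, hold `2J(K + 1)r ≥ 2Λr` of them.
            live-inner : 2 * (Λ * r) ≤ count inner live
            live-inner = begin
              2 * (Λ * r)                   ≤⟨ *-monoʳ-≤ 2 (*-monoˡ-≤ r (≤-trans Λ≤JK (*-monoʳ-≤ J K<2Q))) ⟩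
              2 * (J * (2 * length Q) * r)  ≡⟨ e₁ J (length Q) κ ⟩
              length Q * (8 * J * (2 * κ))  ≤⟨ packing (within? (8 * J * r)) inner _ live Q
                                                 (AllPairs.map (λ far′ → within-disjoint {8 * J * r} (≤-<-trans (≤-reflexive double) far′))
                                                               (net-separated id _ points))
                                                 (All.tabulate (λ x∈ → inside (endpoint (net-⊆ id _ points x∈))))
                                                 (All.tabulate (λ x∈ → enough (endpoint (net-⊆ id _ points x∈)))) ⟩
              count inner live              ∎
              where
              open ≤-Reasoning
              double : 8 * J * r + 8 * J * r ≡ 2 * (8 * J * r)
              double = cong (8 * J * r +_) (sym (+-identityʳ _))
              e₁ : ∀ J n κ → 2 * (J * (2 * n) * (4 * κ)) ≡ n * (8 * J * (2 * κ))
              e₁ = solve-∀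
              enough : ∀ {x} → Endpoint x → 8 * J * (2 * κ) ≤ count (within? (8 * J * r) x) live
              enough p = ball-count (8 * J) (≤-trans (≤-trans (m≤m+n _ (3 * r)) 8Jr+3r≤G) (Endpoint.long p))
              inside : ∀ {x} → Endpoint x → ∀ i → Within (8 * J * r) x i → Range v (s + 2 * r) top i
              inside {x} p i near =
                lin 0 (+-mono-≤ (+-mono-≤ (<⇒≤ below) (≤δ v x i)) (+-mono-≤ (<⇒≤ near) 8Jr+3r≤G))
                      (e₂ s r G (D v x) (δ v i) (δ x i) (8 * J * r)) ,
                +-cancelʳ-< (2 * r) _ _ (<-≤-trans
                  (lin 0 (+-mono-≤ (+-mono-≤ above (δ≤ v x i)) (+-mono-≤ (<⇒≤ near) 8Jr+3r≤G))
                         (e₃ s r G (D v x) (δ v i) (δ x i) (8 * J * r) (q * r)))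
                  (≤-reflexive (sym top+2r≡)))
                where
                open Endpoint p
                e₂ : ∀ s r G x v w J → s + 2 * r + (x + r + 2 * G + (v + w) + (J + G)) + 0 ≡
                                       v + (s + 3 * G + x + (w + (J + 3 * r)))
                e₂ = solve-∀
                e₃ : ∀ s r G x v w J Q → suc (v + 2 * r) + (s + 3 * G + Q + r + 2 * G + (x + w) + (J + G)) + 0 ≡
                                         s + Q + 6 * G + (suc x + v + (w + (J + 3 * r)))
                e₃ = solve-∀

            U : List (Fin m)
            U = filter (meets? v (s + 2 * r) top) E

            -- `inner` is completed by the full balls of the killers that meet it. Then every ball
            -- of a killer lies inside the set or is disjoint from it, so each killing inside is
            -- compensated by survivors inside.
            Whole : ℕ → Set
            Whole i = Range v (s + 2 * r) top i ⊎ Any (λ e → Within r (src e) i) U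

            whole? : Decidable Whole
            whole? i = inner i ⊎-dec Any.any? (λ e → ball? e i) U

            whole⊆window : ∀ i → Whole i → Range v s (s + Λ * r) i
            whole⊆window i (inj₁ (lo≤ , <top)) =
              ≤-trans (m≤m+n s _) lo≤ ,
              <-≤-trans <top (≤-trans (m≤m+n top (2 * r)) (≤-reflexive (trans top+2r≡ (sym end≡))))
            whole⊆window i (inj₂ any)
              with e , e∈ , near ← find any
              with e∈E , lo≤ , <hi ← ∈-filter⁻ (meets? v (s + 2 * r) top) {xs = E} e∈ =
              lin 0 (+-mono-≤ (+-mono-≤ lo≤ (≤δ v (src e) i)) (<⇒≤ near)) (e₁ s r (D v (src e)) (δ v i) (δ (src e) i)) ,
              <-≤-trans (lin 0 (+-mono-≤ (+-mono-≤ <hi (δ≤ v (src e) i)) (<⇒≤ near)) (e₂ top r (D v (src e)) (δ v i) (δ (src e) i)))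
                        (≤-reflexive (trans top+2r≡ (sym end≡)))
              where
              e₁ : ∀ s r x v w → s + (x + r + (v + w) + r) + 0 ≡ v + (s + 2 * r + x + w)
              e₁ = solve-∀
              e₂ : ∀ t r x v w → suc v + (t + r + (x + w) + r) + 0 ≡ t + 2 * r + (suc x + v + w)
              e₂ = solve-∀

            -- Half of at least `2Λr` live positions survive, as many as the window is long. The
            -- fraction is back at one, whatever earlier levels removed.
            dense : β * (Λ * r) ≤ 2 * J * count window live′
            dense = *-mono-≤ (≤-trans (n≤1+n β) β<2J)
                      (≤-trans half (count-mono whole? window whole⊆window live′))
              where
              twice : length U * (2 * κ) ≤ count whole? live
              twice = packing ball? whole? (2 * κ) live U (AllPairsₚ.filter⁺ (meets? v (s + 2 * r) top) balls-disjoint)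
                        (All.tabulate (λ e∈ i near → inj₂ (Any.map (λ { refl → near }) e∈)))
                        (All.tabulate (λ e∈ → killer-count (proj₁ (∈-filter⁻ (meets? v (s + 2 * r) top) {xs = E} e∈))))
              apart : ∀ {e} → e ∈ E → ¬ Meets v (s + 2 * r) top e → ∀ i → Within r (src e) i → ¬ Whole i
              apart e∈ ¬m i near (inj₁ inn) = ¬m (meets near inn)
              apart e∈ ¬m i near (inj₂ any)
                with f , f∈ , near′ ← find any
                with f∈E , mf ← ∈-filter⁻ (meets? v (s + 2 * r) top) {xs = E} f∈
                with allPairs-lookup (λ d i p q → d i q p) balls-disjoint e∈ f∈E
              ... | inj₁ refl = ¬m mf
              ... | inj₂ disj = disj i near near′
              killed-here : count whole? live ≤ length U * κ + count whole? live′
              killed-here = count-killAll ball? κ whole? (meets? v (s + 2 * r) top) E live apart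
              half : Λ * r ≤ count whole? live′
              half = *-cancelˡ-≤ 2 (lin 0 (+-mono-≤ (+-mono-≤ live-inner (count-mono inner whole? (λ i → inj₁) live))
                                                    (+-mono-≤ twice (+-mono-≤ killed-here killed-here)))
                        (e₁ (Λ * r) (count inner live) (count whole? live) (count whole? live′) (length U) κ))
                where
                e₁ : ∀ T c w w′ u κ → 2 * T + (c + w + (w + (u * κ + w′ + (u * κ + w′)))) + 0 ≡
                                      2 * w′ + (2 * T + c + (u * (2 * κ) + (w + w)))
                e₁ = solve-∀

          window-live : β * (Λ * r) ≤ 2 * J * count window live′
          window-live with length meeting ≤? K
          ... | yes few = sparse few
          ... | no many = Dense.dense (≰⇒> many)

        inv′ : Inv J β live′ (Λ * r)
        inv′ v s u far = Window.window-live v s u far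

  -- Finite sums and discrete intermediate values

  ∑ : ℕ → (ℕ → ℕ) → ℕ
  ∑ zero    f = 0
  ∑ (suc n) f = f 0 + ∑ n (f ∘ suc)

  ∑-mono : ∀ n {f g} → (∀ i → f i ≤ g i) → ∑ n f ≤ ∑ n g
  ∑-mono zero    f≤g = z≤n
  ∑-mono (suc n) f≤g = +-mono-≤ (f≤g 0) (∑-mono n (f≤g ∘ suc))

  ∑-+ : ∀ n f g → ∑ n (λ i → f i + g i) ≡ ∑ n f + ∑ n g
  ∑-+ zero    f g = refl
  ∑-+ (suc n) f g rewrite ∑-+ n (f ∘ suc) (g ∘ suc) = shuffle (f 0) (g 0) _ _
    where
    shuffle : ∀ x y s t → x + y + (s + t) ≡ x + s + (y + t)
    shuffle = solve-∀

  ∑-* : ∀ c n f → ∑ n (λ i → c * f i) ≡ c * ∑ n f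
  ∑-* c zero    f = sym (*-zeroʳ c)
  ∑-* c (suc n) f = trans (cong (c * f 0 +_) (∑-* c n (f ∘ suc))) (sym (*-distribˡ-+ c (f 0) _))

  ∑-split : ∀ m n f → ∑ (m + n) f ≡ ∑ m f + ∑ n (λ i → f (m + i))
  ∑-split zero    n f = refl
  ∑-split (suc m) n f = trans (cong (f 0 +_) (∑-split m n (f ∘ suc))) (sym (+-assoc (f 0) _ _))

  ∑-const : ∀ n c → ∑ n (λ _ → c) ≡ n * c
  ∑-const zero    c = refl
  ∑-const (suc n) c = cong (c +_) (∑-const n c)

  ∑-zero : ∀ n → ∑ n (λ _ → 0) ≡ 0
  ∑-zero n = trans (∑-const n 0) (*-zeroʳ n)

  ∑-cong : ∀ n {f g} → (∀ i → f i ≡ g i) → ∑ n f ≡ ∑ n g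
  ∑-cong n f≡g = ≤-antisym (∑-mono n (≤-reflexive ∘ f≡g)) (∑-mono n (≤-reflexive ∘ sym ∘ f≡g))

  -- Groups the levels into `d` classes by their residue modulo `d`.
  ∑-residues : ∀ d n f → ∑ (n * d) f ≡ ∑ d (λ c → ∑ n (λ i → f (c + i * d)))
  ∑-residues d zero    f = sym (∑-zero d)
  ∑-residues d (suc n) f = begin
    ∑ (d + n * d) f                                         ≡⟨ ∑-split d (n * d) f ⟩
    ∑ d f + ∑ (n * d) (λ i → f (d + i))                     ≡⟨ cong (∑ d f +_) (∑-residues d n (λ i → f (d + i))) ⟩
    ∑ d f + ∑ d (λ c → ∑ n (λ i → f (d + (c + i * d))))     ≡⟨ ∑-+ d f _ ⟨
    ∑ d (λ c → f c + ∑ n (λ i → f (d + (c + i * d))))       ≡⟨ ∑-cong d (λ c → cong₂ _+_ (cong f (sym (+-identityʳ c)))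
                                                                  (∑-cong n (λ i → cong f (shuffle d c (i * d))))) ⟩
    ∑ d (λ c → f (c + 0) + ∑ n (λ i → f (c + (d + i * d)))) ∎
    where
    open ≡-Reasoning
    shuffle : ∀ d c x → d + (c + x) ≡ c + (d + x)
    shuffle = solve-∀

  intermediate-value : ∀ (f : ℕ → ℕ) → (∀ i → f (suc i) ≤ suc (f i)) → (∀ i → f i ≤ suc (f (suc i))) →
                       ∀ t n i → (f i ≤ t × t ≤ f (n + i)) ⊎ (t ≤ f i × f (n + i) ≤ t) →
                       ∃[ j ] j ≤ n + i × f j ≡ t
  intermediate-value f up down t n i between with <-cmp (f i) t
  ... | tri≈ _ fi≡t _ = i , m≤n+m i n , fi≡t
  intermediate-value f up down t zero i (inj₁ (_ , t≤)) | tri< fi<t _ _ = contradiction t≤ (<⇒≱ fi<t)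
  intermediate-value f up down t zero i (inj₂ (t≤ , _)) | tri< fi<t _ _ = contradiction t≤ (<⇒≱ fi<t)
  intermediate-value f up down t zero i (inj₁ (≤t , _)) | tri> _ _ t<fi = contradiction ≤t (<⇒≱ t<fi)
  intermediate-value f up down t zero i (inj₂ (_ , ≤t)) | tri> _ _ t<fi = contradiction ≤t (<⇒≱ t<fi)
  intermediate-value f up down t (suc n) i (inj₂ (t≤ , _)) | tri< fi<t _ _ = contradiction t≤ (<⇒≱ fi<t)
  intermediate-value f up down t (suc n) i (inj₁ (≤t , _)) | tri> _ _ t<fi = contradiction ≤t (<⇒≱ t<fi)
  intermediate-value f up down t (suc n) i (inj₁ (_ , t≤)) | tri< fi<t _ _ rewrite sym (+-suc n i) =
    intermediate-value f up down t n (suc i) (inj₁ (≤-trans (up i) fi<t , t≤))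
  intermediate-value f up down t (suc n) i (inj₂ (_ , ≤t)) | tri> _ _ t<fi rewrite sym (+-suc n i) =
    intermediate-value f up down t n (suc i) (inj₂ (s≤s⁻¹ (≤-trans t<fi (down i)) , ≤t))

  -- Dyadic levels and the cost of a class

  module Levels {V : Set} (D : V → V → ℕ) (D-refl : ∀ x → D x x ≡ 0)
                (D-sym : ∀ x y → D x y ≡ D y x) (D-tri : ∀ x y z → D x z ≤ D x y + D y z)
                {m : ℕ} (a b : Fin m → V)
                (star : Contraction.Star D D-refl D-sym D-tri a b)
                (δ : V → ℕ → ℕ) (δ≤ : ∀ x y i → δ x i ≤ D x y + δ y i)
                (≤δ : ∀ x y i → D x y ≤ δ x i + δ y i)
                (δ-up : ∀ x i → δ x (suc i) ≤ suc (δ x i)) (δ-down : ∀ x i → δ x i ≤ suc (δ x (suc i)))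
                (M : ℕ) (δ-zero : ∀ x → ∃[ i ] i ≤ M × δ x i ≡ 0) where

    open Contraction D D-refl D-sym D-tri a b
    open Cycles star using (edges≤2net)
    open Nets D

    side : Bool → Fin m → V
    side true  = a
    side false = b

    side-ends : ∀ t e → Ends e (side t e) (side (not t) e)
    side-ends true  e = inj₁ (refl , refl)
    side-ends false e = inj₂ (refl , refl)

    -- A segment may be a net point at both ends. Each orientation runs the killing process on its
    -- own copy of the positions, at the price of a factor 2.
    module Killₜ (t : Bool) = Killing D D-refl D-sym D-tri a b star δ δ≤ ≤δ (side t) (side (not t)) (side-ends t)

    between : ∀ x t i k → i ≤ k → k ≤ M → (δ x i ≤ t × t ≤ δ x k) ⊎ (t ≤ δ x i × δ x k ≤ t) →
              ∃[ j ] j ≤ M × δ x j ≡ t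
    between x t i k i≤k k≤M p
      with j , j≤ , eq ← intermediate-value (δ x) (δ-up x) (δ-down x) t (k ∸ i) i
                           (subst (λ l → (δ x i ≤ t × t ≤ δ x l) ⊎ (t ≤ δ x i × δ x l ≤ t)) (sym (m∸n+n≡m i≤k)) p) =
      j , ≤-trans j≤ (≤-trans (≤-reflexive (m∸n+n≡m i≤k)) k≤M) , eq

    -- `δ x` vanishes at a position of `x`, is at least `D x y` at a position of `y`, and changes by
    -- at most one per step between them.
    attained : ∀ {x y t} → t ≤ D x y → ∃[ j ] j ≤ M × δ x j ≡ t
    attained {x} {y} {t} t≤ = choose (δ-zero x) (δ-zero y)
      where
      choose : ∃[ i ] i ≤ M × δ x i ≡ 0 → ∃[ k ] k ≤ M × δ y k ≡ 0 → ∃[ j ] j ≤ M × δ x j ≡ t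
      choose (i , i≤M , δi≡0) (k , k≤M , δk≡0) with ≤-total i k
      ... | inj₁ i≤k = between x t i k i≤k k≤M (inj₁ (≤-trans (≤-reflexive δi≡0) z≤n , t≤δk))
        where
        t≤δk : t ≤ δ x k
        t≤δk = ≤-trans t≤ (≤-trans (≤δ x y k) (≤-reflexive (trans (cong (δ x k +_) δk≡0) (+-identityʳ _))))
      ... | inj₂ k≤i = between x t k i k≤i i≤M (inj₂ (t≤δk , ≤-trans (≤-reflexive δi≡0) z≤n))
        where
        t≤δk : t ≤ δ x k
        t≤δk = ≤-trans t≤ (≤-trans (≤δ x y k) (≤-reflexive (trans (cong (δ x k +_) δk≡0) (+-identityʳ _))))

    positions : List ℕ
    positions = upTo (suc M)

    open Killₜ true using (range?; Range)

    interval-sample : ∀ v s u r → s + r ≤ D v u →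
                      ∃[ xs ] length xs ≡ r × Unique xs × (∀ {x} → x ∈ xs → x ≤ M × Range v s (s + r) x)
    interval-sample v s u zero    _   = [] , refl , [] , λ ()
    interval-sample v s u (suc r) far
      with xs , ∣xs∣ , xs! , ok ← interval-sample v s u r (≤-trans (+-monoʳ-≤ s (n≤1+n r)) far)
         | j , j≤M , δj≡ ← attained {v} {u} (≤-trans (+-monoʳ-≤ s (n≤1+n r)) far) =
      j ∷ xs , cong suc ∣xs∣ ,
      All.tabulate (λ { x∈ refl → <⇒≢ (proj₂ (proj₂ (ok x∈))) δj≡ }) ∷ xs! ,
      λ { (here refl) → j≤M , ≤-trans (m≤m+n s r) (≤-reflexive (sym δj≡)) , ≤-<-trans (≤-reflexive δj≡) (+-monoʳ-< s (n<1+n r))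
        ; (there x∈)  → proj₁ (ok x∈) , proj₁ (proj₂ (ok x∈)) , <-≤-trans (proj₂ (proj₂ (ok x∈))) (+-monoʳ-≤ s (n≤1+n r)) }

    -- Every distance in the window is attained at some position. This is the invariant before the
    -- first level, with fraction one.
    interval-length : ∀ v s r u → s + r ≤ D v u → r ≤ count (range? v s (s + r)) positions
    interval-length v s r u far with xs , ∣xs∣ , xs! , ok ← interval-sample v s u r far =
      ≤-trans (≤-reflexive (sym ∣xs∣)) (unique⊆⇒length≤ xs!
        (λ x∈ → ∈-filter⁺ (range? v s (s + r)) (∈-upTo⁺ (s≤s (proj₁ (ok x∈)))) (proj₂ (ok x∈))))

    D≤ : ∀ x y → D x y ≤ suc M
    D≤ x y = ≤-trans (interval-length x 0 (D x y) y ≤-refl)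
               (≤-trans (length-filter (range? x 0 (D x y)) positions) (≤-reflexive (length-upTo (suc M))))

    cost : Fin m → ℕ
    cost e = D (a e) (b e)

    InLevel : ℕ → Fin m → Set
    InLevel x e = x ≤ cost e × cost e < 2 * x

    inLevel? : ∀ x → Decidable (InLevel x)
    inLevel? x e = (x ≤? cost e) ×-dec (cost e <? 2 * x)

    levelEdges : ℕ → List (Fin m)
    levelEdges x = filter (inLevel? x) (allFin m)

    tag : Bool → Fin m → Bool × Fin m
    tag t e = t , e

    onSide : Bool → List (Bool × Fin m) → List (Fin m)
    onSide t []             = []
    onSide t ((t′ , e) ∷ xs) with t ≟ᵇ t′
    ... | yes _ = e ∷ onSide t xs
    ... | no  _ = onSide t xs

    ∈-onSide⁻ : ∀ t xs {e} → e ∈ onSide t xs → (t , e) ∈ xs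
    ∈-onSide⁻ t ((t′ , e) ∷ xs) e∈ with t ≟ᵇ t′ | e∈
    ... | yes refl | here refl = here refl
    ... | yes refl | there e∈′ = there (∈-onSide⁻ t xs e∈′)
    ... | no _     | e∈′       = there (∈-onSide⁻ t xs e∈′)

    onSide-allPairs : ∀ {R : V → V → Set} t xs → AllPairs (λ (t , e) (t′ , e′) → R (side t e) (side t′ e′)) xs →
                      AllPairs (λ e e′ → R (side t e) (side t e′)) (onSide t xs)
    onSide-allPairs {R} t [] [] = []
    onSide-allPairs {R} t ((t′ , e) ∷ xs) (Re ∷ Rs) with t ≟ᵇ t′
    ... | yes refl = All.tabulate (λ e∈ → All.lookup Re (∈-onSide⁻ t xs e∈)) ∷ onSide-allPairs {R} t xs Rs
    ... | no _     = onSide-allPairs {R} t xs Rs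

    length-onSide : ∀ xs → length xs ≡ length (onSide true xs) + length (onSide false xs)
    length-onSide []               = refl
    length-onSide ((true , e) ∷ xs)  = cong suc (length-onSide xs)
    length-onSide ((false , e) ∷ xs) = trans (cong suc (length-onSide xs)) (sym (+-suc _ _))

    -- `h` serves the girth argument for `K + 1` segments of a window, `h₁` the one for all segments
    -- of a level.
    module Cores (J K Λ Γ h h₁ : ℕ) (J>0 : 0 < J) (ΓJ≤Λ : 24 * Γ * J ≤ Λ)
                 (JK≤Λ : J * K ≤ Λ) (Λ≤JK : Λ ≤ J * suc K) (K≤h : 2 * suc K ≤ 2 ^ h)
                 (h<Γ : suc (suc (h + h)) * (32 * J) < Γ)
                 (m≤h₁ : 2 * m ≤ 2 ^ h₁) (h₁<Γ : suc (suc (h₁ + h₁)) * 4 < Γ) where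

      -- The levels share the list `live`: a killed position is gone for all longer segments. Each
      -- of the `j` remaining levels takes one unit of the density, which ends at `β`.
      packed : ∀ t j (κ : ℕ → ℕ) β live (E : ℕ → List (Fin m)) → (∀ i → 0 < κ i) → (∀ i → κ (suc i) ≡ Λ * κ i) →
               J ≤ β → β + j ≤ 2 * J → (∀ i → Killₜ.Level t Γ (4 * κ i) (E i)) →
               Killₜ.Inv t J (β + j) live (4 * κ 0) →
               ∑ j (λ i → length (E i) * κ i) ≤ length live
      packed t zero    κ β live E κ>0 κ-suc J≤β β≤ level inv = z≤n
      packed t (suc j) κ β live E κ>0 κ-suc J≤β β≤ level inv =
        ≤-trans (+-monoʳ-≤ (length (E 0) * κ 0)
                  (packed t j (κ ∘ suc) β live′ (E ∘ suc) (κ>0 ∘ suc) (κ-suc ∘ suc) J≤β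
                     (≤-trans (+-monoʳ-≤ β (n≤1+n j)) β≤) (level ∘ suc)
                     (subst (Inv J (β + j) live′) scale (inv′ (level 0) inv₀))))
                (killed (level 0) inv₀)
        where
        open Killₜ t using (Inv; module Step)
        open Step J K Λ Γ h J>0 ΓJ≤Λ JK≤Λ Λ≤JK K≤h h<Γ (κ 0) (κ>0 0) (β + j)
               (≤-trans J≤β (m≤m+n β j)) (≤-trans (≤-reflexive (sym (+-suc β j))) β≤) live (E 0)
        inv₀ : Inv J (suc (β + j)) live (4 * κ 0)
        inv₀ = subst (λ n → Inv J n live (4 * κ 0)) (+-suc β j) inv
        scale : Λ * (4 * κ 0) ≡ 4 * κ 1
        scale = trans (e₁ Λ (κ 0)) (cong (4 *_) (sym (κ-suc 0)))
          where
          e₁ : ∀ Λ k → Λ * (4 * k) ≡ 4 * (Λ * k)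
          e₁ = solve-∀

      module Net (κ : ℕ) (κ>0 : 0 < κ) where

        r x : ℕ
        r = 4 * κ
        x = Γ * r

        F : List (Fin m)
        F = levelEdges x

        darts N : List (Bool × Fin m)
        darts = map (tag true) F ++ map (tag false) F
        N     = net (λ (t , e) → side t e) (r + r) darts

        F⁻ : ∀ {e} → e ∈ F → InLevel x e
        F⁻ e∈ = proj₂ (∈-filter⁻ (inLevel? x) {xs = allFin m} e∈)

        darts⁻ : ∀ {t e} → (t , e) ∈ darts → e ∈ F
        darts⁻ d∈ with ∈-++⁻ (map (tag true) F) d∈
        ... | inj₁ p with _ , e∈ , refl ← ∈-map⁻ (tag true) p  = e∈
        ... | inj₂ p with _ , e∈ , refl ← ∈-map⁻ (tag false) p = e∈

        level : ∀ t → Killₜ.Level t Γ r (onSide t N)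
        level t = record
          { separated = onSide-allPairs {R = λ x y → r + r < D x y} t N (net-separated _ (r + r) darts)
          ; cost≥ = λ e∈ → subst (x ≤_) (sides t) (proj₁ (bounds e∈))
          ; cost< = λ e∈ → subst (_< 2 * x) (sides t) (proj₂ (bounds e∈)) }
          where
          bounds : ∀ {e} → e ∈ onSide t N → InLevel x e
          bounds e∈ = F⁻ (darts⁻ {t} (net-⊆ _ (r + r) darts (∈-onSide⁻ t N e∈)))
          sides : ∀ t {e} → cost e ≡ D (side t e) (side (not t) e)
          sides true  = refl
          sides false = D-sym _ _

        F≤2N : length F ≤ 2 * (length (onSide true N) + length (onSide false N))
        F≤2N = ≤-trans (edges≤2net (r + r) h₁ (map (λ (t , e) → side t e) N) F
                          (Uniqueₚ.filter⁺ (inLevel? x) (Uniqueₚ.allFin⁺ m)) ∣N∣≤ short (proj₁ ∘ F⁻)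
                          (λ e∈ → Anyₚ.map⁺ (covered (∈-++⁺ˡ (∈-map⁺ (tag true) e∈))) ,
                                  Anyₚ.map⁺ (covered (∈-++⁺ʳ (map (tag true) F) (∈-map⁺ (tag false) e∈)))))
                       (≤-reflexive (cong (2 *_) (trans (length-map _ N) (length-onSide N))))
          where
          covered : ∀ {d} → d ∈ darts → Any _ N
          covered = net-covers (λ (t , e) → side t e) (r + r) D-refl
          short : suc (suc (h₁ + h₁)) * (2 * (r + r)) < x
          short = ≤-<-trans (≤-reflexive (e₁ (suc (suc (h₁ + h₁))) r))
                            (*-monoˡ-< r ⦃ >-nonZero (*-mono-≤ (s≤s (z≤n {3})) κ>0) ⦄ h₁<Γ)
            where
            e₁ : ∀ n r → n * (2 * (r + r)) ≡ n * 4 * r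
            e₁ = solve-∀
          ∣F∣≤m : length F ≤ m
          ∣F∣≤m = ≤-trans (length-filter (inLevel? x) (allFin m)) (≤-reflexive (length-tabulate id))
          ∣N∣≤ : length (map (λ (t , e) → side t e) N) ≤ 2 ^ h₁
          ∣N∣≤ = begin
            length (map (λ (t , e) → side t e) N)  ≡⟨ length-map _ N ⟩
            length N                               ≤⟨ length-net _ (r + r) darts ⟩
            length darts                           ≡⟨ length-++ (map (tag true) F) ⟩
            length (map (tag true) F) + length (map (tag false) F)
                                                   ≡⟨ cong₂ _+_ (length-map _ F) (trans (length-map _ F) (sym (+-identityʳ _))) ⟩
            2 * length F                           ≤⟨ *-monoʳ-≤ 2 ∣F∣≤m ⟩
            2 * m                                  ≤⟨ m≤h₁ ⟩
            2 ^ h₁                                 ∎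
            where open ≤-Reasoning

      -- One factor 2 passes from segments to net points, the other adds the two orientations.
      class-bound : ∀ (κ : ℕ → ℕ) → (∀ i → 0 < κ i) → (∀ i → κ (suc i) ≡ Λ * κ i) →
                    ∑ J (λ i → length (levelEdges (Γ * (4 * κ i))) * κ i) ≤ 4 * suc M
      class-bound κ κ>0 κ-suc = begin
        ∑ J (λ i → length (F i) * κ i)
          ≤⟨ ∑-mono J (λ i → ≤-trans (*-monoˡ-≤ (κ i) (Net.F≤2N (κ i) (κ>0 i)))
                               (≤-reflexive (e₁ (length (E true i)) (length (E false i)) (κ i)))) ⟩
        ∑ J (λ i → 2 * (length (E true i) * κ i + length (E false i) * κ i))
          ≡⟨ trans (∑-* 2 J _) (cong (2 *_) (∑-+ J _ _)) ⟩
        2 * (∑ J (λ i → length (E true i) * κ i) + ∑ J (λ i → length (E false i) * κ i))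
          ≤⟨ *-monoʳ-≤ 2 (+-mono-≤ (one true) (one false)) ⟩
        2 * (length positions + length positions)
          ≡⟨ cong (λ n → 2 * (n + n)) (length-upTo (suc M)) ⟩
        2 * (suc M + suc M)
          ≡⟨ e₂ (suc M) ⟩
        4 * suc M ∎
        where
        open ≤-Reasoning
        F : ℕ → List (Fin m)
        F i = levelEdges (Γ * (4 * κ i))
        E : Bool → ℕ → List (Fin m)
        E t i = onSide t (Net.N (κ i) (κ>0 i))
        e₁ : ∀ x y k → 2 * (x + y) * k ≡ 2 * (x * k + y * k)
        e₁ = solve-∀
        e₂ : ∀ x → 2 * (x + x) ≡ 4 * x
        e₂ = solve-∀
        one : ∀ t → ∑ J (λ i → length (E t i) * κ i) ≤ length positions
        one t = packed t J κ J positions (E t) κ>0 κ-suc ≤-refl (≤-reflexive (cong (J +_) (sym (+-identityʳ J))))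
                  (λ i → Net.level (κ i) (κ>0 i) t)
                  (λ v s u far → *-mono-≤ (≤-reflexive (cong (J +_) (sym (+-identityʳ J)))) (interval-length v s _ u far))

      sumBelow : ℕ → List (Fin m) → ℕ
      sumBelow x es = sum (map cost (filter (λ e → cost e <? x) es))

      sumBelow-double : ∀ x es → sumBelow (2 * x) es ≤ sumBelow x es + length (filter (inLevel? x) es) * (2 * x)
      sumBelow-double x = sum-filter-split cost (λ e → cost e <? 2 * x) (λ e → cost e <? x) (inLevel? x) (2 * x) split
        where
        split : ∀ e → cost e < 2 * x → cost e < x ⊎ (InLevel x e × cost e ≤ 2 * x)
        split e c<2x with <-≤-connex (cost e) x
        ... | inj₁ c<x = inj₁ c<x
        ... | inj₂ x≤c = inj₂ ((x≤c , c<2x) , <⇒≤ c<2x)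

      sumBelow-levels : ∀ n x → sumBelow (x * 2 ^ n) (allFin m) ≤
                        sumBelow x (allFin m) + ∑ n (λ l → length (levelEdges (x * 2 ^ l)) * (2 * (x * 2 ^ l)))
      sumBelow-levels zero x = ≤-reflexive (trans (cong (λ y → sumBelow y (allFin m)) (*-identityʳ x)) (sym (+-identityʳ _)))
      sumBelow-levels (suc n) x = begin
        S (x * (2 * 2 ^ n))            ≡⟨ cong S (shift n) ⟩
        S (2 * x * 2 ^ n)              ≤⟨ sumBelow-levels n (2 * x) ⟩
        S (2 * x) + ∑ n (λ l → g (2 * x * 2 ^ l))
                                       ≤⟨ +-monoˡ-≤ _ (sumBelow-double x (allFin m)) ⟩
        S x + g x + ∑ n (λ l → g (2 * x * 2 ^ l))
                                       ≡⟨ +-assoc (S x) _ _ ⟩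
        S x + (g x + ∑ n (λ l → g (2 * x * 2 ^ l)))
                                       ≡⟨ cong (S x +_) (cong₂ _+_ (cong g (sym (*-identityʳ x))) (∑-cong n (λ l → cong g (sym (shift l))))) ⟩
        S x + (g (x * 1) + ∑ n (λ l → g (x * (2 * 2 ^ l)))) ∎
        where
        open ≤-Reasoning
        S g : ℕ → ℕ
        S y = sumBelow y (allFin m)
        g y = length (levelEdges y) * (2 * y)
        shift : ∀ l → x * (2 * 2 ^ l) ≡ 2 * x * 2 ^ l
        shift l = e₁ x (2 ^ l)
          where
          e₁ : ∀ x y → x * (2 * y) ≡ 2 * x * y
          e₁ = solve-∀

      -- Segments shorter than the base scale `B` are charged `B` each. The `J * w` dyadic levels
      -- above reach beyond every distance and form `w` classes of `J` levels, and a segment of the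
      -- level with parameter `κ` costs at most `8Γκ`.
      total-bound : ∀ w → Λ ≡ 2 ^ w → ∀ κ₀ → 0 < κ₀ → suc M < Γ * (4 * κ₀) * 2 ^ (J * w) →
                    sum (map cost (allFin m)) ≤ m * (Γ * (4 * κ₀)) + w * (8 * Γ * (4 * suc M))
      total-bound w Λ≡ κ₀ κ₀>0 big = begin
        sum (map cost (allFin m))                ≡⟨ cong (sum ∘ map cost) (filter-all (λ e → cost e <? _)
                                                      (All.universal (λ e → ≤-<-trans (D≤ _ _) big) (allFin m))) ⟨
        sumBelow (B * 2 ^ (J * w)) (allFin m)    ≤⟨ sumBelow-levels (J * w) B ⟩
        sumBelow B (allFin m) + ∑ (J * w) g      ≤⟨ +-mono-≤ (≤-trans (sum-filter-≤ cost (λ e → cost e <? B) B (λ _ → <⇒≤) (allFin m))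
                                                                      (≤-reflexive (cong (_* B) (length-tabulate {n = m} id))))
                                                             (≤-reflexive (∑-residues w J g)) ⟩
        m * B + ∑ w (λ c → ∑ J (λ i → g (c + i * w)))
                                                 ≤⟨ +-monoʳ-≤ (m * B) (∑-mono w class) ⟩
        m * B + ∑ w (λ _ → 8 * Γ * (4 * suc M))  ≡⟨ cong (m * B +_) (∑-const w _) ⟩
        m * B + w * (8 * Γ * (4 * suc M))        ∎
        where
        open ≤-Reasoning
        B : ℕ
        B = Γ * (4 * κ₀)
        g : ℕ → ℕ
        g l = length (levelEdges (B * 2 ^ l)) * (2 * (B * 2 ^ l))
        class : ∀ c → ∑ J (λ i → g (c + i * w)) ≤ 8 * Γ * (4 * suc M)
        class c = begin
          ∑ J (λ i → g (c + i * w))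
            ≡⟨ ∑-cong J (λ i → trans (cong (λ y → length (levelEdges y) * (2 * y)) (e₁ Γ κ₀ (2 ^ (c + i * w))))
                                     (e₂ (length (levelEdges (Γ * (4 * κ i)))) Γ (κ i))) ⟩
          ∑ J (λ i → 8 * Γ * (length (levelEdges (Γ * (4 * κ i))) * κ i))
            ≡⟨ ∑-* (8 * Γ) J _ ⟩
          8 * Γ * ∑ J (λ i → length (levelEdges (Γ * (4 * κ i))) * κ i)
            ≤⟨ *-monoʳ-≤ (8 * Γ) (class-bound κ κ>0 κ-suc) ⟩
          8 * Γ * (4 * suc M) ∎
          where
          κ : ℕ → ℕ
          κ i = κ₀ * 2 ^ (c + i * w)
          κ>0 : ∀ i → 0 < κ i
          κ>0 i = *-mono-≤ κ₀>0 (m^n>0 2 (c + i * w))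
          κ-suc : ∀ i → κ (suc i) ≡ Λ * κ i
          κ-suc i = trans (cong (κ₀ *_) (trans (cong (2 ^_) (e₃ c w (i * w))) (trans (^-distribˡ-+-* 2 w (c + i * w)) (cong (_* 2 ^ (c + i * w)) (sym Λ≡)))))
                          (e₄ κ₀ Λ (2 ^ (c + i * w)))
            where
            e₃ : ∀ c w x → c + (w + x) ≡ w + (c + x)
            e₃ = solve-∀
            e₄ : ∀ k l p → k * (l * p) ≡ l * (k * p)
            e₄ = solve-∀
          e₁ : ∀ Γ k p → Γ * (4 * k) * p ≡ Γ * (4 * (k * p))
          e₁ = solve-∀
          e₂ : ∀ n Γ k → n * (2 * (Γ * (4 * k))) ≡ 8 * Γ * (n * k)
          e₂ = solve-∀

  n<2^n : ∀ n → n < 2 ^ n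
  n<2^n zero    = s≤s z≤n
  n<2^n (suc n) = begin-strict
    suc n            ≡⟨ +-comm 1 n ⟩
    n + 1            <⟨ +-mono-<-≤ (n<2^n n) (m^n>0 2 n) ⟩
    2 ^ n + 2 ^ n    ≡⟨ cong (2 ^ n +_) (+-identityʳ (2 ^ n)) ⟨
    2 ^ suc n        ∎
    where open ≤-Reasoning

  n≤[1+n/d]*d : ∀ n d .{{_ : NonZero d}} → n < suc (n / d) * d
  n≤[1+n/d]*d n d = begin-strict
    n                        ≡⟨ m≡m%n+[m/n]*n n d ⟩
    n % d + n / d * d        <⟨ +-monoˡ-< (n / d * d) (m%n<n n d) ⟩
    suc (n / d) * d          ∎
    where open ≤-Reasoning

  -- With w = 2G + s doublings per class, the numbers J of levels in a class and Γ of ball radii in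
  -- a cost satisfy J w = O(H), Γ = O(H) and 24 Γ J ≤ 2 ^ w.
  module Parameters (c : ℕ) (c-large : 32 * 54 + 25 ≤ c) (s : ℕ) (1≤s : 1 ≤ s) (s≤18 : s ≤ 18) (c-small : 48 * c ≤ 2 ^ s)
                    (H G : ℕ) (1≤H : 1 ≤ H) (G≤H : G ≤ H) (H≤2^G : H ≤ 2 ^ G) where

    w Λ J K h h₁ Γ : ℕ
    w  = G + G + s
    Λ  = 2 ^ w

    instance
      w≢0 : NonZero w
      w≢0 = >-nonZero (≤-trans 1≤s (m≤n+m s (G + G)))

    J  = suc (H / w)
    K  = Λ / J
    h  = 2 + w
    h₁ = suc H
    Γ  = suc (suc (suc (h + h)) * (32 * J) + suc (suc (h₁ + h₁)) * 4)

    Jw≤ : J * w ≤ w + H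
    Jw≤ = +-monoʳ-≤ w (m/n*n≤m H w)

    J≤ : J ≤ suc H
    J≤ = s≤s (m/n≤m H w)

    H≤Jw : H ≤ J * w
    H≤Jw = <⇒≤ (n≤[1+n/d]*d H w)

    -- Used twice: with `y = 2 ^ G` to compare with `Λ`, and with `y = H` in the final bound.
    Γ≤ : ∀ y → 1 ≤ y → H ≤ y → w ≤ 20 * y → Γ ≤ c * y
    Γ≤ y 1≤y H≤y w≤ = begin
      Γ                                   ≡⟨ e₁ w J H ⟩
      32 * (2 * (J * w) + 6 * J) + (1 + 8 * H + 16)
                                          ≤⟨ +-mono-≤ (*-monoʳ-≤ 32 inner) outer ⟩
      32 * (54 * y) + 25 * y              ≡⟨ cong (_+ 25 * y) (*-assoc 32 54 y) ⟨
      32 * 54 * y + 25 * y                ≡⟨ *-distribʳ-+ y (32 * 54) 25 ⟨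
      (32 * 54 + 25) * y                  ≤⟨ *-monoˡ-≤ y c-large ⟩
      c * y                               ∎
      where
      open ≤-Reasoning
      inner : 2 * (J * w) + 6 * J ≤ 54 * y
      inner = lin 0 (+-mono-≤ (+-mono-≤ (*-monoʳ-≤ 2 Jw≤) (*-monoʳ-≤ 6 J≤))
                              (+-mono-≤ (+-mono-≤ (*-monoʳ-≤ 8 H≤y) (*-monoʳ-≤ 2 w≤)) (*-monoʳ-≤ 6 1≤y)))
                    (arith w J H y)
        where
        arith : ∀ w J H y → 2 * (J * w) + 6 * J + (2 * (w + H) + 6 * suc H + (8 * y + 2 * (20 * y) + 6 * y)) + 0 ≡
                            54 * y + (2 * (J * w) + 6 * J + (8 * H + 2 * w + 6 * 1))
        arith = solve-∀
      outer : 1 + 8 * H + 16 ≤ 25 * y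
      outer = lin 0 (+-mono-≤ (*-monoʳ-≤ 8 H≤y) (*-monoʳ-≤ 17 1≤y)) (arith H y)
        where
        arith : ∀ H y → 1 + 8 * H + 16 + (8 * y + 17 * y) + 0 ≡ 25 * y + (8 * H + 17 * 1)
        arith = solve-∀
      e₁ : ∀ w J H → suc (suc (suc (2 + w + (2 + w))) * (32 * J) + suc (suc (suc H + suc H)) * 4) ≡
                     32 * (2 * (J * w) + 6 * J) + (1 + 8 * H + 16)
      e₁ = solve-∀

    G<2^G : G < 2 ^ G
    G<2^G = n<2^n G

    w≤-of : ∀ y → 1 ≤ y → G ≤ y → w ≤ 20 * y
    w≤-of y 1≤y G≤y = lin 0 (+-mono-≤ (+-mono-≤ (*-monoʳ-≤ 2 G≤y) (*-monoʳ-≤ 18 1≤y)) s≤18) (arith s G y)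
      where
      arith : ∀ s G y → G + G + s + (2 * y + 18 * y + 18) + 0 ≡ 20 * y + (2 * G + 18 * 1 + s)
      arith = solve-∀

    -- `Γ` and `J` are both O(2 ^ G). This is why `w` contains `2G`; the summand `s` absorbs the
    -- factor `48c`.
    ΓJ≤Λ : 24 * Γ * J ≤ Λ
    ΓJ≤Λ = begin
      24 * Γ * J                    ≤⟨ *-mono-≤ (*-monoʳ-≤ 24 (Γ≤ y (m^n>0 2 G) H≤2^G (w≤-of y (m^n>0 2 G) (<⇒≤ G<2^G))))
                                                (≤-trans J≤ (+-mono-≤ (m^n>0 2 G) H≤2^G)) ⟩
      24 * (c * y) * (y + y)        ≡⟨ arith c y ⟩
      48 * c * (y * y)              ≤⟨ *-monoˡ-≤ (y * y) c-small ⟩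
      2 ^ s * (y * y)              ≡⟨ *-comm (2 ^ s) (y * y) ⟩
      y * y * 2 ^ s                ≡⟨ cong (_* 2 ^ s) (^-distribˡ-+-* 2 G G) ⟨
      2 ^ (G + G) * 2 ^ s          ≡⟨ ^-distribˡ-+-* 2 (G + G) s ⟨
      Λ                             ∎
      where
      open ≤-Reasoning
      y : ℕ
      y = 2 ^ G
      arith : ∀ c y → 24 * (c * y) * (y + y) ≡ 48 * c * (y * y)
      arith = solve-∀

    JK≤Λ : J * K ≤ Λ
    JK≤Λ = ≤-trans (≤-reflexive (*-comm J K)) (m/n*n≤m Λ J)

    Λ≤JK : Λ ≤ J * suc K
    Λ≤JK = ≤-trans (<⇒≤ (n≤[1+n/d]*d Λ J)) (≤-reflexive (*-comm (suc K) J))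

    K≤h : 2 * suc K ≤ 2 ^ h
    K≤h = *-monoʳ-≤ 2 (≤-trans (+-mono-≤ (m^n>0 2 w) (m/n≤m Λ J)) (≤-reflexive (cong (Λ +_) (sym (+-identityʳ Λ)))))

    h<Γ : suc (suc (h + h)) * (32 * J) < Γ
    h<Γ = s≤s (m≤m+n _ _)

    h₁<Γ : suc (suc (h₁ + h₁)) * 4 < Γ
    h₁<Γ = s≤s (m≤n+m _ (suc (suc (h + h)) * (32 * J)))

  -- The cost bound for an integral metric with a tour

  module Core {V : Set} (D : V → V → ℕ) (D-refl : ∀ x → D x x ≡ 0)
              (D-sym : ∀ x y → D x y ≡ D y x) (D-tri : ∀ x y z → D x z ≤ D x y + D y z)
              {m : ℕ} (a b : Fin m → V)
              (star : Contraction.Star D D-refl D-sym D-tri a b)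
              (δ : V → ℕ → ℕ) (δ≤ : ∀ x y i → δ x i ≤ D x y + δ y i)
              (≤δ : ∀ x y i → D x y ≤ δ x i + δ y i)
              (δ-up : ∀ x i → δ x (suc i) ≤ suc (δ x i)) (δ-down : ∀ x i → δ x i ≤ suc (δ x (suc i)))
              (M : ℕ) (δ-zero : ∀ x → ∃[ i ] i ≤ M × δ x i ≡ 0)
              (c : ℕ) (c-large : 32 * 54 + 25 ≤ c)
              (s : ℕ) (1≤s : 1 ≤ s) (s≤18 : s ≤ 18) (c-small : 48 * c ≤ 2 ^ s) where

    open Levels D D-refl D-sym D-tri a b star δ δ≤ ≤δ δ-up δ-down M δ-zero

    cost-bound : ∀ H G → 1 ≤ H → G ≤ H → H ≤ 2 ^ G → m ≤ 2 ^ H →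
                 sum (map (λ e → D (a e) (b e)) (allFin m)) ≤ 36 * (c * H) * (18 * suc G) * (suc M + m)
    cost-bound H G 1≤H G≤H H≤2^G m≤ = begin
      sum (map cost (allFin m))                                ≤⟨ total-bound w refl κ₀ (s≤s z≤n) big ⟩
      m * (Γ * (4 * κ₀)) + w * (8 * Γ * (4 * suc M))           ≡⟨ e₁ m Γ κ₀ w (suc M) ⟩
      4 * Γ * (m * κ₀) + 32 * Γ * w * suc M                    ≤⟨ +-monoˡ-≤ _ (*-mono-≤ (m≤m*n (4 * Γ) w) mκ₀≤) ⟩
      4 * Γ * w * (m + suc M) + 32 * Γ * w * suc M             ≤⟨ lin (32 * Γ * w * m) (≤-refl {0}) (e₂ m Γ w (suc M)) ⟩
      36 * Γ * w * (suc M + m)                                 ≤⟨ *-monoˡ-≤ (suc M + m)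
                                                                     (*-mono-≤ (*-monoʳ-≤ 36 (Γ≤ H 1≤H ≤-refl (w≤-of H 1≤H G≤H))) w≤) ⟩
      36 * (c * H) * (18 * suc G) * (suc M + m)             ∎
      where
      open ≤-Reasoning
      open Parameters c c-large s 1≤s s≤18 c-small H G 1≤H G≤H H≤2^G
      instance
        2^H≢0 : NonZero (2 ^ H)
        2^H≢0 = >-nonZero (m^n>0 2 H)
      open Cores J K Λ Γ h h₁ (s≤s z≤n) ΓJ≤Λ JK≤Λ Λ≤JK K≤h h<Γ (*-monoʳ-≤ 2 m≤) h₁<Γ
      κ₀ : ℕ
      -- A base scale of order `M / 2 ^ H`: low enough for at most `2 ^ H` cheap segments to cost
      -- O(Γ (M + m)), high enough for `H` doublings to pass `M`.
      κ₀ = suc (M / 2 ^ H)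
      w≤ : w ≤ 18 * suc G
      w≤ = lin (16 * G) s≤18 (e₃ s G)
        where
        e₃ : ∀ s G → G + G + s + 18 + 16 * G ≡ 18 * suc G + s
        e₃ = solve-∀
      mκ₀≤ : m * κ₀ ≤ m + suc M
      mκ₀≤ = begin
        m * κ₀                       ≡⟨ *-suc m (M / 2 ^ H) ⟩
        m + m * (M / 2 ^ H)          ≤⟨ +-monoʳ-≤ m (*-monoˡ-≤ (M / 2 ^ H) m≤) ⟩
        m + 2 ^ H * (M / 2 ^ H)      ≡⟨ cong (m +_) (*-comm (2 ^ H) _) ⟩
        m + M / 2 ^ H * 2 ^ H        ≤⟨ +-monoʳ-≤ m (≤-trans (m/n*n≤m M (2 ^ H)) (n≤1+n M)) ⟩
        m + suc M                    ∎
      big : suc M < Γ * (4 * κ₀) * 2 ^ (J * w)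
      big = begin-strict
        suc M                        ≤⟨ n≤[1+n/d]*d M (2 ^ H) ⟩
        κ₀ * 2 ^ H                   <⟨ m<m+n (κ₀ * 2 ^ H) (*-mono-≤ (s≤s (z≤n {M / 2 ^ H})) (m^n>0 2 H)) ⟩
        κ₀ * 2 ^ H + κ₀ * 2 ^ H      ≤⟨ lin (2 * (κ₀ * 2 ^ H)) (≤-refl {0}) (e₄ (κ₀) (2 ^ H)) ⟩
        1 * (4 * κ₀) * 2 ^ H         ≤⟨ *-mono-≤ (*-monoˡ-≤ (4 * κ₀) (s≤s (z≤n {Γ ∸ 1}))) (^-monoʳ-≤ 2 H≤Jw) ⟩
        Γ * (4 * κ₀) * 2 ^ (J * w)   ∎
        where
        e₄ : ∀ k p → k * p + k * p + 0 + 2 * (k * p) ≡ 1 * (4 * k) * p + 0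
        e₄ = solve-∀
      e₁ : ∀ m Γ k w M → m * (Γ * (4 * k)) + w * (8 * Γ * (4 * M)) ≡ 4 * Γ * (m * k) + 32 * Γ * w * M
      e₁ = solve-∀
      e₂ : ∀ m Γ w M → 4 * Γ * w * (m + M) + 32 * Γ * w * M + 0 + 32 * Γ * w * m ≡ 36 * Γ * w * (M + m) + 0
      e₂ = solve-∀

  -- Minima over lists and tours around a tree

  module _ {a} {A : Set a} (f : A → ℕ) where

    minimum : A → List A → ℕ
    minimum x = foldr (λ y acc → f y ⊓ acc) (f x)

    minimum-≤ : ∀ {x y} ys → y ∈ ys → minimum x ys ≤ f y
    minimum-≤ (z ∷ ys) (here refl) = m⊓n≤m (f z) _
    minimum-≤ (z ∷ ys) (there y∈)  = ≤-trans (m⊓n≤n (f z) _) (minimum-≤ ys y∈)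

    minimum-attained : ∀ {x} ys → x ∈ ys → ∃[ y ] y ∈ ys × minimum x ys ≡ f y
    minimum-attained {x} ys x∈ with go ys
      where
      go : ∀ ys → minimum x ys ≡ f x ⊎ (∃[ y ] y ∈ ys × minimum x ys ≡ f y)
      go [] = inj₁ refl
      go (y ∷ ys) with ⊓-sel (f y) (minimum x ys) | go ys
      ... | inj₁ eq | _                  = inj₂ (y , here refl , eq)
      ... | inj₂ eq | inj₁ eq′           = inj₁ (trans eq eq′)
      ... | inj₂ eq | inj₂ (z , z∈ , eq′) = inj₂ (z , there z∈ , trans eq eq′)
    ... | inj₁ eq = x , x∈ , eq
    ... | inj₂ p  = p

    sum-remove : ∀ {x ys} (x∈ : x ∈ ys) → f x + sum (map f (remove x∈)) ≡ sum (map f ys)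
    sum-remove (here refl) = refl
    sum-remove {x} {y ∷ ys} (there x∈) =
      trans (rotate (f x) (f y) _) (cong (f y +_) (sum-remove x∈))
      where
      rotate : ∀ x y z → x + (y + z) ≡ y + (x + z)
      rotate = solve-∀

  module Tours {n : ℕ} (D : Fin n → Fin n → ℕ) (D-refl : ∀ x → D x x ≡ 0)
               (D-sym : ∀ x y → D x y ≡ D y x) (D-tri : ∀ x y z → D x z ≤ D x y + D y z) where

    open DecMembership (Finₚ._≟_ {n}) using (_∈?_)

    -- Times at which a walk of length M that visits the vertices of A passes through them.
    record Tour (A : List (Fin n)) (M : ℕ) : Set where
      field
        pos   : Fin n → ℕ
        pos≤M : ∀ {x} → x ∈ A → pos x ≤ M
        apart : ∀ {x y} → x ∈ A → y ∈ A → pos x + D x y ≤ pos y ⊎ pos y + D x y ≤ pos x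

    start : ∀ x → Tour (x ∷ []) 0
    start x = record { pos = λ _ → 0 ; pos≤M = λ _ → z≤n
                     ; apart = λ { (here refl) (here refl) → inj₁ (≤-reflexive (D-refl _)) } }

    -- An excursion from `x` to `y` and back: positions after that of `x` are delayed by `2ℓ`, and
    -- `y` is reached half-way.
    module Detour {A : List (Fin n)} {M : ℕ} {x y : Fin n} (x∈ : x ∈ A) (T : Tour A M) where
      open Tour T

      ℓ : ℕ
      ℓ = D x y

      pos′ : Fin n → ℕ
      pos′ z with z Finₚ.≟ y
      ... | yes _ = pos x + ℓ
      ... | no  _ with pos z ≤? pos x
      ...   | yes _ = pos z
      ...   | no  _ = pos z + (ℓ + ℓ)

      Apart : Fin n → Fin n → Set
      Apart u v = pos′ u + D u v ≤ pos′ v ⊎ pos′ v + D u v ≤ pos′ u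

      apart-sym : ∀ {u v} → Apart u v → Apart v u
      apart-sym {u} {v} (inj₁ p) = inj₂ (≤-trans (≤-reflexive (cong (pos′ u +_) (D-sym v u))) p)
      apart-sym {u} {v} (inj₂ p) = inj₁ (≤-trans (≤-reflexive (cong (pos′ v +_) (D-sym v u))) p)

      before : ∀ {z} → z ∈ A → pos z ≤ pos x → pos z + D x z ≤ pos x
      before z∈ z≤x with apart x∈ z∈
      ... | inj₂ p = p
      ... | inj₁ p = ≤-trans (+-monoˡ-≤ _ z≤x) (≤-trans p z≤x)

      after : ∀ {z} → z ∈ A → ¬ (pos z ≤ pos x) → pos x + D x z ≤ pos z
      after z∈ z≰x with apart x∈ z∈
      ... | inj₁ p = p
      ... | inj₂ p = contradiction (≤-trans (m≤m+n _ _) p) z≰x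

      new-old : ∀ {z} → z ∈ A → z ≢ y → pos x + ℓ + D y z ≤ pos′ z ⊎ pos′ z + D y z ≤ pos x + ℓ
      new-old {z} z∈ z≢y with z Finₚ.≟ y
      ... | yes z≡y = contradiction z≡y z≢y
      ... | no  _   with pos z ≤? pos x
      ...   | yes z≤x = inj₂ (lin 0 (+-mono-≤ (D-tri y x z) (+-mono-≤ (before z∈ z≤x) (≤-reflexive (D-sym y x))))
                                (arith (pos z) (D y z) (D y x) (D x z) (pos x) ℓ))
        where
        arith : ∀ pz yz yx xz px l → pz + yz + (yx + xz + (px + l)) + 0 ≡ px + l + (yz + (pz + xz + yx))
        arith = solve-∀
      ...   | no z≰x  = inj₁ (lin 0 (+-mono-≤ (D-tri y x z) (+-mono-≤ (after z∈ z≰x) (≤-reflexive (D-sym y x))))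
                                (arith (pos z) (D y z) (D y x) (D x z) (pos x) ℓ))
        where
        arith : ∀ pz yz yx xz px l → px + l + yz + (yx + xz + (pz + l)) + 0 ≡ pz + (l + l) + (yz + (px + xz + yx))
        arith = solve-∀

      old-old : ∀ {u v} → u ∈ A → v ∈ A → pos u + D u v ≤ pos v → u ≢ y → v ≢ y → pos′ u + D u v ≤ pos′ v
      old-old {u} {v} u∈ v∈ p u≢y v≢y with u Finₚ.≟ y | v Finₚ.≟ y
      ... | yes u≡y | _       = contradiction u≡y u≢y
      ... | no _    | yes v≡y = contradiction v≡y v≢y
      ... | no _    | no _    with pos u ≤? pos x | pos v ≤? pos x
      ...   | yes _  | yes _  = p
      ...   | yes _  | no _   = ≤-trans p (m≤m+n _ _)
      ...   | no u≰x | yes v≤x = contradiction (≤-trans (≤-trans (m≤m+n _ _) p) v≤x) u≰x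
      ...   | no _   | no _   = lin 0 p (arith (pos u) (D u v) (pos v) (ℓ + ℓ))
        where
        arith : ∀ pu d pv l → pu + l + d + pv + 0 ≡ pv + l + (pu + d)
        arith = solve-∀

      pos′-y : pos′ y ≡ pos x + ℓ
      pos′-y with y Finₚ.≟ y
      ... | yes _  = refl
      ... | no y≢y = contradiction refl y≢y

      pos′≤ : ∀ {z} → z ∈ y ∷ A → pos′ z ≤ M + (ℓ + ℓ)
      pos′≤ {z} z∈ with z Finₚ.≟ y | z∈
      ... | yes _  | _         = +-mono-≤ (pos≤M x∈) (m≤m+n ℓ ℓ)
      ... | no z≢y | here z≡y  = contradiction z≡y z≢y
      ... | no _   | there z∈′ with pos z ≤? pos x
      ...   | yes _ = ≤-trans (pos≤M z∈′) (m≤m+n M _)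
      ...   | no _  = +-monoˡ-≤ (ℓ + ℓ) (pos≤M z∈′)

      apart′ : y ∉ A → ∀ {u v} → u ∈ y ∷ A → v ∈ y ∷ A → Apart u v
      apart′ y∉ (here refl) (here refl) = inj₁ (≤-reflexive (trans (cong (pos′ y +_) (D-refl y)) (+-identityʳ _)))
      apart′ y∉ {v = v} (here refl) (there v∈) =
        subst (λ p → p + D y v ≤ pos′ v ⊎ pos′ v + D y v ≤ p) (sym pos′-y) (new-old v∈ (λ { refl → y∉ v∈ }))
      apart′ y∉ (there u∈)  (here refl) = apart-sym (apart′ y∉ (here refl) (there u∈))
      apart′ y∉ {u} {v} (there u∈)  (there v∈) with apart u∈ v∈
      ... | inj₁ p = inj₁ (old-old u∈ v∈ p (λ { refl → y∉ u∈ }) (λ { refl → y∉ v∈ }))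
      ... | inj₂ p = inj₂ (≤-trans (≤-reflexive (cong (pos′ v +_) (D-sym u v)))
                            (old-old v∈ u∈ (≤-trans (≤-reflexive (cong (pos v +_) (D-sym v u))) p)
                                     (λ { refl → y∉ v∈ }) (λ { refl → y∉ u∈ })))

      detour : y ∉ A → Tour (y ∷ A) (M + (ℓ + ℓ))
      detour y∉ = record { pos = pos′ ; pos≤M = pos′≤ ; apart = apart′ y∉ }

    module _ {E : Set} (end₁ end₂ : E → Fin n) where

      Crossing : List (Fin n) → E → Set
      Crossing A e = (end₁ e ∈ A × end₂ e ∉ A) ⊎ (end₂ e ∈ A × end₁ e ∉ A)

      crossing? : ∀ A → Decidable (Crossing A)
      crossing? A e = ((end₁ e ∈? A) ×-dec ¬? (end₂ e ∈? A)) ⊎-dec ((end₂ e ∈? A) ×-dec ¬? (end₁ e ∈? A))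

      size : E → ℕ
      size e = D (end₁ e) (end₂ e)

      record Covering (Es : List E) (A : List (Fin n)) (L : ℕ) : Set where
        field
          {A′}   : List (Fin n)
          {M}    : ℕ
          tour   : Tour A′ M
          short  : M ≤ L
          A⊆A′   : A ⊆ A′
          closed : ∀ {e} → e ∈ Es → ¬ Crossing A′ e

      -- An edge that leads out of the visited set is used for one detour and then struck from `R`,
      -- since both its ends are now visited. Hence every edge is paid at most twice.
      cover : ∀ Es R {A M} → Tour A M → (∀ {e} → e ∈ Es → e ∈ R ⊎ (end₁ e ∈ A × end₂ e ∈ A)) →
              Covering Es A (M + 2 * sum (map size R))
      cover Es R = go (length R) R ≤-refl
        where
        go : ∀ fuel R → length R ≤ fuel → ∀ {A M} → Tour A M →
             (∀ {e} → e ∈ Es → e ∈ R ⊎ (end₁ e ∈ A × end₂ e ∈ A)) → Covering Es A (M + 2 * sum (map size R))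
        go fuel R ∣R∣≤ {A} {M} T rest with Any.any? (crossing? A) R
        ... | no none = record
          { tour = T ; short = m≤m+n M _ ; A⊆A′ = id
          ; closed = λ e∈ cr → done (rest e∈) cr }
          where
          done : ∀ {e} → e ∈ R ⊎ (end₁ e ∈ A × end₂ e ∈ A) → ¬ Crossing A e
          done (inj₁ e∈R)       cr             = none (Any.map (λ { refl → cr }) e∈R)
          done (inj₂ (_ , e₂∈)) (inj₁ (_ , e₂∉)) = e₂∉ e₂∈
          done (inj₂ (e₁∈ , _)) (inj₂ (_ , e₁∉)) = e₁∉ e₁∈
        go zero [] _ T rest | yes ()
        go (suc fuel) R ∣R∣≤ {A} {M} T rest | yes some with e , e∈ , cr ← find some = step cr
          where
          R′ : List E
          R′ = remove e∈
          continue : ∀ {x y} → x ∈ A → y ∉ A → D x y ≡ size e → (end₁ e ∈ y ∷ A × end₂ e ∈ y ∷ A) →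
                     Covering Es A (M + 2 * sum (map size R))
          continue {x} {y} x∈ y∉ eq both = record
            { tour = Covering.tour covering ; short = ≤-trans (Covering.short covering) (≤-reflexive total)
            ; A⊆A′ = Covering.A⊆A′ covering ∘ there ; closed = Covering.closed covering }
            where
            rest′ : ∀ {f} → f ∈ Es → f ∈ R′ ⊎ (end₁ f ∈ y ∷ A × end₂ f ∈ y ∷ A)
            rest′ {f} f∈ with rest f∈
            ... | inj₂ (f₁ , f₂) = inj₂ (there f₁ , there f₂)
            ... | inj₁ f∈R with (end₁ f ∈? y ∷ A) ×-dec (end₂ f ∈? y ∷ A)
            ...   | yes p = inj₂ p
            ...   | no ¬p = inj₁ (∈-remove e∈ f∈R (λ { refl → ¬p both }))
            covering : Covering Es (y ∷ A) (M + (D x y + D x y) + 2 * sum (map size R′))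
            covering = go fuel R′ (s≤s⁻¹ (≤-trans (≤-reflexive (length-remove e∈)) ∣R∣≤)) (Detour.detour x∈ T y∉) rest′
            total : M + (D x y + D x y) + 2 * sum (map size R′) ≡ M + 2 * sum (map size R)
            total = trans (arith M (D x y) (sum (map size R′)))
                          (cong (λ s → M + 2 * s) (trans (cong (_+ sum (map size R′)) eq) (sum-remove size e∈)))
              where
              arith : ∀ M d s → M + (d + d) + 2 * s ≡ M + 2 * (d + s)
              arith = solve-∀
          step : Crossing A e → Covering Es A (M + 2 * sum (map size R))
          step (inj₁ (e₁∈ , e₂∉)) = continue e₁∈ e₂∉ refl (there e₁∈ , here refl)
          step (inj₂ (e₂∈ , e₁∉)) = continue e₂∈ e₁∉ (D-sym _ _) (here refl , there e₂∈)

    module TourDistance {A : List (Fin n)} {M : ℕ} (T : Tour A M) {root : Fin n} (root∈ : root ∈ A) where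
      open Tour T

      -- `apart` is known only for visited vertices, so the bound is applied to the metric
      -- restricted to them.
      V : Set
      V = ∃[ x ] x ∈ A

      -- The distance after gluing the line of positions to the vertices, each visited `x` at
      -- `pos x`. By `D≤∣-∣` the line is no short cut between vertices.
      δ : V → ℕ → ℕ
      δ (v , _) i = minimum (λ x → D v x + ∣ i - pos x ∣) root A

      δ-≤ : ∀ v {x} i → x ∈ A → δ v i ≤ D (proj₁ v) x + ∣ i - pos x ∣
      δ-≤ v i x∈ = minimum-≤ _ A x∈

      δ-attained : ∀ v i → ∃[ x ] x ∈ A × δ v i ≡ D (proj₁ v) x + ∣ i - pos x ∣
      δ-attained v i = minimum-attained _ A root∈

      D≤∣-∣ : ∀ {x y} → x ∈ A → y ∈ A → D x y ≤ ∣ pos x - pos y ∣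
      D≤∣-∣ {x} {y} x∈ y∈ with apart x∈ y∈
      ... | inj₂ p = ≤-trans (m+n≤o⇒m≤o∸n _ (≤-trans (≤-reflexive (+-comm _ (pos y))) p)) (m∸n≤∣m-n∣ (pos x) (pos y))
      ... | inj₁ p = ≤-trans (m+n≤o⇒m≤o∸n _ (≤-trans (≤-reflexive (+-comm _ (pos x))) p))
                             (≤-trans (m∸n≤∣m-n∣ (pos y) (pos x)) (≤-reflexive (∣-∣-comm (pos y) (pos x))))

      δ≤ : ∀ v w i → δ v i ≤ D (proj₁ v) (proj₁ w) + δ w i
      δ≤ v w i with x , x∈ , eq ← δ-attained w i = begin
        δ v i                                                              ≤⟨ δ-≤ v i x∈ ⟩
        D (proj₁ v) x + ∣ i - pos x ∣                                      ≤⟨ +-monoˡ-≤ _ (D-tri _ (proj₁ w) x) ⟩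
        D (proj₁ v) (proj₁ w) + D (proj₁ w) x + ∣ i - pos x ∣              ≡⟨ +-assoc (D (proj₁ v) (proj₁ w)) _ _ ⟩
        D (proj₁ v) (proj₁ w) + (D (proj₁ w) x + ∣ i - pos x ∣)            ≡⟨ cong (D (proj₁ v) (proj₁ w) +_) eq ⟨
        D (proj₁ v) (proj₁ w) + δ w i                                      ∎
        where open ≤-Reasoning

      ≤δ : ∀ v w i → D (proj₁ v) (proj₁ w) ≤ δ v i + δ w i
      ≤δ (v , v∈) (w , w∈) i with x , x∈ , eqx ← δ-attained (v , v∈) i | y , y∈ , eqy ← δ-attained (w , w∈) i = begin
        D v w                                                  ≤⟨ D-tri v x w ⟩
        D v x + D x w                                          ≤⟨ +-monoʳ-≤ (D v x) (D-tri x y w) ⟩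
        D v x + (D x y + D y w)                                ≤⟨ +-monoʳ-≤ (D v x) (+-mono-≤ (≤-trans (D≤∣-∣ x∈ y∈) (∣-∣-triangle (pos x) i (pos y)))
                                                                                              (≤-reflexive (D-sym y w))) ⟩
        D v x + (∣ pos x - i ∣ + ∣ i - pos y ∣ + D w y)        ≡⟨ cong (λ t → D v x + (t + ∣ i - pos y ∣ + D w y)) (∣-∣-comm (pos x) i) ⟩
        D v x + (∣ i - pos x ∣ + ∣ i - pos y ∣ + D w y)        ≡⟨ arith (D v x) ∣ i - pos x ∣ ∣ i - pos y ∣ (D w y) ⟩
        D v x + ∣ i - pos x ∣ + (D w y + ∣ i - pos y ∣)        ≡⟨ cong₂ _+_ eqx eqy ⟨
        δ (v , v∈) i + δ (w , w∈) i                            ∎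
        where
        open ≤-Reasoning
        arith : ∀ a b c d → a + (b + c + d) ≡ a + b + (d + c)
        arith = solve-∀

      ∣1+i-i∣ : ∀ i → ∣ suc i - i ∣ ≡ 1
      ∣1+i-i∣ zero    = refl
      ∣1+i-i∣ (suc i) = ∣1+i-i∣ i

      δ-lipschitz : ∀ v i j → δ v i ≤ ∣ i - j ∣ + δ v j
      δ-lipschitz v i j with x , x∈ , eq ← δ-attained v j = begin
        δ v i                                              ≤⟨ δ-≤ v i x∈ ⟩
        D (proj₁ v) x + ∣ i - pos x ∣                      ≤⟨ +-monoʳ-≤ (D (proj₁ v) x) (∣-∣-triangle i j (pos x)) ⟩
        D (proj₁ v) x + (∣ i - j ∣ + ∣ j - pos x ∣)        ≡⟨ arith (D (proj₁ v) x) ∣ i - j ∣ ∣ j - pos x ∣ ⟩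
        ∣ i - j ∣ + (D (proj₁ v) x + ∣ j - pos x ∣)        ≡⟨ cong (∣ i - j ∣ +_) eq ⟨
        ∣ i - j ∣ + δ v j                                  ∎
        where
        open ≤-Reasoning
        arith : ∀ a b c → a + (b + c) ≡ b + (a + c)
        arith = solve-∀

      δ-up : ∀ v i → δ v (suc i) ≤ suc (δ v i)
      δ-up v i = ≤-trans (δ-lipschitz v (suc i) i) (≤-reflexive (cong (_+ δ v i) (∣1+i-i∣ i)))

      δ-down : ∀ v i → δ v i ≤ suc (δ v (suc i))
      δ-down v i = ≤-trans (δ-lipschitz v i (suc i))
                     (≤-reflexive (cong (_+ δ v (suc i)) (trans (∣-∣-comm i (suc i)) (∣1+i-i∣ i))))

      δ-zero : ∀ v → ∃[ i ] i ≤ M × δ v i ≡ 0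
      δ-zero v@(x , x∈) = pos x , pos≤M x∈ , n≤0⇒n≡0 (≤-trans (δ-≤ v (pos x) x∈)
        (≤-reflexive (cong₂ _+_ (D-refl x) (∣n-n∣≡0 (pos x)))))

      module _ {m : ℕ} (a b : Fin m → Fin n) (a∈ : ∀ e → a e ∈ A) (b∈ : ∀ e → b e ∈ A)
               (star : Contraction.Star D D-refl D-sym D-tri a b)
               (c : ℕ) (c-large : 32 * 54 + 25 ≤ c)
               (s : ℕ) (1≤s : 1 ≤ s) (s≤18 : s ≤ 18) (c-small : 48 * c ≤ 2 ^ s) where

        private
          D′ : V → V → ℕ
          D′ v w = D (proj₁ v) (proj₁ w)
          a′ b′ : Fin m → V
          a′ e = a e , a∈ e
          b′ e = b e , b∈ e
          module C  = Contraction D D-refl D-sym D-tri a b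
          module C′ = Contraction D′ (D-refl ∘ proj₁) (λ v w → D-sym _ _) (λ u v w → D-tri _ _ _) a′ b′

          forget : ∀ {H v w d} → C′.Conn H v w d → C.Conn H (proj₁ v) (proj₁ w) d
          forget (C′.gap p)            = C.gap p
          forget (C′.hop p h ends w l) = C.hop p h (forget-ends ends) (forget w) l
            where
            forget-ends : ∀ {e u v} → C′.Ends e u v → C.Ends e (proj₁ u) (proj₁ v)
            forget-ends (inj₁ (refl , refl)) = inj₁ (refl , refl)
            forget-ends (inj₂ (refl , refl)) = inj₂ (refl , refl)

        tour-bound : ∀ H G → 1 ≤ H → G ≤ H → H ≤ 2 ^ G → m ≤ 2 ^ H →
                     sum (map (λ e → D (a e) (b e)) (allFin m)) ≤ 36 * (c * H) * (18 * suc G) * (suc M + m)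
        tour-bound = Core.cost-bound D′ (D-refl ∘ proj₁) (λ v w → D-sym _ _) (λ u v w → D-tri _ _ _) a′ b′
                       (λ e w → star e (forget w)) δ δ≤ ≤δ δ-up δ-down M δ-zero c c-large s 1≤s s≤18 c-small

open Combinatorics using (unique⊆⇒length≤; lin; n<2^n; module Contraction; module Tours)

-- Permits classical reasoning towards a negation, in particular towards any inequality `_≤_` of
-- reals.
¬¬-bind : ∀ {a b} {A : Set a} {B : Set b} → ¬ ¬ A → (A → ¬ B) → ¬ B
¬¬-bind ¬¬a f b = ¬¬a (λ a → f a b)

-- Arithmetic of the ordered field

module OrderedField {c ℓ₁ ℓ₂} (ℝ : RealField c ℓ₁ ℓ₂) where

  open RealField ℝ public
  open CommutativeRing commutativeRing public using (commutativeSemiring; semiring; ring)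
  open RingProperties ring using (-‿distribˡ-*; -‿distribʳ-*; -‿involutive)

  private module < = IsStrictPartialOrder isStrictPartialOrder

  <-irrefl : ∀ {x y} → x ≈ y → ¬ x < y
  <-irrefl = <.irrefl

  <-trans : ∀ {x y z} → x < y → y < z → x < z
  <-trans = <.trans

  <-respˡ : ∀ {x y z} → x ≈ y → x < z → y < z
  <-respˡ = <.<-respˡ-≈

  <-respʳ : ∀ {x y z} → y ≈ z → x < y → x < z
  <-respʳ = <.<-respʳ-≈

  <⇒≤ : ∀ {x y} → x < y → x ≤ y
  <⇒≤ x<y y<x = <-irrefl refl (<-trans x<y y<x)

  ≤-reflexive : ∀ {x y} → x ≈ y → x ≤ y
  ≤-reflexive x≈y = <-irrefl (sym x≈y)

  ≤-refl : ∀ {x} → x ≤ x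
  ≤-refl = ≤-reflexive refl

  <-≤-trans : ∀ {x y z} → x < y → y ≤ z → x < z
  <-≤-trans {z = z} x<y y≤z with <-cotrans x<y z
  ... | inj₁ x<z = x<z
  ... | inj₂ z<y = contradiction z<y y≤z

  ≤-<-trans : ∀ {x y z} → x ≤ y → y < z → x < z
  ≤-<-trans {x} x≤y y<z with <-cotrans y<z x
  ... | inj₁ y<x = contradiction y<x x≤y
  ... | inj₂ x<z = x<z

  ≤-trans : ∀ {x y z} → x ≤ y → y ≤ z → x ≤ z
  ≤-trans x≤y y≤z z<x = x≤y (≤-<-trans y≤z z<x)

  +-monoʳ-< : ∀ {x y} z → x < y → z + x < z + y
  +-monoʳ-< z x<y = <-respˡ (+-comm _ z) (<-respʳ (+-comm _ z) (+-monoˡ-< z x<y))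

  +-cancelʳ-< : ∀ {x y} z → x + z < y + z → x < y
  +-cancelʳ-< {x} {y} z x+z<y+z = <-respˡ (cancel x) (<-respʳ (cancel y) (+-monoˡ-< (- z) x+z<y+z))
    where
    cancel : ∀ x → x + z + - z ≈ x
    cancel x = trans (+-assoc x z (- z)) (trans (+-congˡ (-‿inverseʳ z)) (+-identityʳ x))

  +-monoˡ-≤ : ∀ {x y} z → x ≤ y → x + z ≤ y + z
  +-monoˡ-≤ z x≤y y+z<x+z = x≤y (+-cancelʳ-< z y+z<x+z)

  +-monoʳ-≤ : ∀ {x y} z → x ≤ y → z + x ≤ z + y
  +-monoʳ-≤ z x≤y = ≤-trans (≤-reflexive (+-comm z _)) (≤-trans (+-monoˡ-≤ z x≤y) (≤-reflexive (+-comm _ z)))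

  +-mono-≤ : ∀ {x y u v} → x ≤ y → u ≤ v → x + u ≤ y + v
  +-mono-≤ {y = y} {u} x≤y u≤v = ≤-trans (+-monoˡ-≤ u x≤y) (+-monoʳ-≤ y u≤v)

  +-cancelʳ-≤ : ∀ {x y} z → x + z ≤ y + z → x ≤ y
  +-cancelʳ-≤ z x+z≤y+z y<x = x+z≤y+z (+-monoˡ-< z y<x)

  lin≤ : ∀ {X Y A B} → X ≤ Y → A + Y ≈ B + X → A ≤ B
  lin≤ {X} {Y} {A} {B} X≤Y eq = +-cancelʳ-≤ Y (≤-trans (≤-reflexive eq) (+-monoʳ-≤ B X≤Y))

  x≤x+y : ∀ {x y} → 0# ≤ y → x ≤ x + y
  x≤x+y {x} 0≤y = ≤-trans (≤-reflexive (sym (+-identityʳ x))) (+-monoʳ-≤ x 0≤y)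

  x≤y+x : ∀ {x y} → 0# ≤ y → x ≤ y + x
  x≤y+x {x} 0≤y = ≤-trans (≤-reflexive (sym (+-identityˡ x))) (+-monoˡ-≤ x 0≤y)

  gap : ∀ {x y} → x < y → ∃[ d ] 0# < d × y ≈ x + d
  gap {x} {y} x<y = y + - x , <-respˡ (-‿inverseʳ x) (+-monoˡ-< (- x) x<y) , sym (begin
    x + (y + - x)    ≈⟨ +-congˡ (+-comm y (- x)) ⟩
    x + (- x + y)    ≈⟨ +-assoc x (- x) y ⟨
    x + - x + y      ≈⟨ +-congʳ (-‿inverseʳ x) ⟩
    0# + y           ≈⟨ +-identityˡ y ⟩
    y                ∎)
    where open import Relation.Binary.Reasoning.Setoid setoid

  *-monoˡ-< : ∀ {x y z} → 0# < z → x < y → z * x < z * y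
  *-monoˡ-< {x} {y} {z} 0<z x<y with d , 0<d , y≈ ← gap x<y =
    <-respˡ (+-identityʳ (z * x)) (<-respʳ (trans (sym (distribˡ z x d)) (*-congˡ (sym y≈)))
      (+-monoʳ-< (z * x) (*-pos 0<z 0<d)))

  -- By tightness, numbers that are not apart are equal.
  ≤-cases : ∀ {x y} → x ≤ y → ¬ ¬ (x < y ⊎ x ≈ y)
  ≤-cases {x} {y} x≤y ¬cases = ¬cases (inj₂ (proj₁ (tight x y) λ x#y →
    [ ¬cases ∘ inj₁ , x≤y ]′ (Equivalence.to #⇔<⊎> x#y)))

  *-monoˡ-≤ : ∀ {x y z} → 0# ≤ z → x ≤ y → z * x ≤ z * y
  *-monoˡ-≤ {x} {y} {z} 0≤z x≤y = ¬¬-bind (≤-cases 0≤z) λ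
    { (inj₂ 0≈z) → ≤-reflexive (trans (*-congʳ (sym 0≈z)) (trans (zeroˡ x) (sym (trans (*-congʳ (sym 0≈z)) (zeroˡ y)))))
    ; (inj₁ 0<z) → ¬¬-bind (≤-cases x≤y) λ
      { (inj₁ x<y) → <⇒≤ (*-monoˡ-< 0<z x<y) ; (inj₂ x≈y) → ≤-reflexive (*-congˡ x≈y) } }

  *-monoʳ-≤ : ∀ {x y z} → 0# ≤ z → x ≤ y → x * z ≤ y * z
  *-monoʳ-≤ {x} {y} {z} 0≤z x≤y =
    ≤-trans (≤-reflexive (*-comm x z)) (≤-trans (*-monoˡ-≤ 0≤z x≤y) (≤-reflexive (*-comm z y)))

  *-mono-≤ : ∀ {x y u v} → 0# ≤ u → 0# ≤ y → x ≤ y → u ≤ v → x * u ≤ y * v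
  *-mono-≤ 0≤u 0≤y x≤y u≤v = ≤-trans (*-monoʳ-≤ 0≤u x≤y) (*-monoˡ-≤ 0≤y u≤v)

  *-nonneg : ∀ {x y} → 0# ≤ x → 0# ≤ y → 0# ≤ x * y
  *-nonneg {x} 0≤x 0≤y = ≤-trans (≤-reflexive (sym (zeroʳ x))) (*-monoˡ-≤ 0≤x 0≤y)

  1#0 : 1# # 0#
  1#0 = invertible⇒# (1# , trans (*-identityˡ _) 1-0 , trans (*-identityʳ _) 1-0)
    where
    1-0 : 1# + - 0# ≈ 1#
    1-0 = trans (+-congˡ (trans (sym (+-identityˡ (- 0#))) (-‿inverseʳ 0#))) (+-identityʳ 1#)

  0<1 : 0# < 1#
  0<1 with Equivalence.to #⇔<⊎> 1#0
  ... | inj₂ 0<1 = 0<1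
  ... | inj₁ 1<0 = <-respʳ square (*-pos 0<-1 0<-1)
    where
    0<-1 : 0# < - 1#
    0<-1 = <-respˡ (-‿inverseʳ 1#) (<-respʳ (+-identityˡ (- 1#)) (+-monoˡ-< (- 1#) 1<0))
    square : - 1# * - 1# ≈ 1#
    square = trans (sym (-‿distribˡ-* 1# (- 1#))) (trans (-‿cong (*-identityˡ (- 1#))) (-‿involutive 1#))

  open Mult semiring using (×-homo-+; ×1-homo-*)

  fromℕ-+ : ∀ m n → fromℕ (m ℕ.+ n) ≈ fromℕ m + fromℕ n
  fromℕ-+ = ×-homo-+ 1#

  fromℕ-* : ∀ m n → fromℕ (m ℕ.* n) ≈ fromℕ m * fromℕ n
  fromℕ-* = ×1-homo-*

  fromℕ-1 : fromℕ 1 ≈ 1#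
  fromℕ-1 = +-identityʳ 1#

  fromℕ-^ : ∀ m n → fromℕ (m ℕ.^ n) ≈ fromℕ m ^ n
  fromℕ-^ m ℕ.zero    = fromℕ-1
  fromℕ-^ m (ℕ.suc n) = trans (fromℕ-* m (m ℕ.^ n)) (*-congˡ (fromℕ-^ m n))

  fromℕ-nonneg : ∀ n → 0# ≤ fromℕ n
  fromℕ-nonneg ℕ.zero    = ≤-refl
  fromℕ-nonneg (ℕ.suc n) = ≤-trans (fromℕ-nonneg n) (x≤y+x {fromℕ n} (<⇒≤ 0<1))

  fromℕ-pos : ∀ {n} → 0 ℕ.< n → 0# < fromℕ n
  fromℕ-pos {ℕ.suc n} _ = <-≤-trans 0<1 (x≤x+y {1#} {fromℕ n} (fromℕ-nonneg n))

  fromℕ-mono : ∀ {m n} → m ℕ.≤ n → fromℕ m ≤ fromℕ n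
  fromℕ-mono {n = n} ℕ.z≤n = fromℕ-nonneg n
  fromℕ-mono (ℕ.s≤s m≤n) = +-monoʳ-≤ 1# (fromℕ-mono m≤n)

  fromℕ-mono-< : ∀ {m n} → m ℕ.< n → fromℕ m < fromℕ n
  fromℕ-mono-< {m} m<n = <-≤-trans (<-respˡ (+-identityˡ _) (+-monoˡ-< (fromℕ m) 0<1)) (fromℕ-mono m<n)

  -- The Archimedean property in the form used to let the mesh of the discretisation tend to 0.
  ≤-by-scaling : ∀ {x y} r → (∀ n → fromℕ n * x ≤ fromℕ n * y + r) → x ≤ y
  ≤-by-scaling {x} {y} r bound y<x
    with d , 0<d , x≈ ← gap y<x
    with d⁻¹ , d⁻¹*d , _ ← #⇒invertible (Equivalence.from #⇔<⊎> (inj₂ 0<d))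
    with n , large ← archimedean (r * d⁻¹) =
    bound n (<-respʳ (sym (trans (*-congˡ x≈) (distribˡ (fromℕ n) y d))) (+-monoʳ-< (fromℕ n * y) r<nd))
    where
    d-0 : d + - 0# ≈ d
    d-0 = trans (+-congˡ (trans (sym (+-identityˡ (- 0#))) (-‿inverseʳ 0#))) (+-identityʳ d)
    r<nd : r < fromℕ n * d
    r<nd = <-respˡ (trans (*-comm d (r * d⁻¹)) (trans (*-assoc r d⁻¹ d) (trans (*-congˡ (trans (*-congˡ (sym d-0)) d⁻¹*d)) (*-identityʳ r))))
             (<-respʳ (*-comm d (fromℕ n)) (*-monoˡ-< 0<d large))

-- Walks, and cutting a shortest path into segments

module Walks {c ℓ₁ ℓ₂} (ℝ : RealField c ℓ₁ ℓ₂) where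

  open OrderedField ℝ
  open SteinerForest ℝ
  open RingSolver commutativeSemiring using (solve; _:+_; _:*_; _:=_)

  ∑-++ : ∀ xs ys → ∑ (xs ++ ys) ≈ ∑ xs + ∑ ys
  ∑-++ []       ys = sym (+-identityˡ _)
  ∑-++ (x ∷ xs) ys = trans (+-congˡ (∑-++ xs ys)) (sym (+-assoc x _ _))

  module _ {n : ℕ} where

    module _ {G : Graph n} where

      append : ∀ {u v w} → Walk G u v → Walk G v w → Walk G u w
      append nil          q = q
      append (step e j p) q = step e j (append p q)

      len-append : ∀ {u v w} (p : Walk G u v) (q : Walk G v w) → len (append p q) ≈ len p + len q
      len-append nil          q = sym (+-identityˡ _)
      len-append (step e j p) q = trans (+-congˡ (len-append p q)) (sym (+-assoc _ _ _))

      reverse : ∀ {u v} → Walk G u v → Walk G v u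
      reverse nil          = nil
      reverse (step e j p) = append (reverse p) (step e (swap j) nil)

      len-reverse : ∀ {u v} (p : Walk G u v) → len (reverse p) ≈ len p
      len-reverse nil          = refl
      len-reverse (step e j p) = trans (len-append (reverse p) _)
        (trans (+-cong (len-reverse p) (+-identityʳ _)) (+-comm _ _))

      laterVertices : ∀ {u v} → Walk G u v → List (Fin n)
      laterVertices nil          = []
      laterVertices (step _ _ p) = vertices p

      vertices-∷ : ∀ {u v} (p : Walk G u v) → vertices p ≡ u ∷ laterVertices p
      vertices-∷ nil          = ≡.refl
      vertices-∷ (step _ _ p) = ≡.refl

    Nonneg : Graph n → Set _
    Nonneg = All (λ e → 0# ≤ weight e)

    module _ {G : Graph n} (G≥0 : Nonneg G) where

      edgeWeight≥0 : ∀ e → 0# ≤ edgeWeight G e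
      edgeWeight≥0 e = All.lookup G≥0 (∈-lookup e)

      len≥0 : ∀ {u v} (p : Walk G u v) → 0# ≤ len p
      len≥0 nil          = ≤-refl
      len≥0 (step e j p) = ≤-trans (len≥0 p) (x≤y+x (edgeWeight≥0 e))

      suffixPath : ∀ {u v x} (p : Walk G u v) → IsPath p → x ∈ vertices p →
                   Σ[ q ∈ Walk G x v ] IsPath q × len q ≤ len p
      suffixPath nil          p! (here ≡.refl) = nil , p! , ≤-refl
      suffixPath (step e j p) p! (here ≡.refl) = step e j p , p! , ≤-refl
      suffixPath (step e j p) (_ ∷ p!) (there x∈) with q , q! , q≤ ← suffixPath p p! x∈ =
        q , q! , ≤-trans q≤ (x≤y+x (edgeWeight≥0 e))

      open DecMembership (Finₚ._≟_ {n}) using (_∈?_)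

      loopErase : ∀ {u v} (p : Walk G u v) → Σ[ q ∈ Walk G u v ] IsPath q × len q ≤ len p
      loopErase nil = nil , [] ∷ [] , ≤-refl
      loopErase (step {u} e j p) with q , q! , q≤ ← loopErase p with u ∈? vertices q
      ... | no u∉ = step e j q , All.tabulate (λ { x∈ ≡.refl → u∉ x∈ }) ∷ q! , +-monoʳ-≤ _ q≤
      ... | yes u∈ with r , r! , r≤ ← suffixPath q q! u∈ =
        r , r! , ≤-trans r≤ (≤-trans q≤ (x≤y+x (edgeWeight≥0 e)))

      shortest-walk : ∀ {u v} {p : Walk G u v} → IsShortestPath p → ∀ q → len p ≤ len q
      shortest-walk (_ , shortest) q with r , r! , r≤ ← loopErase q = ≤-trans (shortest r r!) r≤

    embed : ∀ {G G′ : Graph n} → G ⊆ G′ → ∀ {u v} (p : Walk G u v) → Σ[ q ∈ Walk G′ u v ] len q ≡ len p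
    embed G⊆G′ nil = nil , ≡.refl
    embed {G} {G′} G⊆G′ (step {u} {v} e j p) with q , eq ← embed G⊆G′ p =
      step e′ (≡.subst (λ x → Joins x u v) e≡e′ j) q , ≡.cong₂ _+_ (≡.cong weight (≡.sym e≡e′)) eq
      where
      e∈ : lookup G e ∈ G′
      e∈ = G⊆G′ (∈-lookup e)
      e′ : EdgeOf G′
      e′ = Any.index e∈
      e≡e′ : lookup G e ≡ lookup G′ e′
      e≡e′ = Anyₚ.lookup-index e∈

    shortcut : Fin n × Fin n → Edge n
    shortcut (u , v) = edge u v 0#

    ⊆-⊕ : ∀ {G : Graph n} S → G ⊆ G ⊕ S
    ⊆-⊕ S = ∈-++⁺ˡ

    ⊕-mono : ∀ {G : Graph n} {S S′} → S ⊆ S′ → G ⊕ S ⊆ G ⊕ S′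
    ⊕-mono {G} S⊆S′ e∈ with ∈-++⁻ G e∈
    ... | inj₁ e∈G = ∈-++⁺ˡ e∈G
    ... | inj₂ e∈S with x , x∈ , ≡.refl ← ∈-map⁻ shortcut e∈S = ∈-++⁺ʳ G (∈-map⁺ shortcut (S⊆S′ x∈))

    ⊕-edge : ∀ (G : Graph n) S (e : EdgeOf (G ⊕ S)) →
             (∃[ i ] lookup (G ⊕ S) e ≡ lookup G i) ⊎ (∃[ x ] x ∈ S × lookup (G ⊕ S) e ≡ shortcut x)
    ⊕-edge G S e with ∈-++⁻ G (∈-lookup {xs = G ⊕ S} e)
    ... | inj₁ e∈G = inj₁ (Any.index e∈G , Anyₚ.lookup-index e∈G)
    ... | inj₂ e∈S = inj₂ (∈-map⁻ shortcut e∈S)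

    ⊕-nonneg : ∀ {G : Graph n} → Nonneg G → ∀ S → Nonneg (G ⊕ S)
    ⊕-nonneg G≥0 S = Allₚ.++⁺ G≥0 (Allₚ.map⁺ (All.universal (λ _ → ≤-refl) S))

    record Segment (G : Graph n) : Set c where
      field
        {src tgt} : Fin n
        walk      : Walk G src tgt
      ends : Fin n × Fin n
      ends = src , tgt
      size : Carrier
      size = len walk

    open Segment

    totalLength : ∀ {G} → List (Segment G) → Carrier
    totalLength ss = ∑ (map size ss)

    -- The counterpart of `Star` for real lengths; `H` collects the ends of the earlier segments.
    data Ordered {G : Graph n} (H : Shortcuts n) : List (Segment G) → Set (c ⊔ ℓ₂) where
      []  : Ordered H []
      _∷_ : ∀ {s ss} → (∀ (q : Walk (G ⊕ H) (src s) (tgt s)) → size s ≤ len q) →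
            Ordered (ends s ∷ H) ss → Ordered H (s ∷ ss)

    push : ∀ {G} → List (Segment G) → Shortcuts n → Shortcuts n
    push []       H = H
    push (s ∷ ss) H = push ss (ends s ∷ H)

    ∈-push⁻ : ∀ {G} (ss : List (Segment G)) {H x} → x ∈ push ss H → x ∈ H ⊎ (∃[ s ] s ∈ ss × x ≡ ends s)
    ∈-push⁻ []       x∈ = inj₁ x∈
    ∈-push⁻ (s ∷ ss) x∈ with ∈-push⁻ ss x∈
    ... | inj₁ (here eq)          = inj₂ (s , here ≡.refl , eq)
    ... | inj₁ (there x∈H)        = inj₁ x∈H
    ... | inj₂ (s′ , s′∈ , eq)    = inj₂ (s′ , there s′∈ , eq)

    ordered-++ : ∀ {G H} {ss ss′ : List (Segment G)} → Ordered H ss → Ordered (push ss H) ss′ → Ordered H (ss ++ ss′)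
    ordered-++ []       o′ = o′
    ordered-++ (p ∷ o) o′ = p ∷ ordered-++ o o′

    ordered-lookup : ∀ {G H₀} {ss : List (Segment G)} → Ordered H₀ ss → ∀ i H →
                     (∀ {x} → x ∈ H → x ∈ H₀ ⊎ (∃[ j ] j Fin.< i × x ≡ ends (lookup ss j))) →
                     ∀ (q : Walk (G ⊕ H) (src (lookup ss i)) (tgt (lookup ss i))) → size (lookup ss i) ≤ len q
    ordered-lookup {G} {H₀} (p ∷ o) zero H earlier q = ≤-trans (p (proj₁ embedded)) (≤-reflexive (reflexive (proj₂ embedded)))
      where
      H⊆H₀ : H ⊆ H₀
      H⊆H₀ x∈ with earlier x∈
      ... | inj₁ x∈H₀ = x∈H₀
      ... | inj₂ (_ , () , _)
      embedded : Σ[ q′ ∈ Walk (G ⊕ H₀) _ _ ] len q′ ≡ len q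
      embedded = embed (⊕-mono {G} H⊆H₀) q
    ordered-lookup {G} {H₀} {s ∷ ss} (_ ∷ o) (suc i) H earlier q = ordered-lookup o i H earlier′ q
      where
      earlier′ : ∀ {x} → x ∈ H → x ∈ ends s ∷ H₀ ⊎ (∃[ j ] j Fin.< i × x ≡ ends (lookup ss j))
      earlier′ x∈ with earlier x∈
      ... | inj₁ x∈H₀                          = inj₁ (there x∈H₀)
      ... | inj₂ (zero , _ , eq)               = inj₁ (here eq)
      ... | inj₂ (suc j , ℕ.s≤s j<i , eq)      = inj₂ (j , j<i , eq)

    module Extract {G : Graph n} (G≥0 : Nonneg G) (S : Shortcuts n) {t : Fin n}
                   {Marked : Fin n → Set} (marked? : Decidable Marked) (t-marked : Marked t)
                   (S-marked : ∀ {u v} → (u , v) ∈ S → Marked u × Marked v) where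

      record Extraction (H : Shortcuts n) (x : Fin n) (ys : List (Fin n)) (L : Carrier) : Set (c ⊔ ℓ₁ ⊔ ℓ₂) where
        field
          segments : List (Segment G)
          ordered  : Ordered H segments
          total    : totalLength segments ≈ L
          among    : ∀ {s} → s ∈ segments → ends s ∈ zip (x ∷ ys) ys
          few      : length segments ℕ.≤ length ys

      -- Ends of shortcuts are marked, so the path can enter a shortcut only while the current
      -- segment `A` is empty. Hence segments use edges of `G` only.
      data Status {x : Fin n} : ∀ {w} → Walk G x w → Set where
        fresh : Status nil
        mid   : ∀ {w} {A : Walk G x w} → ¬ Marked w → Status A

      -- Everything after the last hop of H that is not in S is a walk of G ⊕ S.
      tailWalk : ∀ {H Z} → (∀ {u v} → (u , v) ∈ H → (u , v) ∈ S ⊎ (u ∈ Z × v ∈ Z)) →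
                 ∀ {z y} (q : Walk (G ⊕ H) z y) →
                 ∃[ z′ ] (z′ ≡ z ⊎ z′ ∈ Z) × (Σ[ q′ ∈ Walk (G ⊕ S) z′ y ] len q′ ≤ len q)
      tailWalk H⊆ nil = _ , inj₁ ≡.refl , nil , ≤-refl
      tailWalk {H} H⊆ (step {u} {v} e j q) with tailWalk H⊆ q
      ... | z′ , inj₂ z′∈ , q′ , q′≤ = z′ , inj₂ z′∈ , q′ , ≤-trans q′≤ (x≤y+x (edgeWeight≥0 (⊕-nonneg G≥0 H) e))
      ... | .v , inj₁ ≡.refl , q′ , q′≤ = case-edge (⊕-edge G H e)
        where
        via : ∀ {f} → f ∈ G ⊕ S → lookup (G ⊕ H) e ≡ f →
              ∃[ z′ ] (z′ ≡ u ⊎ z′ ∈ _) × (Σ[ q″ ∈ Walk (G ⊕ S) z′ _ ] len q″ ≤ edgeWeight (G ⊕ H) e + len q)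
        via {f} f∈ eq = u , inj₁ ≡.refl ,
          step (Any.index f∈) (≡.subst (λ x → Joins x u v) (≡.trans eq (Anyₚ.lookup-index f∈)) j) q′ ,
          ≤-trans (≤-reflexive (+-congʳ (reflexive (≡.cong weight (≡.trans (≡.sym (Anyₚ.lookup-index f∈)) (≡.sym eq)))))) (+-monoʳ-≤ _ q′≤)
        ends∈ : ∀ {Z x y} → Joins (edge x y 0#) u v → x ∈ Z × y ∈ Z → v ∈ Z
        ends∈ (inj₁ (≡.refl , ≡.refl)) = proj₂
        ends∈ (inj₂ (≡.refl , ≡.refl)) = proj₁
        case-edge : _ → _
        case-edge (inj₁ (i , eq)) = via (∈-++⁺ˡ {xs = G} (∈-lookup {xs = G} i)) eq
        case-edge (inj₂ ((x , y) , xy∈ , eq)) with H⊆ xy∈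
        ... | inj₁ xy∈S = via (∈-++⁺ʳ G (∈-map⁺ shortcut xy∈S)) eq
        ... | inj₂ xy∈Z = v , inj₂ (ends∈ (≡.subst (λ x → Joins x u v) eq j) xy∈Z) , q′ ,
                          ≤-trans q′≤ (x≤y+x (edgeWeight≥0 (⊕-nonneg G≥0 H) e))

      joined-marked : ∀ {x y u v} → (x , y) ∈ S → Joins (edge x y 0#) u v → Marked u × Marked v
      joined-marked xy∈ (inj₁ (≡.refl , ≡.refl)) = S-marked xy∈
      joined-marked xy∈ (inj₂ (≡.refl , ≡.refl)) = Product.swap (S-marked xy∈)

      -- `A` is the current segment, begun at the last marked vertex `x`; `R` is the rest of the
      -- path and `Z` the list of marked vertices passed. Earlier segments of this very path must
      -- count as free too, although Rule 3 acts only after it. They lead only to vertices of `Z`,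
      -- and by `opt`, as the path is shortest, none of these is closer to `t` than `x` is.
      extract : ∀ {w} (R : Walk (G ⊕ S) w t) x (A : Walk G x w) → Status A → ∀ Z H → x ∈ Z →
                (∀ {z} → z ∈ Z → (q : Walk (G ⊕ S) z t) → len A + len R ≤ len q) →
                (∀ {u v} → (u , v) ∈ H → (u , v) ∈ S ⊎ (u ∈ Z × v ∈ Z)) →
                Extraction H x (filter marked? (laterVertices R)) (len A + len R)
      extract nil x A (mid ¬t) Z H x∈ opt H⊆ = contradiction t-marked ¬t
      extract nil x A fresh Z H x∈ opt H⊆ = record
        { segments = [] ; ordered = [] ; total = sym (+-identityʳ 0#) ; among = λ () ; few = ℕ.z≤n }
      extract (step {v = w′} e j R) x A status Z H x∈ opt H⊆ with ⊕-edge G S e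
      extract (step {v = w′} e j R) x A (mid ¬w) Z H x∈ opt H⊆ | inj₂ ((y , z) , yz∈ , eq) =
        contradiction (proj₁ (joined-marked yz∈ (≡.subst (λ f → Joins f _ w′) eq j))) ¬w
      extract (step {v = w′} e j R) x A fresh Z H x∈ opt H⊆ | inj₂ ((y , z) , yz∈ , eq)
        rewrite vertices-∷ R with marked? w′
      ... | no ¬w′ = contradiction (proj₂ (joined-marked yz∈ (≡.subst (λ f → Joins f _ w′) eq j))) ¬w′
      -- A shortcut joins two consecutive marked vertices at length 0 and yields no segment.
      ... | yes _  = record
        { segments = segments ; ordered = ordered ; total = trans total (trans (+-identityˡ _) (sym lenR))
        ; among = there ∘ among ; few = ℕₚ.m≤n⇒m≤1+n few }
        where
        lenR : 0# + (edgeWeight (G ⊕ S) e + len R) ≈ len R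
        lenR = trans (+-identityˡ _) (trans (+-congʳ (reflexive (≡.cong weight eq))) (+-identityˡ _))
        opt′ : ∀ {z} → z ∈ w′ ∷ Z → (q : Walk (G ⊕ S) z t) → 0# + len R ≤ len q
        opt′ (here ≡.refl) q = ≤-trans (≤-reflexive (trans (+-identityˡ _) (sym lenR)))
          (≤-trans (opt x∈ (step e j q)) (≤-reflexive (trans (+-congʳ (reflexive (≡.cong weight eq))) (+-identityˡ _))))
        opt′ (there z∈)    q = ≤-trans (≤-reflexive (trans (+-identityˡ _) (sym lenR))) (opt z∈ q)
        H⊆′ : ∀ {u v} → (u , v) ∈ H → (u , v) ∈ S ⊎ (u ∈ w′ ∷ Z × v ∈ w′ ∷ Z)
        H⊆′ uv∈ with H⊆ uv∈
        ... | inj₁ ∈S        = inj₁ ∈S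
        ... | inj₂ (u∈ , v∈) = inj₂ (there u∈ , there v∈)
        open Extraction (extract R w′ nil fresh (w′ ∷ Z) H (here ≡.refl) opt′ H⊆′)
      extract (step {u = w} {v = w′} e j R) x A status Z H x∈ opt H⊆ | inj₁ (i , eq)
        rewrite vertices-∷ R = arrive
        where
        A′ : Walk G x w′
        A′ = append A (step i (≡.subst (λ f → Joins f w w′) eq j) nil)
        lenA′ : len A′ ≈ len A + edgeWeight (G ⊕ S) e
        lenA′ = trans (len-append A _) (+-congˡ (trans (+-identityʳ _) (reflexive (≡.cong weight (≡.sym eq)))))
        lenA′R : len A + (edgeWeight (G ⊕ S) e + len R) ≈ len A′ + len R
        lenA′R = trans (sym (+-assoc _ _ _)) (+-congʳ (sym lenA′))
        optA′ : ∀ {z} → z ∈ Z → (q : Walk (G ⊕ S) z t) → len A′ + len R ≤ len q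
        optA′ z∈ q = ≤-trans (≤-reflexive (sym lenA′R)) (opt z∈ q)
        arrive : Extraction H x (filter marked? (w′ ∷ laterVertices R)) (len A + (edgeWeight (G ⊕ S) e + len R))
        arrive with marked? w′
        ... | no ¬w′ = record { segments = segments ; ordered = ordered ; total = trans total (sym lenA′R)
                              ; among = among ; few = few }
          where open Extraction (extract R x A′ (mid ¬w′) Z H x∈ optA′ H⊆)
        ... | yes _ = record
          { segments = record { walk = A′ } ∷ segments
          ; ordered  = optimal ∷ ordered
          ; total    = trans (+-congˡ (trans total (+-identityˡ _))) (sym lenA′R)
          ; among    = λ { (here ≡.refl) → here ≡.refl ; (there s∈) → there (among s∈) }
          ; few      = ℕ.s≤s few }
          where
          optimal : (q : Walk (G ⊕ H) x w′) → len A′ ≤ len q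
          -- Behind its last new hop, `q` is a walk of `G ⊕ S` from a vertex of `Z`. Continued by
          -- `R` it reaches `t`, so `opt` bounds it from below.
          optimal q with tailWalk H⊆ q
          ... | z , z∈ , q′ , q′≤ = ≤-trans (+-cancelʳ-≤ (len R)
                  (≤-trans (optA′ (z∈Z z∈) (append q′ R)) (≤-reflexive (len-append q′ R)))) q′≤
            where
            z∈Z : z ≡ x ⊎ z ∈ Z → z ∈ Z
            z∈Z (inj₁ ≡.refl) = x∈
            z∈Z (inj₂ z∈)     = z∈
          opt′ : ∀ {z} → z ∈ w′ ∷ Z → (q : Walk (G ⊕ S) z t) → 0# + len R ≤ len q
          opt′ (there z∈) q = ≤-trans (≤-trans (≤-reflexive (+-identityˡ _)) (x≤y+x (len≥0 G≥0 A′))) (optA′ z∈ q)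
          opt′ (here ≡.refl) q with A″ , eqA ← embed (⊆-⊕ {G} S) A′ = ≤-trans (≤-reflexive (+-identityˡ _)) (lin≤ {X = len A′ + len R}
              (≤-trans (optA′ x∈ (append A″ q)) (≤-reflexive (trans (len-append A″ q) (+-congʳ (reflexive eqA)))))
              (solve 3 (λ r a b → r :+ (a :+ b) := b :+ (a :+ r)) refl (len R) (len A′) (len q)))
          H⊆′ : ∀ {u v} → (u , v) ∈ (x , w′) ∷ H → (u , v) ∈ S ⊎ (u ∈ w′ ∷ Z × v ∈ w′ ∷ Z)
          H⊆′ (here ≡.refl) = inj₂ (there x∈ , here ≡.refl)
          H⊆′ (there uv∈) with H⊆ uv∈
          ... | inj₁ ∈S        = inj₁ ∈S
          ... | inj₂ (u∈ , v∈) = inj₂ (there u∈ , there v∈)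
          open Extraction (extract R w′ nil fresh (w′ ∷ Z) ((x , w′) ∷ H) (here ≡.refl) opt′ H⊆′)

-- The segments of a whole run

∈-zip⁻ : ∀ {a} {A : Set a} {x y : A} xs ys → (x , y) ∈ zip xs ys → x ∈ xs × y ∈ ys
∈-zip⁻ (x ∷ xs) (y ∷ ys) (here ≡.refl) = here ≡.refl , here ≡.refl
∈-zip⁻ (x ∷ xs) (y ∷ ys) (there xy∈) with x∈ , y∈ ← ∈-zip⁻ xs ys xy∈ = there x∈ , there y∈

module RunSegments {c ℓ₁ ℓ₂} (ℝ : RealField c ℓ₁ ℓ₂) where

  open OrderedField ℝ
  open SteinerForest ℝ
  open Walks ℝ

  module _ {n : ℕ} where

    open DecMembership (Finₚ._≟_ {n}) using (_∈?_)
    open Segment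

    Marked : List (Fin n) → Fin n → Fin n → Fin n → Set
    Marked seen s t v = v ≡ s ⊎ (v ≡ t ⊎ v ∈ seen)

    marked? : ∀ seen s t → Decidable (Marked seen s t)
    marked? seen s t v = (v Finₚ.≟ s) ⊎-dec ((v Finₚ.≟ t) ⊎-dec (v ∈? seen))

    marks : ∀ {G : Graph n} → List (Fin n) → ∀ {s t} → Walk G s t → List (Fin n)
    marks seen {s} {t} p = filter (marked? seen s t) (laterVertices p)

    marked-vertices : ∀ {G : Graph n} seen {s t} (p : Walk G s t) →
                      filter (marked? seen s t) (vertices p) ≡ s ∷ marks seen p
    marked-vertices seen {s} {t} p =
      ≡.trans (≡.cong (filter (marked? seen s t)) (vertices-∷ p)) (filter-accept (marked? seen s t) (inj₁ ≡.refl))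

    rule₃-zip : ∀ {G : Graph n} seen {s t} (p : Walk G s t) → rule₃ seen p ≡ zip (s ∷ marks seen p) (marks seen p)
    rule₃-zip seen p = ≡.cong (λ v′ → zip v′ (drop 1 v′)) (marked-vertices seen p)

    marked∈ : ∀ {seen s t v} → Marked seen s t v → v ∈ s ∷ t ∷ seen
    marked∈ (inj₁ ≡.refl)        = here ≡.refl
    marked∈ (inj₂ (inj₁ ≡.refl)) = there (here ≡.refl)
    marked∈ (inj₂ (inj₂ v∈))     = there (there v∈)

    marks⊆ : ∀ {G : Graph n} seen {s t} (p : Walk G s t) → s ∷ marks seen p ⊆ s ∷ t ∷ seen
    marks⊆ seen {s} {t} p v∈ =
      marked∈ (proj₂ (∈-filter⁻ (marked? seen s t) {xs = vertices p} (≡.subst (_ ∈_) (≡.sym (marked-vertices seen p)) v∈)))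

    -- The vertices of a path are distinct, and the marked ones lie in `s ∷ t ∷ seen`; the start `s`
    -- is not counted.
    length-marks : ∀ {G : Graph n} seen {s t} (p : Walk G s t) → IsPath p → length (marks seen p) ℕ.≤ ℕ.suc (length seen)
    length-marks seen {s} {t} p p! = ℕ.s≤s⁻¹ (unique⊆⇒length≤
      (≡.subst Unique (marked-vertices seen p) (Uniqueₚ.filter⁺ (marked? seen s t) p!)) (marks⊆ seen p))

    EndsIn : List (Fin n) → Shortcuts n → Set
    EndsIn seen S = ∀ {u v} → (u , v) ∈ S → u ∈ seen × v ∈ seen

    rule₃-ends : ∀ {G : Graph n} seen {s t} (p : Walk G s t) → EndsIn (s ∷ t ∷ seen) (rule₃ seen p)
    rule₃-ends seen p uv∈
      with u∈ , v∈ ← ∈-zip⁻ (_ ∷ marks seen p) (marks seen p) (≡.subst (_ ∈_) (rule₃-zip seen p) uv∈) =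
      marks⊆ seen p u∈ , marks⊆ seen p (there v∈)

    module _ {G : Graph n} (G≥0 : Nonneg G) (P : Fin n → Set) where

      record Accounting (H : Shortcuts n) (L : Carrier) (bound : ℕ) : Set (c ⊔ ℓ₁ ⊔ ℓ₂) where
        field
          segments : List (Segment G)
          ordered  : Ordered H segments
          total    : totalLength segments ≈ L
          few      : length segments ℕ.≤ bound
          ends-P   : ∀ {s} → s ∈ segments → P (src s) × P (tgt s)

      -- `H` holds only ends of segments, all of which Rule 3 has put into `S`. Each path yields at
      -- most one segment more than there are entries in `seen`, which grows by two, so `k` pairs
      -- yield at most `2k²` segments.
      account : ∀ {seen S ps} (r : Run G seen S ps) H → H ⊆ S → EndsIn seen S → All P seen →
                All (λ (s , t) → P s × P t) ps →
                Accounting H (cost r) (length ps ℕ.* (length seen ℕ.+ 2 ℕ.* length ps))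
      account done H H⊆S S∈ seen-P ps-P = record
        { segments = [] ; ordered = [] ; total = refl ; few = ℕ.z≤n ; ends-P = λ () }
      account {seen} {S} (serve {s} {t} {ps} p shortest r) H H⊆S S∈ seen-P ((sP , tP) ∷ ps-P) = record
        { segments = E.segments ++ A.segments
        ; ordered  = ordered-++ E.ordered A.ordered
        ; total    = trans (reflexive (≡.cong ∑ (map-++ size E.segments A.segments)))
                       (trans (∑-++ (map size E.segments) (map size A.segments))
                         (+-cong (trans E.total (+-identityˡ _)) A.total))
        ; few      = few
        ; ends-P   = ends-P }
        where
        module X = Extract G≥0 S (marked? seen s t) (inj₂ (inj₁ ≡.refl))
                     (λ uv∈ → inj₂ (inj₂ (proj₁ (S∈ uv∈))) , inj₂ (inj₂ (proj₂ (S∈ uv∈))))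
        extraction : X.Extraction H s (marks seen p) (0# + len p)
        extraction = X.extract p s nil X.fresh (s ∷ []) H (here ≡.refl)
          (λ { (here ≡.refl) q → ≤-trans (≤-reflexive (+-identityˡ _)) (shortest-walk (⊕-nonneg G≥0 S) shortest q) })
          (inj₁ ∘ H⊆S)
        module E = X.Extraction extraction
        S′∈ : EndsIn (s ∷ t ∷ seen) (S ++ rule₃ seen p)
        S′∈ uv∈ with ∈-++⁻ S uv∈
        ... | inj₁ ∈S = there (there (proj₁ (S∈ ∈S))) , there (there (proj₂ (S∈ ∈S)))
        ... | inj₂ ∈r = rule₃-ends seen p ∈r
        H′⊆ : push E.segments H ⊆ S ++ rule₃ seen p
        H′⊆ x∈ with ∈-push⁻ E.segments x∈
        ... | inj₁ x∈H                  = ∈-++⁺ˡ (H⊆S x∈H)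
        ... | inj₂ (g , g∈ , ≡.refl)    = ∈-++⁺ʳ S (≡.subst (ends g ∈_) (≡.sym (rule₃-zip seen p)) (E.among g∈))
        seen′-P : All P (s ∷ t ∷ seen)
        seen′-P = sP ∷ tP ∷ seen-P
        module A = Accounting (account r (push E.segments H) H′⊆ S′∈ seen′-P ps-P)
        few : length (E.segments ++ A.segments) ℕ.≤ ℕ.suc (length ps) ℕ.* (length seen ℕ.+ 2 ℕ.* ℕ.suc (length ps))
        few = ℕₚ.≤-trans (ℕₚ.≤-reflexive (length-++ E.segments))
          (ℕₚ.≤-trans (ℕₚ.+-mono-≤ (ℕₚ.≤-trans E.few (length-marks seen p (proj₁ shortest))) A.few)
            (lin (1 ℕ.+ 2 ℕ.* length ps) (ℕₚ.≤-refl {0}) (arith (length seen) (length ps))))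
          where
          arith : ∀ σ k → ℕ.suc σ ℕ.+ k ℕ.* (ℕ.suc (ℕ.suc σ) ℕ.+ 2 ℕ.* k) ℕ.+ 0 ℕ.+ (1 ℕ.+ 2 ℕ.* k) ≡
                          ℕ.suc k ℕ.* (σ ℕ.+ 2 ℕ.* ℕ.suc k) ℕ.+ 0
          arith = solve-∀
        ends-P : ∀ {g} → g ∈ E.segments ++ A.segments → P (src g) × P (tgt g)
        ends-P g∈ with ∈-++⁻ E.segments g∈
        ... | inj₂ g∈A = A.ends-P g∈A
        ... | inj₁ g∈E with u∈ , v∈ ← ∈-zip⁻ (s ∷ marks seen p) (marks seen p) (E.among g∈E) =
          All.lookup seen′-P (marks⊆ seen p u∈) , All.lookup seen′-P (marks⊆ seen p (there v∈))

-- Rounding distances to integers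

least : ∀ {ℓ} {P : ℕ → Set ℓ} B → P B → ¬ ¬ (∃[ m ] P m × (∀ k → P k → m ℕ.≤ k))
least {P = P} B pB none = below (ℕ.suc B) B ℕₚ.≤-refl pB
  where
  below : ∀ n i → i ℕ.< n → ¬ P i
  below (ℕ.suc n) i (ℕ.s≤s i≤n) pi with ℕₚ.m≤n⇒m<n∨m≡n i≤n
  ... | inj₁ i<n    = below n i i<n pi
  ... | inj₂ ≡.refl = none (n , pi , λ k pk → ℕₚ.≮⇒≥ (λ k<n → below n k k<n pk))

-- Lets the rounded distances of all pairs of vertices be chosen at once.
¬¬-∀Fin : ∀ {ℓ} n {P : Fin n → Set ℓ} → (∀ i → ¬ ¬ P i) → ¬ ¬ (∀ i → P i)
¬¬-∀Fin ℕ.zero    ¬¬P = λ ¬all → ¬all λ ()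
¬¬-∀Fin (ℕ.suc n) ¬¬P = ¬¬-bind (¬¬P zero) λ p → ¬¬-bind (¬¬-∀Fin n (¬¬P ∘ suc)) λ ps ¬all →
  ¬all λ { zero → p ; (suc i) → ps i }

-- The lower bound is strict because logarithms are compared through `<`.
power-bracket : ∀ n → 2 ℕ.≤ n → ∃[ L ] 2 ℕ.^ L ℕ.< n × n ℕ.≤ 2 ℕ.^ ℕ.suc L
power-bracket 1 (ℕ.s≤s ())
power-bracket 2 _ = 0 , ℕₚ.≤-refl , ℕₚ.≤-refl
power-bracket (ℕ.suc n@(ℕ.suc (ℕ.suc _))) _ with power-bracket n (ℕ.s≤s (ℕ.s≤s ℕ.z≤n))
... | L , lo , hi with ℕₚ.m≤n⇒m<n∨m≡n hi
...   | inj₁ n<    = L , ℕₚ.m≤n⇒m≤1+n lo , n<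
...   | inj₂ n≡    = ℕ.suc L , ℕₚ.≤-reflexive (≡.cong ℕ.suc (≡.sym n≡)) ,
  ℕₚ.≤-trans (ℕₚ.≤-reflexive (≡.cong ℕ.suc n≡))
    (ℕₚ.+-mono-≤ (ℕₚ.m^n>0 2 (ℕ.suc L)) (ℕₚ.≤-reflexive (≡.sym (ℕₚ.+-identityʳ (2 ℕ.^ ℕ.suc L)))))

module Discretise {c ℓ₁ ℓ₂} (ℝ : RealField c ℓ₁ ℓ₂) where

  open OrderedField ℝ
  open SteinerForest ℝ
  open Walks ℝ
  open RunSegments ℝ
  open RingSolver commutativeSemiring using (solve; _:+_; _:*_; _:=_)
  open Segment

  N*-mono : ∀ N {x y} → x ≤ y → fromℕ N * x ≤ fromℕ N * y
  N*-mono N = *-monoˡ-≤ (fromℕ-nonneg N)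

  module _ {n : ℕ} {G : Graph n} (G≥0 : Nonneg G) (N Big : ℕ) where

    -- The cap Big keeps the distance between unconnected vertices finite.
    Reach : Fin n → Fin n → ℕ → Set ℓ₂
    Reach x y m = (Σ[ p ∈ Walk G x y ] fromℕ N * len p ≤ fromℕ m) ⊎ Big ℕ.≤ m

    -- `D` is the distance in `G` times `N`, rounded up and capped at `Big`.
    record Distance : Set ℓ₂ where
      field
        D         : Fin n → Fin n → ℕ
        reach     : ∀ x y → Reach x y (D x y)
        minimal   : ∀ {x y m} → Reach x y m → D x y ℕ.≤ m

    distance : ¬ ¬ Distance
    distance = ¬¬-bind (¬¬-∀Fin n λ x → ¬¬-∀Fin n λ y → least {P = Reach x y} Big (inj₂ ℕₚ.≤-refl)) λ f ¬D →
      ¬D (record { D = λ x y → proj₁ (f x y) ; reach = λ x y → proj₁ (proj₂ (f x y))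
                 ; minimal = λ r → proj₂ (proj₂ (f _ _)) _ r })

    module Properties (dist : Distance) where
      open Distance dist

      D-refl : ∀ x → D x x ≡ 0
      D-refl x = ℕₚ.n≤0⇒n≡0 (minimal (inj₁ (nil , ≤-reflexive (zeroʳ (fromℕ N)))))

      D-sym : ∀ x y → D x y ≡ D y x
      D-sym x y = ℕₚ.≤-antisym (flip≤ x y) (flip≤ y x)
        where
        flip≤ : ∀ x y → D x y ℕ.≤ D y x
        flip≤ x y with reach y x
        ... | inj₂ big     = minimal (inj₂ big)
        ... | inj₁ (p , h) = minimal (inj₁ (reverse p , ≤-trans (≤-reflexive (*-congˡ (len-reverse p))) h))

      D-tri : ∀ x y z → D x z ℕ.≤ D x y ℕ.+ D y z
      D-tri x y z with reach x y | reach y z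
      ... | inj₂ big | _        = minimal (inj₂ (ℕₚ.≤-trans big (ℕₚ.m≤m+n _ _)))
      ... | inj₁ _   | inj₂ big = minimal (inj₂ (ℕₚ.≤-trans big (ℕₚ.m≤n+m _ (D x y))))
      ... | inj₁ (p , h) | inj₁ (q , h′) = minimal (inj₁ (append p q ,
        ≤-trans (≤-reflexive (trans (*-congˡ (len-append p q)) (distribˡ (fromℕ N) _ _)))
          (≤-trans (+-mono-≤ h h′) (≤-reflexive (sym (fromℕ-+ (D x y) (D y z)))))))

      D≤Big : ∀ x y → D x y ℕ.≤ Big
      D≤Big x y = minimal (inj₂ ℕₚ.≤-refl)

      module OnSegments (ss : List (Segment G)) (ordered : Ordered [] ss)
                        (Big-large : ∀ {s} → s ∈ ss → fromℕ N * size s ≤ fromℕ Big) where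

        m : ℕ
        m = length ss

        seg : Fin m → Segment G
        seg = lookup ss

        a b : Fin m → Fin n
        a e = src (seg e)
        b e = tgt (seg e)

        earlier : Fin m → Shortcuts n
        earlier e = map (λ j → ends (seg j)) (filter (Finₚ._<? e) (allFin m))

        earlier⁻ : ∀ e {x} → x ∈ earlier e → x ∈ [] ⊎ (∃[ j ] j Fin.< e × x ≡ ends (seg j))
        earlier⁻ e x∈ with j , j∈ , eq ← ∈-map⁻ (λ j → ends (seg j)) x∈ =
          inj₂ (j , proj₂ (∈-filter⁻ (Finₚ._<? e) {xs = allFin m} j∈) , eq)

        open Contraction D D-refl D-sym D-tri a b

        hopWalk : ∀ {H : Shortcuts n} {e u v} → ends (seg e) ∈ H → Ends e u v → Σ[ q ∈ Walk (G ⊕ H) u v ] len q ≈ 0#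
        hopWalk {H} {e} {u} {v} e∈ uv =
          step (Any.index f∈) (≡.subst (λ x → Joins x u v) f≡ (joins uv)) nil ,
          trans (+-identityʳ _) (reflexive (≡.cong weight (≡.sym f≡)))
          where
          f∈ : shortcut (ends (seg e)) ∈ G ⊕ H
          f∈ = ∈-++⁺ʳ G (∈-map⁺ shortcut e∈)
          f≡ : shortcut (ends (seg e)) ≡ lookup (G ⊕ H) (Any.index f∈)
          f≡ = Anyₚ.lookup-index f∈
          joins : Ends e u v → Joins (shortcut (ends (seg e))) u v
          joins (inj₁ (p , q)) = inj₁ (≡.sym p , ≡.sym q)
          joins (inj₂ (p , q)) = inj₂ (≡.sym q , ≡.sym p)

        -- A connection with a capped gap costs at least `Big`; any other is realised by a walk that
        -- takes the hops as shortcuts.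
        conn-walk : ∀ {e x y d} → Conn (Fin._< e) x y d →
                    (Σ[ q ∈ Walk (G ⊕ earlier e) x y ] fromℕ N * len q ≤ fromℕ d) ⊎ Big ℕ.≤ d
        conn-walk {e} {x} {y} (gap D≤d) with reach x y
        ... | inj₂ big = inj₂ (ℕₚ.≤-trans big D≤d)
        ... | inj₁ (p , h) with q , eq ← embed (⊆-⊕ {G = G} (earlier e)) p =
          inj₁ (q , ≤-trans (≤-reflexive (*-congˡ (reflexive eq))) (≤-trans h (fromℕ-mono D≤d)))
        conn-walk {e} {x} {y} {d} (hop {e = f} {u} {v} {g} {d′} D≤g f<e uv w total) with reach x u | conn-walk {e} w
        ... | inj₂ big | _ = inj₂ (ℕₚ.≤-trans big (ℕₚ.≤-trans D≤g (ℕₚ.≤-trans (ℕₚ.m≤m+n g d′) total)))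
        ... | inj₁ _ | inj₂ big = inj₂ (ℕₚ.≤-trans big (ℕₚ.≤-trans (ℕₚ.m≤n+m d′ g) total))
        ... | inj₁ (p , h) | inj₁ (q , h′)
          with p′ , eq ← embed (⊆-⊕ {G = G} (earlier e)) p
             | r , r≈0 ← hopWalk {earlier e} {f} (∈-map⁺ (λ j → ends (seg j)) (∈-filter⁺ (Finₚ._<? e) (∈-allFin f) f<e)) uv =
          inj₁ (append p′ (append r q) , short)
          where
          short : fromℕ N * len (append p′ (append r q)) ≤ fromℕ d
          short = ≤-trans (≤-reflexive (trans (*-congˡ (trans (len-append p′ (append r q))
              (+-cong (reflexive eq) (trans (len-append r q) (trans (+-congʳ r≈0) (+-identityˡ _))))))
              (distribˡ (fromℕ N) (len p) (len q))))
            (≤-trans (+-mono-≤ (≤-trans h (fromℕ-mono D≤g)) h′)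
              (≤-trans (≤-reflexive (sym (fromℕ-+ g d′))) (fromℕ-mono total)))

        star : Star
        star e {d} w with conn-walk w
        ... | inj₂ big     = ℕₚ.≤-trans (D≤Big _ _) big
        ... | inj₁ (q , h) = minimal (inj₁ (walk (seg e) ,
          ≤-trans (N*-mono N (ordered-lookup ordered e (earlier e) (earlier⁻ e) q)) h))

        -- Rounding goes upwards, and `Big` is at least every scaled segment length, so neither
        -- rounding nor the cap loses cost.
        size≤D : ∀ e → fromℕ N * size (seg e) ≤ fromℕ (D (a e) (b e))
        size≤D e with reach (a e) (b e)
        ... | inj₂ big     = ≤-trans (Big-large (∈-lookup e)) (fromℕ-mono big)
        ... | inj₁ (p , h) with q , eq ← embed (⊆-⊕ {G = G} []) p =
          ≤-trans (N*-mono N (≤-trans (ordered-lookup ordered e [] (λ ()) q) (≤-reflexive (reflexive eq)))) h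

        sum-size≤ : ∀ es → fromℕ N * ∑ (map (size ∘ seg) es) ≤ fromℕ (sum (map (λ e → D (a e) (b e)) es))
        sum-size≤ []       = ≤-reflexive (zeroʳ (fromℕ N))
        sum-size≤ (e ∷ es) = ≤-trans (≤-reflexive (distribˡ (fromℕ N) _ _))
          (≤-trans (+-mono-≤ (size≤D e) (sum-size≤ es)) (≤-reflexive (sym (fromℕ-+ (D (a e) (b e)) _))))

        totalLength≤ : fromℕ N * totalLength ss ≤ fromℕ (sum (map (λ e → D (a e) (b e)) (allFin m)))
        totalLength≤ = ≤-trans (≤-reflexive (*-congˡ (reflexive (≡.cong ∑ lists)))) (sum-size≤ (allFin m))
          where
          lists : map size ss ≡ map (size ∘ seg) (allFin m)
          lists = ≡.trans (≡.cong (map size) (≡.sym (tabulate-lookup ss)))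
                    (≡.trans (map-tabulate seg size) (≡.sym (map-tabulate id (size ∘ seg))))

      -- Rounding adds at most 1 per edge, an error that does not grow with `N`.
      edge-distance : ∀ e → fromℕ (D (end₁ (lookup G e)) (end₂ (lookup G e))) ≤ fromℕ N * edgeWeight G e + 1#
      edge-distance e with D (end₁ (lookup G e)) (end₂ (lookup G e)) in eq
      ... | ℕ.zero  = ≤-trans (*-nonneg (fromℕ-nonneg N) (edgeWeight≥0 G≥0 e)) (x≤x+y (<⇒≤ 0<1))
      ... | ℕ.suc d = ≤-trans (≤-reflexive (+-comm 1# (fromℕ d))) (+-monoˡ-≤ 1# λ Nw<d →
        ℕₚ.<⇒≱ (ℕₚ.≤-reflexive (≡.sym eq)) (minimal (inj₁ (step e (inj₁ (≡.refl , ≡.refl)) nil ,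
          ≤-trans (≤-reflexive (*-congˡ (+-identityʳ _))) (<⇒≤ Nw<d)))))

      sum-edge-distance : ∀ es → fromℕ (sum (map (λ e → D (end₁ (lookup G e)) (end₂ (lookup G e))) es)) ≤
                                 fromℕ N * ∑ (map (edgeWeight G) es) + fromℕ (length es)
      sum-edge-distance []       = ≤-reflexive (sym (trans (+-congʳ (zeroʳ (fromℕ N))) (+-identityʳ 0#)))
      sum-edge-distance (e ∷ es) = ≤-trans (≤-reflexive (fromℕ-+ (D (end₁ (lookup G e)) (end₂ (lookup G e))) _))
        (≤-trans (+-mono-≤ (edge-distance e) (sum-edge-distance es))
          (≤-reflexive (solve 5 (λ N w o s l → (N :* w :+ o) :+ (N :* s :+ l) := N :* (w :+ s) :+ (o :+ l)) refl
            (fromℕ N) (edgeWeight G e) 1# (∑ (map (edgeWeight G) es)) (fromℕ (length es)))))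

  big-enough : ∀ {A : Set c} (f : A → Carrier) xs → ∃[ B ] (∀ {x} → x ∈ xs → f x ≤ fromℕ B)
  big-enough f [] = 0 , λ ()
  big-enough f (x ∷ xs) with B , rest ← big-enough f xs | B′ , fx< ← archimedean (f x) = B ℕ.⊔ B′ ,
    λ { (here ≡.refl) → ≤-trans (<⇒≤ fx<) (fromℕ-mono (ℕₚ.m≤n⊔m B B′))
      ; (there x∈)    → ≤-trans (rest x∈) (fromℕ-mono (ℕₚ.m≤m⊔n B B′)) }

  module _ {n : ℕ} {G : Graph n} (T : Subgraph G)
           (connected : ∀ {u v} → u Subset.∈ V′ T → v Subset.∈ V′ T → ConnectedIn T u v) where

    treeEdges : List (EdgeOf G)
    treeEdges = filter (Subsetₚ._∈? E′ T) (allFin (length G))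

    module _ {A : List (Fin n)} (D : Fin n → Fin n → ℕ) (D-refl : ∀ x → D x x ≡ 0)
             (D-sym : ∀ x y → D x y ≡ D y x) (D-tri : ∀ x y z → D x z ℕ.≤ D x y ℕ.+ D y z) where

      open Tours D D-refl D-sym D-tri

      -- A walk in the tree that left `A` would have to use a crossing edge.
      reached : (∀ {e} → e ∈ treeEdges → ¬ Crossing (end₁ ∘ lookup G) (end₂ ∘ lookup G) A e) →
                ∀ {u v} (p : Walk G u v) → p Within T → u ∈ A → v ∈ A
      reached closed nil          _          u∈ = u∈
      reached closed (step {u} {v} e j p) (e∈ ∷ within) u∈ = reached closed p within (next j)
        where
        open import Data.List.Membership.DecPropositional (Finₚ._≟_ {n}) using () renaming (_∈?_ to _∈ˡ?_)
        ¬crossing : ¬ Crossing (end₁ ∘ lookup G) (end₂ ∘ lookup G) A e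
        ¬crossing = closed (∈-filter⁺ (Subsetₚ._∈? E′ T) (∈-allFin e) e∈)
        next : Joins (lookup G e) u v → v ∈ A
        next j with v ∈ˡ? A
        ... | yes v∈ = v∈
        next (inj₁ (≡.refl , ≡.refl)) | no v∉ = contradiction (inj₁ (u∈ , v∉)) ¬crossing
        next (inj₂ (≡.refl , ≡.refl)) | no v∉ = contradiction (inj₂ (u∈ , v∉)) ¬crossing

-- From the integral bound to the theorem

module CostBound {c₀ ℓ₁ ℓ₂} (ℝ : RealField c₀ ℓ₁ ℓ₂)
                 (c : ℕ) (c-large : 32 ℕ.* 54 ℕ.+ 25 ℕ.≤ c) (s : ℕ) (1≤s : 1 ℕ.≤ s) (s≤18 : s ℕ.≤ 18)
                 (c-small : 48 ℕ.* c ℕ.≤ 2 ℕ.^ s) where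

  open OrderedField ℝ
  open SteinerForest ℝ
  open Walks ℝ
  open RunSegments ℝ
  open Discretise ℝ
  open RingSolver commutativeSemiring using (solve; _:+_; _:*_; _:=_)
  open Instance

  factor : ℕ → ℕ → ℕ
  factor H L = 36 ℕ.* (c ℕ.* H) ℕ.* (18 ℕ.* ℕ.suc L)

  first-terminal : ∀ I (T : Subgraph (graph I)) → IsFeasible I T → 0 ℕ.< #pairs I → ∃[ x ] x Subset.∈ V′ T
  first-terminal I T feasible 0<k with pairs I | feasible | 0<k
  ... | []          | _                      | ()
  ... | (s , t) ∷ _ | ((s∈ , _) ∷ _)         | _ = s , s∈

  cost≤factor*tree : ∀ (I : Instance) (run : Greedy₃ I) (T : Subgraph (graph I)) → IsTreeSolution I T →
                     0 ℕ.< #pairs I → ∀ H L → 1 ℕ.≤ H → L ℕ.≤ H → H ℕ.≤ 2 ℕ.^ L →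
                     #pairs I ℕ.* (2 ℕ.* #pairs I) ℕ.≤ 2 ℕ.^ H →
                     cost run ≤ fromℕ (factor H L ℕ.* 2) * totalWeight T
  cost≤factor*tree I run T (feasible , connected , _) 0<k H L 1≤H L≤H H≤2^L k≤ =
    -- The error consists of the rounding of `t` tree edges and the summand `1 + m` of the tour
    -- bound. It is independent of `N`, so refining the mesh removes it.
    ≤-by-scaling (fromℕ (Q ℕ.* 2) * fromℕ t + fromℕ (Q ℕ.* (1 ℕ.+ length ss))) scaled
    where
    G : Graph (size I)
    G = graph I

    Q t : ℕ
    Q = factor H L
    t = length (treeEdges T connected)

    accounting : Accounting {G = G} (nonneg I) (Subset._∈ V′ T) [] (cost run) _
    accounting = account (nonneg I) (Subset._∈ V′ T) run [] (λ ()) (λ ()) []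
                   (All.map (λ { {_ , _} (s∈ , t∈ , _) → s∈ , t∈ }) feasible)

    open Accounting accounting renaming (segments to ss)

    root : Fin (size I)
    root = proj₁ (first-terminal I T feasible 0<k)

    scaled : ∀ N → fromℕ N * cost run ≤ fromℕ N * (fromℕ (Q ℕ.* 2) * totalWeight T) +
                                        (fromℕ (Q ℕ.* 2) * fromℕ t + fromℕ (Q ℕ.* (1 ℕ.+ length ss)))
    scaled N = ¬¬-bind (distance (nonneg I) N Big) discretised
      where
      Big : ℕ
      Big = proj₁ (big-enough (λ g → fromℕ N * Segment.size g) ss)

      discretised : Distance (nonneg I) N Big → _
      discretised dist =
        ≤-trans (≤-reflexive (*-congˡ (sym total)))
        (≤-trans totalLength≤
        (≤-trans (fromℕ-mono (ℕₚ.≤-trans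
          (TourDistance.tour-bound tour root∈ a b
             (λ e → terminal∈ (proj₁ (ends-P (∈-lookup e)))) (λ e → terminal∈ (proj₂ (ends-P (∈-lookup e))))
             star c c-large s 1≤s s≤18 c-small H L 1≤H L≤H H≤2^L m≤)
          (ℕₚ.≤-trans (ℕₚ.*-monoʳ-≤ Q (ℕₚ.+-monoˡ-≤ m (ℕ.s≤s short)))
            (ℕₚ.≤-reflexive (expand Q S m)))))
        (≤-trans (≤-reflexive (trans (fromℕ-+ (Q ℕ.* 2 ℕ.* S) (Q ℕ.* (1 ℕ.+ m))) (+-congʳ (fromℕ-* (Q ℕ.* 2) S))))
        (≤-trans (+-monoˡ-≤ _ (*-monoˡ-≤ (fromℕ-nonneg (Q ℕ.* 2)) (sum-edge-distance (treeEdges T connected))))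
          (≤-reflexive (solve 5 (λ q N W l r → q :* (N :* W :+ l) :+ r := N :* (q :* W) :+ (q :* l :+ r)) refl
            (fromℕ (Q ℕ.* 2)) (fromℕ N) (totalWeight T) (fromℕ t) (fromℕ (Q ℕ.* (1 ℕ.+ m)))))))))
        where
        open Distance dist using (D)
        open Properties (nonneg I) N Big dist
        open OnSegments ss ordered (proj₂ (big-enough (λ g → fromℕ N * Segment.size g) ss))
        open Tours D D-refl D-sym D-tri
        S : ℕ
        S = sum (map (λ e → D (end₁ (lookup G e)) (end₂ (lookup G e))) (treeEdges T connected))
        covering : Covering (end₁ ∘ lookup G) (end₂ ∘ lookup G) (treeEdges T connected) (root ∷ []) (0 ℕ.+ 2 ℕ.* S)
        covering = cover (end₁ ∘ lookup G) (end₂ ∘ lookup G) (treeEdges T connected) (treeEdges T connected) (start root) inj₁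
        open Covering covering using (A′; tour; short; A⊆A′)
        root∈ : root ∈ A′
        root∈ = A⊆A′ (here ≡.refl)
        terminal∈ : ∀ {x} → x Subset.∈ V′ T → x ∈ A′
        terminal∈ x∈ with _ , _ , p , within ← connected (proj₂ (first-terminal I T feasible 0<k)) x∈ =
          reached T connected D D-refl D-sym D-tri (Covering.closed covering) p within root∈
        m≤ : m ℕ.≤ 2 ℕ.^ H
        m≤ = ℕₚ.≤-trans few k≤
        expand : ∀ Q S m → Q ℕ.* (ℕ.suc (2 ℕ.* S) ℕ.+ m) ≡ Q ℕ.* 2 ℕ.* S ℕ.+ Q ℕ.* (1 ℕ.+ m)
        expand = solve-∀

  module _ {x y : Carrier} (log : y IsLog₂Of x) where

    log-lower : ∀ n p q → fromℕ (2 ℕ.^ p) < x ^ n * fromℕ (2 ℕ.^ q) → fromℕ p < fromℕ n * y + fromℕ q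
    log-lower n p q lt = Equivalence.from (proj₁ (log n p q))
      (<-respˡ (fromℕ-^ 2 p) (<-respʳ (*-congˡ (fromℕ-^ 2 q)) lt))

  1* : ∀ x → fromℕ 1 * x ≈ x
  1* x = trans (*-congʳ fromℕ-1) (*-identityˡ x)

  x^2 : ∀ x → x ^ 2 ≈ x * x
  x^2 x = *-congˡ (*-identityʳ x)

  log-ℕ : ∀ k {y} → y IsLog₂Of fromℕ k → ∀ n p → 2 ℕ.^ p ℕ.< k ℕ.^ n → fromℕ p < fromℕ n * y
  log-ℕ k {y} log n p lt = <-respʳ (+-identityʳ _) (log-lower log n p 0
    (<-respʳ (trans (fromℕ-^ k n) (sym (trans (*-congˡ fromℕ-1) (*-identityʳ _)))) (fromℕ-mono-< lt)))

  module Logarithms {k : ℕ} (3≤k : 3 ℕ.≤ k) {logk loglogk : Carrier}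
                    (log : logk IsLog₂Of fromℕ k) (loglog : loglogk IsLog₂Of logk) where

    -- From `2 ^ 3 < 3 ^ 2`; it absorbs the summand 3 of `H`.
    3<2logk : fromℕ 3 < fromℕ 2 * logk
    3<2logk = log-ℕ k log 2 3 (ℕₚ.≤-trans (ℕₚ.≤ᵇ⇒≤ 9 (3 ℕ.^ 2) _) (ℕₚ.^-monoˡ-≤ 2 3≤k))

    0<logk : 0# < logk
    0<logk = <-≤-trans (fromℕ-pos {1} (ℕ.s≤s ℕ.z≤n))
      (<⇒≤ (<-respʳ (1* logk) (log-ℕ k log 1 1 (ℕₚ.≤-trans 3≤k (ℕₚ.≤-reflexive (≡.sym (ℕₚ.*-identityʳ k)))))))

    module _ (L : ℕ) (lo : 2 ℕ.^ L ℕ.< k) where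

      -- From `k ≤ 2 ^ (L + 1)` follows `k · 2k ≤ 2 ^ (2L + 3)`, the bound on the number of
      -- segments.
      H : ℕ
      H = 2 ℕ.* L ℕ.+ 3

      L<logk : fromℕ L < logk
      L<logk = <-respʳ (1* logk) (log-ℕ k log 1 L (ℕₚ.<-≤-trans lo (ℕₚ.≤-reflexive (≡.sym (ℕₚ.*-identityʳ k)))))

      fromℕ-H : fromℕ H ≈ fromℕ 2 * fromℕ L + fromℕ 3
      fromℕ-H = trans (fromℕ-+ (2 ℕ.* L) 3) (+-congʳ (fromℕ-* 2 L))

      H<4logk : fromℕ H < fromℕ 4 * logk
      H<4logk = <-respˡ (sym fromℕ-H) (<-respʳ four (<-trans
        (+-monoˡ-< (fromℕ 3) (*-monoˡ-< (fromℕ-pos {2} (ℕ.s≤s ℕ.z≤n)) L<logk)) (+-monoʳ-< _ 3<2logk)))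
        where
        four : fromℕ 2 * logk + fromℕ 2 * logk ≈ fromℕ 4 * logk
        four = trans (sym (distribʳ logk (fromℕ 2) (fromℕ 2))) (*-congʳ (sym (fromℕ-+ 2 2)))

      -- From `(2 log k)² > 9 > 2 ^ 3`. For small `k` this lower bound absorbs the additive
      -- constants.
      1<2loglogk : 1# < fromℕ 2 * loglogk
      1<2loglogk = +-cancelʳ-< (fromℕ 2) (<-respˡ (trans (fromℕ-+ 1 2) (+-congʳ fromℕ-1)) (log-lower loglog 2 3 2
        (<-≤-trans (<-respʳ (fromℕ-* 3 3) (fromℕ-mono-< (ℕₚ.≤ᵇ⇒≤ 9 9 _)))
          (≤-trans (*-mono-≤ (fromℕ-nonneg 3) (<⇒≤ (<-≤-trans (fromℕ-pos {3} (ℕ.s≤s ℕ.z≤n)) (<⇒≤ 3<2logk)))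
                     (<⇒≤ 3<2logk) (<⇒≤ 3<2logk))
            (≤-reflexive (trans (solve 2 (λ t x → (t :* x) :* (t :* x) := x :* x :* (t :* t)) refl (fromℕ 2) logk)
              (*-cong (sym (x^2 logk)) (sym (fromℕ-* 2 2)))))))))

      -- `2 ^ L′ < H < 4 log k` gives `L′ < log log k + 2`, and the remaining 4 is at most
      -- `8 log log k`.
      L′+2≤9loglogk : ∀ L′ → 2 ℕ.^ L′ ℕ.< H → fromℕ (ℕ.suc (ℕ.suc L′)) ≤ fromℕ 9 * loglogk
      L′+2≤9loglogk L′ lo′ = ≤-trans (<⇒≤ (<-respʳ rearrange (+-monoʳ-< 1# (+-monoʳ-< 1# L′<))))
        (≤-trans (+-monoˡ-≤ loglogk (+-mono-≤ (+-mono-≤ 1≤ 1≤) (+-mono-≤ 1≤ 1≤)))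
          (≤-reflexive (trans eight (*-congʳ (sym nine)))))
        where
        1≤ : 1# ≤ fromℕ 2 * loglogk
        1≤ = <⇒≤ 1<2loglogk
        L′< : fromℕ L′ < loglogk + fromℕ 2
        L′< = <-respʳ (+-congʳ (1* loglogk)) (log-lower loglog 1 L′ 2
          (<-≤-trans (fromℕ-mono-< lo′) (≤-trans (<⇒≤ H<4logk)
            (≤-reflexive (trans (*-comm (fromℕ 4) logk) (*-congʳ (sym (*-identityʳ logk))))))))
        rearrange : 1# + (1# + (loglogk + fromℕ 2)) ≈ 1# + 1# + (1# + 1#) + loglogk
        rearrange = trans (+-congˡ (+-congˡ (+-congˡ (+-congˡ (+-identityʳ 1#)))))
          (solve 2 (λ o y → o :+ (o :+ (y :+ (o :+ o))) := o :+ o :+ (o :+ o) :+ y) refl 1# loglogk)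
        eight : fromℕ 2 * loglogk + fromℕ 2 * loglogk + (fromℕ 2 * loglogk + fromℕ 2 * loglogk) + loglogk ≈
                (fromℕ 2 + fromℕ 2 + (fromℕ 2 + fromℕ 2) + fromℕ 1) * loglogk
        eight = trans (+-congˡ (sym (1* loglogk)))
          (solve 3 (λ t o y → t :* y :+ t :* y :+ (t :* y :+ t :* y) :+ o :* y := (t :+ t :+ (t :+ t) :+ o) :* y)
            refl (fromℕ 2) (fromℕ 1) loglogk)
        nine : fromℕ 9 ≈ fromℕ 2 + fromℕ 2 + (fromℕ 2 + fromℕ 2) + fromℕ 1
        nine = trans (fromℕ-+ 8 1) (+-congʳ (trans (fromℕ-+ 4 4) (+-cong (fromℕ-+ 2 2) (fromℕ-+ 2 2))))

  -- 36, `c` and 18 come from `factor`, 2 from going around the tree, 4 and 9 from passing to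
  -- `log k` and `log log k`.
  constant : ℕ
  constant = 36 ℕ.* c ℕ.* 18 ℕ.* 2 ℕ.* (4 ℕ.* 9)

  0<c : 0 ℕ.< c
  0<c = ℕₚ.≤-trans (ℕₚ.m≤n⇒m≤o+n (32 ℕ.* 54) (ℕ.s≤s ℕ.z≤n)) c-large

  constant-pos : 0# < fromℕ constant
  constant-pos = fromℕ-pos (ℕₚ.*-mono-≤ (ℕₚ.*-mono-≤ {1} {_} {1} (ℕₚ.*-mono-≤ {1} {_} {1} (ℕₚ.*-mono-≤ {1} {36} {1} (ℕ.s≤s ℕ.z≤n) 0<c)
    (ℕ.s≤s (ℕ.z≤n {17}))) (ℕ.s≤s (ℕ.z≤n {1}))) (ℕ.s≤s (ℕ.z≤n {35})))

  totalWeight≥0 : ∀ {n} {G : Graph n} → Nonneg G → (T : Subgraph G) → 0# ≤ totalWeight T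
  totalWeight≥0 {G = G} G≥0 T = go (filter (Subsetₚ._∈? E′ T) (allFin (length G)))
    where
    go : ∀ es → 0# ≤ ∑ (map (edgeWeight G) es)
    go []       = ≤-refl
    go (e ∷ es) = ≤-trans (go es) (x≤y+x (edgeWeight≥0 G≥0 e))

  cost-bound : ∀ (I : Instance) → 3 ℕ.≤ #pairs I →
               ∀ (run : Greedy₃ I) (T⋆ : Subgraph (graph I)) → IsOptimalTreeSolution I T⋆ →
               ∀ (logk loglogk : Carrier) → logk IsLog₂Of fromℕ (#pairs I) → loglogk IsLog₂Of logk →
               cost run ≤ fromℕ constant * logk * loglogk * totalWeight T⋆
  cost-bound I 3≤k run T⋆ (solution , _) logk loglogk log loglog
    with L , lo , hi ← power-bracket (#pairs I) (ℕₚ.≤-trans (ℕₚ.n≤1+n 2) 3≤k)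
    with L′ , lo′ , hi′ ← power-bracket (2 ℕ.* L ℕ.+ 3) (ℕₚ.m≤n⇒m≤o+n (2 ℕ.* L) (ℕₚ.n≤1+n 2)) =
    ≤-trans (cost≤factor*tree I run T⋆ solution (ℕₚ.≤-trans (ℕ.s≤s ℕ.z≤n) 3≤k) (H L lo) (ℕ.suc L′)
               (ℕₚ.m≤n⇒m≤o+n (2 ℕ.* L) (ℕ.s≤s ℕ.z≤n)) (ℕₚ.≤-trans (n<2^n L′) (ℕₚ.<⇒≤ lo′)) hi′ pairs≤)
            (*-monoʳ-≤ (totalWeight≥0 (nonneg I) T⋆)
               (≤-trans (≤-reflexive (trans (reflexive (≡.cong fromℕ (rearrange 36 c 18 (H L lo) (ℕ.suc (ℕ.suc L′)))))
                   (trans (fromℕ-* (36 ℕ.* c ℕ.* 18 ℕ.* 2) (H L lo ℕ.* ℕ.suc (ℕ.suc L′))) (*-congˡ (fromℕ-* (H L lo) (ℕ.suc (ℕ.suc L′)))))))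
               (≤-trans (*-monoˡ-≤ (fromℕ-nonneg (36 ℕ.* c ℕ.* 18 ℕ.* 2))
                   (*-mono-≤ (fromℕ-nonneg (ℕ.suc (ℕ.suc L′))) (*-nonneg (fromℕ-nonneg 4) (<⇒≤ 0<logk))
                      (<⇒≤ (H<4logk L lo)) (L′+2≤9loglogk L lo L′ lo′)))
               (≤-reflexive (trans (solve 5 (λ K f n x y → K :* ((f :* x) :* (n :* y)) := K :* (f :* n) :* x :* y) refl
                   (fromℕ (36 ℕ.* c ℕ.* 18 ℕ.* 2)) (fromℕ 4) (fromℕ 9) logk loglogk)
                   (*-congʳ (*-congʳ (sym (trans (fromℕ-* (36 ℕ.* c ℕ.* 18 ℕ.* 2) (4 ℕ.* 9)) (*-congˡ (fromℕ-* 4 9)))))))))))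
    where
    open Logarithms 3≤k log loglog
    rearrange : ∀ p c q H G → p ℕ.* (c ℕ.* H) ℕ.* (q ℕ.* G) ℕ.* 2 ≡ p ℕ.* c ℕ.* q ℕ.* 2 ℕ.* (H ℕ.* G)
    rearrange = solve-∀
    pairs≤ : #pairs I ℕ.* (2 ℕ.* #pairs I) ℕ.≤ 2 ℕ.^ (2 ℕ.* L ℕ.+ 3)
    pairs≤ = ℕₚ.≤-trans (ℕₚ.*-mono-≤ hi (ℕₚ.*-monoʳ-≤ 2 hi))
      (ℕₚ.≤-reflexive (≡.trans (≡.sym (ℕₚ.^-distribˡ-+-* 2 (ℕ.suc L) (ℕ.suc (ℕ.suc L)))) (≡.cong (2 ℕ.^_) (exponent L))))
      where
      exponent : ∀ L → ℕ.suc L ℕ.+ ℕ.suc (ℕ.suc L) ≡ 2 ℕ.* L ℕ.+ 3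
      exponent = solve-∀

theorem1p2 : ∀ {c ℓ₁ ℓ₂} (ℝ : RealField c ℓ₁ ℓ₂) →
  let open RealField ℝ
      open SteinerForest ℝ
      open Instance
  in
  ∃[ C ] (0# < C ×
    (∀ (I : Instance) → 3 ℕ.≤ #pairs I →
     ∀ (run : Greedy₃ I) (T⋆ : Subgraph (graph I)) → IsOptimalTreeSolution I T⋆ →
     ∀ (logk loglogk : Carrier) → logk IsLog₂Of fromℕ (#pairs I) → loglogk IsLog₂Of logk →
     cost run ≤ C * logk * loglogk * totalWeight T⋆))
theorem1p2 ℝ = fromℕ constant , constant-pos , cost-bound
  where
  open RealField ℝ using (fromℕ)
  -- The requirements are `32 · 54 + 25 = 1753 ≤ 2048` and `48 · 2048 ≤ 2 ^ 17`.
  open CostBound ℝ 2048 (ℕₚ.≤ᵇ⇒≤ _ _ _) 17 (ℕₚ.≤ᵇ⇒≤ _ _ _) (ℕₚ.≤ᵇ⇒≤ _ _ _) (ℕₚ.≤ᵇ⇒≤ _ _ _)
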